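{- Let $(G,\sigma)$ be a finite connected unbalanced signed graph satisfying $CD^\sigma(0,N)$ for some $N\in(1,\infty]$. Then \[ \mathrm{vol}(G)\leq 8\sqrt{\left(1+\sqrt{(N-1)/N}\right)\ln 2}\cdot d\,\iota^\sigma(G)\sqrt{(D+1)\lceil(D+1)/2\rceil}, \] where $d$ is the maximal vertex degree, $D$ the diameter, $\mathrm{vol}(G)=\sum_{x\in V}d_x$, and $\sqrt{(N-1)/N}:=1$ when $N=\infty$.
   Context: $G=(V,E)$ is a finite simple connected graph with degrees $d_x$; $\sigma:E\to\{\pm1\}$, $\sigma_{xy}=\sigma(\{x,y\})$; $(G,\sigma)$ is balanced if every cycle has sign product $+1$, unbalanced otherwise. The frustration index is $\iota^\sigma(G)=\min_{\tau:V\to\{\pm1\}}\sum_{\{x,y\}\in E}|\tau(x)-\sigma_{xy}\tau(y)|$. Signed Laplacian $\Delta^{\sigma}f(x)=\frac{1}{d_x}\sum_{y\sim x}(\sigma_{xy}f(y)-f(x))$; $\Delta$ is the case $\sigma\equiv+1$. $\Gamma^{\sigma}(f,g)=\frac12\{\Delta(fg)-g\Delta^{\sigma}f-f\Delta^{\sigma}g\}$, $\Gamma_2^{\sigma}(f,g)=\frac12\{\Delta\Gamma^{\sigma}(f,g)-\Gamma^{\sigma}(g,\Delta^{\sigma}f)-\Gamma^{\sigma}(f,\Delta^{\sigma}g)\}$. $CD^{\sigma}(K,N)$ means $\Gamma_2^{\sigma}(f,f)(x)\ge\frac1N(\Delta^\sigma f)^2(x)+K\Gamma^\sigma(f,f)(x)$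 for all $f:V\to\mathbb{R}$, $x\in V$ ($\frac1N=0$ if $N=\infty$). $\lceil\cdot\rceil$ is the ceiling. -}

module Defs where

open import Algebra.Apartness.Bundles using (HeytingCommutativeRing; HeytingField)
open import Algebra.Bundles using (CommutativeRing)
import Algebra.Definitions.RawMonoid as RawMonoidDefinitions
open import Algebra.Properties.Monoid.Sum using (sum)
open import Data.Bool using (if_then_else_; _∧_)
open import Data.Fin using (Fin; zero; suc; inject₁; fromℕ; _<?_)
import Data.Integer as ℤ
open import Data.Nat as ℕ using (ℕ; zero; suc)
open import Data.Nat.Properties using (+-0-monoid)
open import Data.Product using (Σ; ∃-syntax; _×_; proj₁)
open import Data.Sign as Sign using (Sign)
open import Data.Sum using (_⊎_; inj₂)
open import Data.Vec.Functional using (Vector; foldr; _∷_)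
open import Function.Bundles using (_⇔_; Equivalence)
open import Function.Definitions using (Injective)
open import Level using (Lift; 0ℓ; _⊔_) renaming (suc to lsuc)
open import Relation.Binary using (Rel; Decidable; Symmetric; Irreflexive; IsStrictPartialOrder)
open import Relation.Binary.Construct.Closure.ReflexiveTransitive using (Star; fold)
open import Relation.Binary.PropositionalEquality using (_≡_)
open import Relation.Nullary using (¬_; does)

private variable
  n : ℕ

-- Axioms for ℝ: a Cauchy complete Archimedean ordered field.  Classically this
-- determines ℝ up to unique isomorphism.  The axioms are phrased with an
-- apartness relation, and without decidable order, so that they are also
-- satisfied by the constructive Cauchy reals.
record RealNumbers c ℓ₁ ℓ₂ : Set (lsuc (c ⊔ ℓ₁ ⊔ ℓ₂)) where
  infix 4 _<_ _≤_

  field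
    heytingField : HeytingField c ℓ₁ ℓ₂

  open HeytingField heytingField public

  commutativeRing : CommutativeRing c ℓ₁
  commutativeRing = HeytingCommutativeRing.commutativeRing heytingCommutativeRing

  open CommutativeRing commutativeRing public
    using (+-rawMonoid; +-monoid)
  open RawMonoidDefinitions +-rawMonoid using () renaming (_×_ to _•_)

  ofℕ : ℕ → Carrier
  ofℕ k = k • 1#

  field
    _<_         : Rel Carrier ℓ₂
    isOrder     : IsStrictPartialOrder _≈_ _<_
    #⇔<⊎>       : ∀ {x y} → x # y ⇔ (x < y ⊎ y < x)
    0<1         : 0# < 1#
    +-monoˡ-<   : ∀ z {x y} → x < y → x + z < y + z
    *-positive  : ∀ {x y} → 0# < x → 0# < y → 0# < x * y
    archimedean : ∀ x → ∃[ k ] x < ofℕ k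

  IsCauchy : (ℕ → Carrier) → Set (c ⊔ ℓ₂)
  IsCauchy u = ∀ ε → 0# < ε → ∃[ k ] ∀ i j → k ℕ.≤ i → k ℕ.≤ j → u i - u j < ε

  ConvergesTo : (ℕ → Carrier) → Carrier → Set (c ⊔ ℓ₂)
  ConvergesTo u a =
    ∀ ε → 0# < ε → ∃[ k ] ∀ i → k ℕ.≤ i → (u i - a < ε) × (a - u i < ε)

  field
    complete : ∀ u → IsCauchy u → ∃[ a ] ConvergesTo u a

  _≤_ : Rel Carrier ℓ₂
  x ≤ y = ¬ (y < x)

  -- #⇒invertible inverts differences, so this is literally (x - 0#)⁻¹.
  inv : ∀ x → 0# < x → Carrier
  inv x 0<x = proj₁ (#⇒invertible (Equivalence.from #⇔<⊎> (inj₂ 0<x)))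

  private
    module O = IsStrictPartialOrder isOrder

  0<ofℕ : ∀ k → 0# < ofℕ (suc k)
  0<ofℕ zero    = O.<-respʳ-≈ (sym (+-identityʳ 1#)) 0<1
  0<ofℕ (suc k) =
    O.trans (0<ofℕ k) (O.<-respˡ-≈ (+-identityˡ _) (+-monoˡ-< (ofℕ (suc k)) 0<1))

  -- The value at 0 is a convention.  It is only reachable as 1/dₓ at an isolated
  -- vertex, where it multiplies an empty sum.
  1/ℕ : ℕ → Carrier
  1/ℕ zero    = 0#
  1/ℕ (suc k) = inv (ofℕ (suc k)) (0<ofℕ k)

  ½ : Carrier
  ½ = 1/ℕ 2

  IsSqrt : Carrier → Carrier → Set (ℓ₁ ⊔ ℓ₂)
  IsSqrt a r = (0# ≤ r) × (r * r ≈ a)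

  -- expTerm y k = yᵏ / k!
  expTerm : Carrier → ℕ → Carrier
  expTerm y zero    = 1#
  expTerm y (suc k) = expTerm y k * (y * 1/ℕ (suc k))

  expSum : Carrier → ℕ → Carrier
  expSum y zero    = 0#
  expSum y (suc k) = expSum y k + expTerm y k

  IsExp : Carrier → Carrier → Set (c ⊔ ℓ₂)
  IsExp y a = ConvergesTo (expSum y) a

  IsLn : Carrier → Carrier → Set (c ⊔ ℓ₂)
  IsLn a y = IsExp y a

record Graph (n : ℕ) : Set₁ where
  infix 4 _∼_ _∼?_
  field
    _∼_   : Rel (Fin n) 0ℓ
    _∼?_  : Decidable _∼_
    ∼-sym : Symmetric _∼_
    ∼-irr : Irreflexive _≡_ _∼_

  Walk : Rel (Fin n) 0ℓ
  Walk = Star _∼_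

  length : ∀ {x y} → Walk x y → ℕ
  length = fold (λ _ _ → ℕ) (λ _ k → suc k) 0

  Connected : Set
  Connected = ∀ x y → Walk x y

  degree : Fin n → ℕ
  degree x = sum +-0-monoid (λ y → if does (x ∼? y) then 1 else 0)

  maxDegree : ℕ
  maxDegree = foldr ℕ._⊔_ 0 degree

  volume : ℕ
  volume = sum +-0-monoid degree

  IsDistance : Fin n → Fin n → ℕ → Set
  IsDistance x y k =
    (Σ (Walk x y) λ w → length w ≡ k) × (∀ (w : Walk x y) → k ℕ.≤ length w)

  IsDiameter : ℕ → Set
  IsDiameter D =
    (∃[ x ] ∃[ y ] IsDistance x y D) × (∀ x y k → IsDistance x y k → k ℕ.≤ D)

  -- A cycle v₀ ∼ v₁ ∼ … ∼ vₘ₊₂ ∼ v₀ on at least three, pairwise distinct, vertices.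
  record Cycle : Set where
    field
      m        : ℕ
      vertex   : Fin (3 ℕ.+ m) → Fin n
      distinct : Injective _≡_ _≡_ vertex
      steps    : ∀ (i : Fin (2 ℕ.+ m)) → vertex (inject₁ i) ∼ vertex (suc i)
      closes   : vertex (fromℕ (2 ℕ.+ m)) ∼ vertex zero

-- The sign of an edge {x , y} is σ x y; the values of σ at non-adjacent pairs are
-- never used.
record Signature (G : Graph n) : Set where
  open Graph G
  field
    σ     : Fin n → Fin n → Sign
    σ-sym : ∀ {x y} → x ∼ y → σ x y ≡ σ y x

allPositive : (G : Graph n) → Signature G
allPositive G = record { σ = λ _ _ → Sign.+ ; σ-sym = λ _ → _≡_.refl }

-- The minimum of a function of n signs.
minOverSigns : ∀ n → (Vector Sign n → ℕ) → ℕ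
minOverSigns zero    F = F λ ()
minOverSigns (suc n) F =
  minOverSigns n (λ τ → F (Sign.+ ∷ τ)) ℕ.⊓ minOverSigns n (λ τ → F (Sign.- ∷ τ))

module _ {G : Graph n} (S : Signature G) where
  open Graph G
  open Signature S

  cycleSign : Cycle → Sign
  cycleSign C =
    foldr Sign._*_ Sign.+ (λ i → σ (vertex (inject₁ i)) (vertex (suc i)))
      Sign.* σ (vertex (fromℕ (2 ℕ.+ m))) (vertex zero)
    where open Cycle C

  Balanced : Set
  Balanced = ∀ C → cycleSign C ≡ Sign.+

  Unbalanced : Set
  Unbalanced = ¬ Balanced

  -- Each edge {x , y} is counted once, at its ordered representative x < y; the
  -- summand is symmetric in x and y.
  frustration : Vector Sign n → ℕ
  frustration τ =
    sum +-0-monoid λ x → sum +-0-monoid λ y →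
      if does (x ∼? y) ∧ does (x <? y)
      then ℤ.∣ (τ x ℤ.◃ 1) ℤ.- ((σ x y Sign.* τ y) ℤ.◃ 1) ∣
      else 0

  frustrationIndex : ℕ
  frustrationIndex = minOverSigns n frustration

module SignedCalculus {c ℓ₁ ℓ₂} (ℝ : RealNumbers c ℓ₁ ℓ₂) where
  open RealNumbers ℝ

  -- The dimension parameter N ∈ (1 , ∞].
  data Dimension : Set (c ⊔ ℓ₂) where
    finite : ∀ N → 1# < N → Dimension
    ∞      : Dimension

  private
    1<⇒0< : ∀ {N} → 1# < N → 0# < N
    1<⇒0< 1<N = IsStrictPartialOrder.trans isOrder 0<1 1<N

  1/ᴺ : Dimension → Carrier
  1/ᴺ (finite N 1<N) = inv N (1<⇒0< 1<N)
  1/ᴺ ∞              = 0#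

  -- q = √((N-1)/N), read as 1 when N = ∞.
  IsSqrt[N-1/N] : Dimension → Carrier → Set (ℓ₁ ⊔ ℓ₂)
  IsSqrt[N-1/N] (finite N 1<N) q = IsSqrt ((N - 1#) * inv N (1<⇒0< 1<N)) q
  IsSqrt[N-1/N] ∞              q = Lift ℓ₂ (q ≈ 1#)

  signed : Sign → Carrier → Carrier
  signed Sign.+ a = a
  signed Sign.- a = - a

  module _ {G : Graph n} where
    open Graph G

    Fun : Set c
    Fun = Fin n → Carrier

    Δ[_] : Signature G → Fun → Fun
    Δ[ S ] f x =
      1/ℕ (degree x) *
        sum +-monoid (λ y → if does (x ∼? y) then signed (σ x y) (f y) - f x else 0#)
      where open Signature S

    Δ : Fun → Fun
    Δ = Δ[ allPositive G ]

    module _ (S : Signature G) where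

      Γ : Fun → Fun → Fun
      Γ f g x = ½ * ((Δ (λ y → f y * g y) x - g x * Δ[ S ] f x) - f x * Δ[ S ] g x)

      Γ₂ : Fun → Fun → Fun
      Γ₂ f g x = ½ * ((Δ (Γ f g) x - Γ g (Δ[ S ] f) x) - Γ f (Δ[ S ] g) x)

      CD : Carrier → Dimension → Set (c ⊔ ℓ₂)
      CD K N = ∀ f x →
        1/ᴺ N * (Δ[ S ] f x * Δ[ S ] f x) + K * Γ f f x ≤ Γ₂ f f x

{-# OPTIONS --safe #-}

-- Let τ attain the frustration index ι and let u₀ = τ, uₖ₊₁ = uₖ + s Δ^σ uₖ be the
-- explicit Euler scheme for the heat flow, with a tiny time step s.  Up to an error
-- vanishing with s, CD^σ(0,∞) gives the reverse Poincaré inequality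
-- u² + 2tΓ^σ(u) ≤ 1 at time t = sk.
--
-- The bound on Γ^σ is used twice.  First, since (G,σ) is unbalanced, every vertex x
-- is reached by two walks from a common vertex, of lengths at most D and D + 1 and
-- of opposite sign; integrating the gradient along them bounds 2|u(x)| by D + 1
-- increments, so that |u| ≤ 1/2 (roughly) at time t = 2d(D+1)².  By self-adjointness
-- ⟨τ, u⟩ ≤ vol(G)/4 at time T = 4d(D+1)².  Second, ⟨τ, u⟩ starts at vol(G) and
-- decays at rate at most ι max|σu(y) - u(x)| ≤ ι √(d/t), because only the frustrated
-- edges contribute.  Integrating over [0,T] yields 3/4 vol(G) ≤ 2ι √(dT), that is
-- vol(G) ≤ (16/3) ι d (D+1), and (28/5) ι d (D+1) with the discretisation errors.
--
-- The constant of the theorem is only slightly larger: ln 2 ≥ 2/3, and testing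
-- CD^σ(0,N) on the indicator of a vertex all of whose neighbours have degree at
-- least 2 gives N ≥ 8/5, so that √((N-1)/N) ≥ 3/5.
--
-- The conclusion is a negation, so the order may be used classically throughout.
module Submission where

open import Defs
open import Algebra.Bundles using (RawRing; CommutativeRing)
import Algebra.Properties.Monoid.Sum as MonoidSum
import Algebra.Properties.Ring as RingProperties
import Algebra.Properties.Semiring.Mult as SemiringMult
import Algebra.Properties.Semiring.Sum as SemiringSum
import Algebra.Solver.Ring as RingSolver
open import Algebra.Solver.Ring.AlmostCommutativeRing using (fromCommutativeRing; _-Raw-AlmostCommutative⟶_)
open import Data.Bool using (if_then_else_; _∧_)
open import Data.Empty using (⊥; ⊥-elim)
open import Data.Fin as Fin using (Fin; zero; suc)
import Data.Fin.Properties as Finₚ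
open import Data.Integer as ℤ using (ℤ; +_; -[1+_]; _⊖_; _◃_)
import Data.Integer.Properties as ℤₚ
open import Data.Maybe using (Maybe; just; nothing)
open import Data.Nat as ℕ using (ℕ; zero; suc; ⌈_/2⌉)
import Data.Nat.Properties as ℕₚ
import Data.Nat.Tactic.RingSolver as ℕ-Solver
open import Data.Product using (Σ; ∃-syntax; _×_; _,_; proj₁; proj₂)
open import Data.Sign as Sign using (Sign)
import Data.Sign.Properties as Signₚ
open import Data.Sum using (_⊎_; inj₁; inj₂)
open import Data.Vec.Functional using (Vector; foldr; _∷_)
open import Function using (_∘_)
open import Function.Bundles using (Equivalence)
open import Level using (0ℓ; lift)
open import Relation.Binary using (IsStrictPartialOrder; Poset)
open import Relation.Binary.Construct.Closure.ReflexiveTransitive using (ε; _◅_)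
open import Relation.Binary.PropositionalEquality as ≡ using (_≡_; _≢_)
import Relation.Binary.Reasoning.PartialOrder as PartialOrderReasoning
open import Relation.Nullary using (¬_; Dec; yes; no; does)
open import Relation.Nullary.Decidable using (_×-dec_)

-- The Euler scheme is used instead of the heat semigroup because it is polynomial in the Laplacian:
-- every estimate becomes a ring identity together with a sum of visibly nonnegative terms, and
-- neither operator exponentials nor derivatives or integrals occur. Each step costs an error of
-- order s², and there are of order 1/s steps, so the total error is of order s.
--
-- The other obstacle is the rate √(d/t), since no square roots of reals are constructed. With s =
-- 1/(d h²) and h a natural number, the rate at step k is √(d/(sk)) = d h/√k. Cutting the steps into
-- blocks between consecutive squares then replaces √k by a natural number, and the integral of 1/√t
-- by a sum over blocks.
--
-- There is room for rational rounding. From √(m⌈m/2⌉) ≥ m/√2 with m = D + 1, together with ln 2 ≥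
-- 2/3 and √((N-1)/N) ≥ 3/5, the right-hand side is at least 8√(8/15) d ι (D+1), and 8√(8/15) >
-- 5.84. The target 28/5 lies between this and the ideal 16/3, so an error of one per cent in the
-- reverse Poincaré inequality is affordable.

module OrderedField {c ℓ₁ ℓ₂} (ℝ : RealNumbers c ℓ₁ ℓ₂) where
  open RealNumbers ℝ hiding (zero)
  open CommutativeRing commutativeRing using (ring; semiring; rawRing)
  open RingProperties ring using (-‿involutive; -0#≈0#; -‿distribˡ-*; -‿distribʳ-*; -‿+-comm)
  open SemiringMult semiring using (×-homo-+; ×1-homo-*)
  open IsStrictPartialOrder isOrder using ()
    renaming (trans to <-trans; irrefl to <-irrefl; <-respʳ-≈ to <-respʳ; <-respˡ-≈ to <-respˡ)

  private variable
    w x y z : Carrier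

  ofℕ-+ : ∀ m n → ofℕ (m ℕ.+ n) ≈ ofℕ m + ofℕ n
  ofℕ-+ = ×-homo-+ 1#

  ofℕ-* : ∀ m n → ofℕ (m ℕ.* n) ≈ ofℕ m * ofℕ n
  ofℕ-* = ×1-homo-*

  ofℕ-1 : ofℕ 1 ≈ 1#
  ofℕ-1 = +-identityʳ 1#

  -- Sending 0 and 1 to the literal 0# and 1# lets the ring solver be applied
  -- to goals mentioning these constants.
  fromℤ : ℤ → Carrier
  fromℤ (+ 0)           = 0#
  fromℤ (+ 1)           = 1#
  fromℤ (+ suc (suc n)) = ofℕ (suc (suc n))
  fromℤ -[1+ n ]        = - ofℕ (suc n)

  private
    fromℤ-+ᵥ : ∀ n → fromℤ (+ n) ≈ ofℕ n
    fromℤ-+ᵥ 0             = refl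
    fromℤ-+ᵥ 1             = sym ofℕ-1
    fromℤ-+ᵥ (suc (suc n)) = refl

    cancel : ∀ a b → (1# + a) - (1# + b) ≈ a - b
    cancel a b = begin
      (1# + a) + - (1# + b)     ≈⟨ +-cong (+-comm 1# a) (sym (-‿+-comm 1# b)) ⟩
      (a + 1#) + (- 1# + - b)   ≈⟨ +-assoc a 1# _ ⟩
      a + (1# + (- 1# + - b))   ≈⟨ +-congˡ (sym (+-assoc 1# (- 1#) (- b))) ⟩
      a + ((1# + - 1#) + - b)   ≈⟨ +-congˡ (+-congʳ (-‿inverseʳ 1#)) ⟩
      a + (0# + - b)            ≈⟨ +-congˡ (+-identityˡ (- b)) ⟩
      a - b                     ∎
      where open import Relation.Binary.Reasoning.Setoid setoid

    fromℤ-⊖ : ∀ m n → fromℤ (m ⊖ n) ≈ ofℕ m - ofℕ n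
    fromℤ-⊖ m zero = trans (fromℤ-+ᵥ m) (sym (trans (+-congˡ -0#≈0#) (+-identityʳ _)))
    fromℤ-⊖ zero (suc n) = sym (+-identityˡ _)
    fromℤ-⊖ (suc m) (suc n) rewrite ℤₚ.[1+m]⊖[1+n]≡m⊖n m n =
      trans (fromℤ-⊖ m n) (sym (cancel (ofℕ m) (ofℕ n)))

    fromℤ-homo-+ : ∀ i j → fromℤ (i ℤ.+ j) ≈ fromℤ i + fromℤ j
    fromℤ-homo-+ (+ m) (+ n) =
      trans (fromℤ-+ᵥ (m ℕ.+ n))
        (trans (ofℕ-+ m n) (sym (+-cong (fromℤ-+ᵥ m) (fromℤ-+ᵥ n))))
    fromℤ-homo-+ (+ m) -[1+ n ] = trans (fromℤ-⊖ m (suc n)) (+-congʳ (sym (fromℤ-+ᵥ m)))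
    fromℤ-homo-+ -[1+ m ] (+ n) =
      trans (fromℤ-⊖ n (suc m)) (trans (+-comm _ _) (+-congˡ (sym (fromℤ-+ᵥ n))))
    fromℤ-homo-+ -[1+ m ] -[1+ n ] =
      trans (-‿cong (trans (+-congˡ (ofℕ-+ (suc m) n)) (regroup (ofℕ (suc m)) (ofℕ n))))
        (sym (-‿+-comm _ _))
      where
      regroup : ∀ a b → 1# + (a + b) ≈ a + (1# + b)
      regroup a b = trans (sym (+-assoc 1# a b)) (trans (+-congʳ (+-comm 1# a)) (+-assoc a 1# b))

    fromℤ-neg : ∀ n → fromℤ (Sign.- ◃ n) ≈ - ofℕ n
    fromℤ-neg zero    = sym -0#≈0#
    fromℤ-neg (suc n) = refl

    fromℤ-pos : ∀ n → fromℤ (Sign.+ ◃ n) ≈ ofℕ n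
    fromℤ-pos n rewrite ℤₚ.+◃n≡+n n = fromℤ-+ᵥ n

    fromℤ-homo-* : ∀ i j → fromℤ (i ℤ.* j) ≈ fromℤ i * fromℤ j
    fromℤ-homo-* (+ m) (+ n) =
      trans (fromℤ-pos (m ℕ.* n))
        (trans (ofℕ-* m n) (sym (*-cong (fromℤ-+ᵥ m) (fromℤ-+ᵥ n))))
    fromℤ-homo-* (+ m) -[1+ n ] =
      trans (fromℤ-neg (m ℕ.* suc n))
        (trans (-‿cong (ofℕ-* m (suc n)))
          (trans (-‿distribʳ-* _ _) (*-congʳ (sym (fromℤ-+ᵥ m)))))
    fromℤ-homo-* -[1+ m ] (+ n) =
      trans (fromℤ-neg (suc m ℕ.* n))
        (trans (-‿cong (ofℕ-* (suc m) n))
          (trans (-‿distribˡ-* _ _) (*-congˡ (sym (fromℤ-+ᵥ n)))))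
    fromℤ-homo-* -[1+ m ] -[1+ n ] =
      trans (fromℤ-pos (suc m ℕ.* suc n))
        (trans (ofℕ-* (suc m) (suc n))
          (trans (sym (-‿involutive _))
            (trans (-‿cong (-‿distribˡ-* _ _)) (-‿distribʳ-* _ _))))

    fromℤ-homo-neg : ∀ i → fromℤ (ℤ.- i) ≈ - fromℤ i
    fromℤ-homo-neg (+ 0)           = sym -0#≈0#
    fromℤ-homo-neg (+ 1)           = -‿cong ofℕ-1
    fromℤ-homo-neg (+ suc (suc n)) = refl
    fromℤ-homo-neg -[1+ n ]        = trans (fromℤ-+ᵥ (suc n)) (sym (-‿involutive _))

    ℤ-rawRing : RawRing 0ℓ 0ℓ
    ℤ-rawRing = record
      { Carrier = ℤ ; _≈_ = _≡_ ; _+_ = ℤ._+_ ; _*_ = ℤ._*_ ; -_ = ℤ.-_ ; 0# = + 0 ; 1# = + 1 }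

    homomorphism : ℤ-rawRing -Raw-AlmostCommutative⟶ fromCommutativeRing commutativeRing
    homomorphism = record
      { ⟦_⟧    = fromℤ
      ; +-homo = fromℤ-homo-+
      ; *-homo = fromℤ-homo-*
      ; -‿homo = fromℤ-homo-neg
      ; 0-homo = refl
      ; 1-homo = refl
      }

    fromℤ-≟ : ∀ i j → Maybe (fromℤ i ≈ fromℤ j)
    fromℤ-≟ i j with i ℤ.≟ j
    ... | yes ≡.refl = just refl
    ... | no  _      = nothing

  open RingSolver ℤ-rawRing (fromCommutativeRing commutativeRing) homomorphism fromℤ-≟ public
    using (solve; _:=_; _:+_; _:*_; _:-_; :-_; con)


  -- Order lemmas for a field whose order is not decidable.

  ≤-refl : x ≤ x
  ≤-refl = <-irrefl refl

  ≤-reflexive : x ≈ y → x ≤ y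
  ≤-reflexive x≈y y<x = <-irrefl (sym x≈y) y<x

  <⇒≤ : x < y → x ≤ y
  <⇒≤ x<y y<x = <-irrefl refl (<-trans x<y y<x)

  private
    -- Inherited from cotransitivity of apartness; it takes the place of trichotomy, and
    -- transitivity of `_≤_` rests on it.
    <-cotrans : x < z → ∀ y → (x < y) ⊎ (y < z)
    <-cotrans {x} {z} x<z y with #-cotrans (Equivalence.from #⇔<⊎> (inj₁ x<z)) y
    ... | inj₁ x#y with Equivalence.to #⇔<⊎> x#y
    ...   | inj₁ x<y = inj₁ x<y
    ...   | inj₂ y<x = inj₂ (<-trans y<x x<z)
    <-cotrans {x} {z} x<z y | inj₂ y#z with Equivalence.to #⇔<⊎> y#z
    ...   | inj₁ y<z = inj₂ y<z
    ...   | inj₂ z<y = inj₁ (<-trans x<z z<y)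

  ≤-trans : x ≤ y → y ≤ z → x ≤ z
  ≤-trans {y = y} x≤y y≤z z<x with <-cotrans z<x y
  ... | inj₁ z<y = y≤z z<y
  ... | inj₂ y<x = x≤y y<x

  <-≤-trans : x < y → y ≤ z → x < z
  <-≤-trans {z = z} x<y y≤z with <-cotrans x<y z
  ... | inj₁ x<z = x<z
  ... | inj₂ z<y = ⊥-elim (y≤z z<y)

  ≤-<-trans : x ≤ y → y < z → x < z
  ≤-<-trans {x = x} x≤y y<z with <-cotrans y<z x
  ... | inj₁ y<x = ⊥-elim (x≤y y<x)
  ... | inj₂ x<z = x<z

  ≤-antisym : x ≤ y → y ≤ x → x ≈ y
  ≤-antisym x≤y y≤x = proj₁ (tight _ _) λ x#y → case′ (Equivalence.to #⇔<⊎> x#y)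
    where
    case′ : _ → ⊥
    case′ (inj₁ x<y) = y≤x x<y
    case′ (inj₂ y<x) = x≤y y<x

  ≤-poset : Poset c ℓ₁ ℓ₂
  ≤-poset = record
    { isPartialOrder = record
      { isPreorder = record
        { isEquivalence = isEquivalence ; reflexive = ≤-reflexive ; trans = ≤-trans }
      ; antisym = ≤-antisym } }

  module ≤-Reasoning = PartialOrderReasoning ≤-poset
  open ≤-Reasoning

  -- A negated goal admits the classical case distinction. As `_≤_` is itself a negation, every
  -- inequality to be proved is such a goal.
  ≤-cases : ∀ x y {p} {P : Set p} → (x ≤ y → ¬ P) → (y < x → ¬ P) → ¬ P
  ≤-cases x y f g p = f (λ y<x → g y<x p) p

  +-cancel : ∀ x y → (x + y) - y ≈ x
  +-cancel = solve 2 (λ x y → (x :+ y) :- y := x) refl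

  +-monoˡ-≤ : ∀ z → x ≤ y → x + z ≤ y + z
  +-monoˡ-≤ z x≤y y+z<x+z =
    x≤y (<-respˡ (+-cancel _ z) (<-respʳ (+-cancel _ z) (+-monoˡ-< (- z) y+z<x+z)))

  +-mono-≤ : w ≤ x → y ≤ z → w + y ≤ x + z
  +-mono-≤ {w} {x} {y} {z} w≤x y≤z = begin
    w + y  ≤⟨ +-monoˡ-≤ y w≤x ⟩
    x + y  ≈⟨ +-comm x y ⟩
    y + x  ≤⟨ +-monoˡ-≤ x y≤z ⟩
    z + x  ≈⟨ +-comm z x ⟩
    x + z  ∎

  +-nonneg : 0# ≤ x → 0# ≤ y → 0# ≤ x + y
  +-nonneg {x} {y} 0≤x 0≤y = begin
    0#       ≈⟨ +-identityˡ 0# ⟨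
    0# + 0#  ≤⟨ +-mono-≤ 0≤x 0≤y ⟩
    x + y    ∎

  -- Displaying the slack `e` splits an inequality into a sign condition and an identity for the
  -- ring solver; the long estimates below all take this form.
  ≤-by : ∀ e → 0# ≤ e → x + e ≈ y → x ≤ y
  ≤-by {x} {y} e 0≤e x+e≈y = begin
    x       ≈⟨ +-identityʳ x ⟨
    x + 0#  ≤⟨ +-mono-≤ ≤-refl 0≤e ⟩
    x + e   ≈⟨ x+e≈y ⟩
    y       ∎

  ≤⇒0≤- : x ≤ y → 0# ≤ y - x
  ≤⇒0≤- {x} {y} x≤y = begin
    0#     ≈⟨ -‿inverseʳ x ⟨
    x - x  ≤⟨ +-monoˡ-≤ (- x) x≤y ⟩
    y - x  ∎

  <⇒0<- : x < y → 0# < y - x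
  <⇒0<- {x} x<y = <-respˡ (-‿inverseʳ x) (+-monoˡ-< (- x) x<y)

  0<-⇒< : 0# < y - x → x < y
  0<-⇒< {y} {x} p =
    <-respʳ (solve 2 (λ x y → (y :- x) :+ x := y) refl x y)
      (<-respˡ (+-identityˡ x) (+-monoˡ-< x p))

  neg-mono-≤ : x ≤ y → - y ≤ - x
  neg-mono-≤ {x} {y} x≤y =
    ≤-by (y - x) (≤⇒0≤- x≤y) (solve 2 (λ x y → :- y :+ (y :- x) := :- x) refl x y)

  *-nonneg : 0# ≤ x → 0# ≤ y → 0# ≤ x * y
  *-nonneg {x} {y} 0≤x 0≤y =
    ≤-cases x 0# (λ x≤0 → ≤-reflexive (trans (sym (zeroˡ y)) (*-congʳ (≤-antisym 0≤x x≤0))))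
      λ 0<x → ≤-cases y 0# (λ y≤0 → ≤-reflexive (trans (sym (zeroʳ x)) (*-congˡ (≤-antisym 0≤y y≤0))))
        λ 0<y → <⇒≤ (*-positive 0<x 0<y)

  *-monoˡ-≤ : 0# ≤ z → x ≤ y → z * x ≤ z * y
  *-monoˡ-≤ {z} {x} {y} 0≤z x≤y =
    ≤-by (z * (y - x)) (*-nonneg 0≤z (≤⇒0≤- x≤y))
      (solve 3 (λ x y z → z :* x :+ z :* (y :- x) := z :* y) refl x y z)

  *-monoʳ-≤ : 0# ≤ z → x ≤ y → x * z ≤ y * z
  *-monoʳ-≤ {z} {x} {y} 0≤z x≤y = begin
    x * z  ≈⟨ *-comm x z ⟩
    z * x  ≤⟨ *-monoˡ-≤ 0≤z x≤y ⟩
    z * y  ≈⟨ *-comm z y ⟩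
    y * z  ∎

  *-mono-≤ : 0# ≤ y → 0# ≤ w → x ≤ y → w ≤ z → x * w ≤ y * z
  *-mono-≤ 0≤y 0≤w x≤y w≤z = ≤-trans (*-monoʳ-≤ 0≤w x≤y) (*-monoˡ-≤ 0≤y w≤z)

  *-monoˡ-< : 0# < z → x < y → z * x < z * y
  *-monoˡ-< {z} {x} {y} 0<z x<y =
    0<-⇒< (<-respʳ (solve 3 (λ x y z → z :* (y :- x) := z :* y :- z :* x) refl x y z)
      (*-positive 0<z (<⇒0<- x<y)))

  *-cancelˡ-≤ : 0# < z → z * x ≤ z * y → x ≤ y
  *-cancelˡ-≤ 0<z zx≤zy y<x = zx≤zy (*-monoˡ-< 0<z y<x)

  square-nonneg : ∀ x → 0# ≤ x * x
  square-nonneg x =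
    ≤-cases x 0#
      (λ x≤0 → ≤-trans (*-nonneg (-x≥0 x≤0) (-x≥0 x≤0))
        (≤-reflexive (solve 1 (λ x → (:- x) :* (:- x) := x :* x) refl x)))
      (λ 0<x → <⇒≤ (*-positive 0<x 0<x))
    where
    -x≥0 : x ≤ 0# → 0# ≤ - x
    -x≥0 x≤0 = ≤-trans (≤⇒0≤- x≤0) (≤-reflexive (+-identityˡ (- x)))

  square-cancel-≤ : 0# ≤ y → x * x ≤ y * y → x ≤ y
  square-cancel-≤ {y} {x} 0≤y x²≤y² y<x =
    x²≤y² (≤-<-trans (*-monoˡ-≤ 0≤y (<⇒≤ y<x))
      (<-respˡ (*-comm x y) (*-monoˡ-< (≤-<-trans 0≤y y<x) y<x)))

  0≤1 : 0# ≤ 1#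
  0≤1 = <⇒≤ 0<1

  0≤ofℕ : ∀ k → 0# ≤ ofℕ k
  0≤ofℕ zero    = ≤-refl
  0≤ofℕ (suc k) = <⇒≤ (0<ofℕ k)

  ofℕ-mono-≤ : ∀ {m n} → m ℕ.≤ n → ofℕ m ≤ ofℕ n
  ofℕ-mono-≤ {n = n} ℕ.z≤n = 0≤ofℕ n
  ofℕ-mono-≤ (ℕ.s≤s {m} {n} m≤n) = +-mono-≤ (≤-refl {1#}) (ofℕ-mono-≤ {m} {n} m≤n)

  *-cancelˡ-ofℕ-≤ : ∀ k → ofℕ (suc k) * x ≤ ofℕ (suc k) * y → x ≤ y
  *-cancelˡ-ofℕ-≤ k = *-cancelˡ-≤ (0<ofℕ k)

  -- inv divides by x - 0#, not by x.
  *-inv : ∀ x (0<x : 0# < x) → x * inv x 0<x ≈ 1#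
  *-inv x 0<x with #⇒invertible (Equivalence.from #⇔<⊎> (inj₂ 0<x))
  ... | x⁻¹ , _ , x*x⁻¹≈1 =
    trans (*-congʳ (solve 1 (λ x → x := x :- con (+ 0)) refl x)) x*x⁻¹≈1

  ofℕ-*-1/ℕ : ∀ k → ofℕ (suc k) * 1/ℕ (suc k) ≈ 1#
  ofℕ-*-1/ℕ k = *-inv (ofℕ (suc k)) (0<ofℕ k)

  inv-nonneg : ∀ x (0<x : 0# < x) → 0# ≤ inv x 0<x
  inv-nonneg x 0<x = *-cancelˡ-≤ 0<x (begin
    x * 0#           ≈⟨ zeroʳ x ⟩
    0#               ≤⟨ 0≤1 ⟩
    1#               ≈⟨ *-inv x 0<x ⟨
    x * inv x 0<x    ∎)

  1/ℕ-nonneg : ∀ k → 0# ≤ 1/ℕ k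
  1/ℕ-nonneg zero    = ≤-refl
  1/ℕ-nonneg (suc k) = inv-nonneg _ (0<ofℕ k)

  2*½ : ofℕ 2 * ½ ≈ 1#
  2*½ = ofℕ-*-1/ℕ 1

  1/ℕ-antitone : ∀ {j k} → suc j ℕ.≤ k → 1/ℕ k ≤ 1/ℕ (suc j)
  1/ℕ-antitone {j} {suc k} j≤k = *-cancelˡ-ofℕ-≤ j (begin
    ofℕ (suc j) * 1/ℕ (suc k)   ≤⟨ *-monoʳ-≤ (1/ℕ-nonneg (suc k)) (ofℕ-mono-≤ j≤k) ⟩
    ofℕ (suc k) * 1/ℕ (suc k)   ≈⟨ ofℕ-*-1/ℕ k ⟩
    1#                          ≈⟨ ofℕ-*-1/ℕ j ⟨
    ofℕ (suc j) * 1/ℕ (suc j)   ∎)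

  infix 4 ∣_∣≤_

  -- A two-sided bound stands in for the absolute value, whose definition by cases would require
  -- deciding the sign of `x`.
  record ∣_∣≤_ (x b : Carrier) : Set ℓ₂ where
    constructor bounds
    field
      upper : x ≤ b
      lower : - x ≤ b

  ∣∣≤-weaken : ∣ x ∣≤ y → y ≤ z → ∣ x ∣≤ z
  ∣∣≤-weaken (bounds p q) y≤z = bounds (≤-trans p y≤z) (≤-trans q y≤z)

  ∣∣≤-resp : x ≈ y → ∣ x ∣≤ z → ∣ y ∣≤ z
  ∣∣≤-resp x≈y (bounds p q) =
    bounds (≤-trans (≤-reflexive (sym x≈y)) p) (≤-trans (≤-reflexive (-‿cong (sym x≈y))) q)

  ∣∣≤-+ : ∣ w ∣≤ x → ∣ y ∣≤ z → ∣ w + y ∣≤ x + z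
  ∣∣≤-+ {w} {y = y} (bounds p p′) (bounds q q′) =
    bounds (+-mono-≤ p q)
      (≤-trans (≤-reflexive (solve 2 (λ w y → :- (w :+ y) := (:- w) :+ (:- y)) refl w y)) (+-mono-≤ p′ q′))

  ∣∣≤-neg : ∣ x ∣≤ y → ∣ - x ∣≤ y
  ∣∣≤-neg (bounds p q) = bounds q (≤-trans (≤-reflexive (-‿involutive _)) p)

  ∣∣≤-square : 0# ≤ y → x * x ≤ y * y → ∣ x ∣≤ y
  ∣∣≤-square {y} {x} 0≤y x²≤y² =
    bounds (square-cancel-≤ 0≤y x²≤y²)
      (square-cancel-≤ 0≤y (≤-trans (≤-reflexive (solve 1 (λ x → (:- x) :* (:- x) := x :* x) refl x)) x²≤y²))

  square-∣∣≤ : ∣ x ∣≤ y → x * x ≤ y * y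
  square-∣∣≤ {x} {y} (bounds x≤y -x≤y) =
    ≤-by ((y - x) * (y - - x)) (*-nonneg (≤⇒0≤- x≤y) (≤⇒0≤- -x≤y))
      (solve 2 (λ x y → x :* x :+ (y :- x) :* (y :- :- x) := y :* y) refl x y)

  open SignedCalculus ℝ using (signed)

  unit : Sign → Carrier
  unit t = signed t 1#

  signed≈ : ∀ t a → signed t a ≈ unit t * a
  signed≈ Sign.+ a = sym (*-identityˡ a)
  signed≈ Sign.- a = solve 1 (λ a → :- a := (:- con (+ 1)) :* a) refl a

  unit² : ∀ t → unit t * unit t ≈ 1#
  unit² Sign.+ = *-identityˡ 1#
  unit² Sign.- = solve 0 ((:- con (+ 1)) :* (:- con (+ 1)) := con (+ 1)) refl

  unit-* : ∀ s t → unit (s Sign.* t) ≈ unit s * unit t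
  unit-* Sign.+ t = sym (*-identityˡ _)
  unit-* Sign.- Sign.+ = sym (*-identityʳ _)
  unit-* Sign.- Sign.- = sym (unit² Sign.-)

  ∣∣≤-unit : ∀ t → ∣ x ∣≤ y → ∣ unit t * x ∣≤ y
  ∣∣≤-unit Sign.+ p = ∣∣≤-resp (sym (*-identityˡ _)) p
  ∣∣≤-unit {x} Sign.- p = ∣∣≤-resp (solve 1 (λ x → :- x := (:- con (+ 1)) :* x) refl x) (∣∣≤-neg p)

-- Finite sums and sums restricted by a decidable condition.

module Sums {c ℓ₁ ℓ₂} (ℝ : RealNumbers c ℓ₁ ℓ₂) where
  open RealNumbers ℝ hiding (zero)
  open OrderedField ℝ
  open ≤-Reasoning
  open CommutativeRing commutativeRing using (semiring)
  open SemiringSum semiring public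
    using (sum; sum-cong-≋; ∑-distrib-+; ∑-comm; *-distribˡ-sum; sum-replicate-zero)
  open MonoidSum ℕₚ.+-0-monoid public using () renaming (sum to sumℕ)

  private variable
    n : ℕ

  sum-mono-≤ : {s t : Vector Carrier n} → (∀ i → s i ≤ t i) → sum s ≤ sum t
  sum-mono-≤ {zero}  s≤t = ≤-refl
  sum-mono-≤ {suc n} s≤t = +-mono-≤ (s≤t zero) (sum-mono-≤ (s≤t ∘ suc))

  sum-nonneg : {t : Vector Carrier n} → (∀ i → 0# ≤ t i) → 0# ≤ sum t
  sum-nonneg {zero}  0≤t = ≤-refl
  sum-nonneg {suc n} 0≤t = +-nonneg (0≤t zero) (sum-nonneg (0≤t ∘ suc))

  term≤sum : {t : Vector Carrier n} → (∀ i → 0# ≤ t i) → ∀ i → t i ≤ sum t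
  term≤sum {t = t} 0≤t zero    = ≤-by _ (sum-nonneg (0≤t ∘ suc)) refl
  term≤sum {t = t} 0≤t (suc i) =
    ≤-trans (term≤sum (0≤t ∘ suc) i) (≤-by (t zero) (0≤t zero) (+-comm _ _))

  two-terms≤sum : {t : Vector Carrier n} → (∀ i → 0# ≤ t i) → ∀ {i j} → i ≢ j → t i + t j ≤ sum t
  two-terms≤sum 0≤t {zero}  {zero}  i≢j = ⊥-elim (i≢j ≡.refl)
  two-terms≤sum 0≤t {zero}  {suc j} i≢j = +-mono-≤ ≤-refl (term≤sum (0≤t ∘ suc) j)
  two-terms≤sum 0≤t {suc i} {zero}  i≢j =
    ≤-trans (≤-reflexive (+-comm _ _)) (+-mono-≤ ≤-refl (term≤sum (0≤t ∘ suc) i))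
  two-terms≤sum {t = t} 0≤t {suc i} {suc j} i≢j =
    ≤-trans (two-terms≤sum (0≤t ∘ suc) (i≢j ∘ ≡.cong suc)) (≤-by (t zero) (0≤t zero) (+-comm _ _))

  sum-zero : {t : Vector Carrier n} → (∀ i → t i ≈ 0#) → sum t ≈ 0#
  sum-zero {n} t≈0 = trans (sum-cong-≋ t≈0) (sum-replicate-zero n)

  sum-single : {t : Vector Carrier n} → ∀ i → (∀ j → j ≢ i → t j ≈ 0#) → sum t ≈ t i
  sum-single zero    t≈0 = trans (+-congˡ (sum-zero λ j → t≈0 (suc j) λ ())) (+-identityʳ _)
  sum-single (suc i) t≈0 =
    trans (+-cong (t≈0 zero λ ()) (sum-single i λ j j≢i → t≈0 (suc j) (j≢i ∘ Finₚ.suc-injective)))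
      (+-identityˡ _)

  ofℕ-sum : (t : Vector ℕ n) → ofℕ (sumℕ t) ≈ sum (ofℕ ∘ t)
  ofℕ-sum {zero}  t = refl
  ofℕ-sum {suc n} t = trans (ofℕ-+ (t zero) _) (+-congˡ (ofℕ-sum (t ∘ suc)))

  private variable
    A : Set

  -- The same conditional as in `Δ[_]`, so that `Δσ f x` and `avg x (δ f x)` agree by computation.
  when : Dec A → Carrier → Carrier
  when d a = if does d then a else 0#

  when-cong : ∀ (d : Dec A) {a b} → (A → a ≈ b) → when d a ≈ when d b
  when-cong (yes p) a≈b = a≈b p
  when-cong (no  _) _   = refl

  when-mono-≤ : ∀ (d : Dec A) {a b} → (A → a ≤ b) → when d a ≤ when d b
  when-mono-≤ (yes p) a≤b = a≤b p
  when-mono-≤ (no  _) _   = ≤-refl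

  when-nonneg : ∀ (d : Dec A) {a} → (A → 0# ≤ a) → 0# ≤ when d a
  when-nonneg (yes p) 0≤a = 0≤a p
  when-nonneg (no  _) _   = ≤-refl

  when-+ : ∀ (d : Dec A) a b → when d (a + b) ≈ when d a + when d b
  when-+ (yes _) a b = refl
  when-+ (no  _) a b = sym (+-identityˡ 0#)

  when-* : ∀ (d : Dec A) a b → when d (a * b) ≈ a * when d b
  when-* (yes _) a b = refl
  when-* (no  _) a b = sym (zeroʳ a)

  when-yes : ∀ (d : Dec A) {a} → A → when d a ≡ a
  when-yes (yes _) _ = ≡.refl
  when-yes (no ¬p) p = ⊥-elim (¬p p)

  when-zero : ∀ (d : Dec A) {a} → (A → a ≈ 0#) → when d a ≈ 0#
  when-zero (yes p) a≈0 = a≈0 p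
  when-zero (no  _) _   = refl

-- Signed Laplacian, carré du champ and a single Euler step.

module Calculus
  {c ℓ₁ ℓ₂} (ℝ : RealNumbers c ℓ₁ ℓ₂) {n : ℕ} {G : Graph n} (S : Signature G)
  (positive : ∀ x → 0 ℕ.< Graph.degree G x) where

  open RealNumbers ℝ hiding (zero)
  open OrderedField ℝ
  open ≤-Reasoning
  open Sums ℝ
  open SignedCalculus ℝ
  open Graph G
  open Signature S

  ∑∼ : Fin n → Fun {G = G} → Carrier
  ∑∼ x h = sum λ y → when (x ∼? y) (h y)

  avg : Fin n → Fun {G = G} → Carrier
  avg x h = 1/ℕ (degree x) * ∑∼ x h

  private variable
    x : Fin n
    h k : Fun {G = G}

  ∑∼-cong : (∀ y → x ∼ y → h y ≈ k y) → ∑∼ x h ≈ ∑∼ x k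
  ∑∼-cong h≈k = sum-cong-≋ λ y → when-cong (_ ∼? y) (h≈k y)

  ∑∼-mono-≤ : (∀ y → x ∼ y → h y ≤ k y) → ∑∼ x h ≤ ∑∼ x k
  ∑∼-mono-≤ h≤k = sum-mono-≤ λ y → when-mono-≤ (_ ∼? y) (h≤k y)

  ∑∼-+ : ∀ x h k → ∑∼ x (λ y → h y + k y) ≈ ∑∼ x h + ∑∼ x k
  ∑∼-+ x h k = trans (sum-cong-≋ {n = n} λ y → when-+ (x ∼? y) (h y) (k y))
    (∑-distrib-+ (λ y → when (x ∼? y) (h y)) (λ y → when (x ∼? y) (k y)))

  ∑∼-* : ∀ x a h → ∑∼ x (λ y → a * h y) ≈ a * ∑∼ x h
  ∑∼-* x a h = trans (sum-cong-≋ {n = n} λ y → when-* (x ∼? y) a (h y))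
    (sym (*-distribˡ-sum a λ y → when (x ∼? y) (h y)))

  ∑∼-1 : ∀ x → ∑∼ x (λ _ → 1#) ≈ ofℕ (degree x)
  ∑∼-1 x = sym (trans (ofℕ-sum (λ y → if does (x ∼? y) then 1 else 0)) (sum-cong-≋ λ y → count (x ∼? y)))
    where
    count : ∀ {y} (d : Dec (x ∼ y)) → ofℕ (if does d then 1 else 0) ≈ when d 1#
    count (yes _) = ofℕ-1
    count (no  _) = refl

  degree*1/degree : ∀ x → ofℕ (degree x) * 1/ℕ (degree x) ≈ 1#
  degree*1/degree x with degree x | positive x
  ... | suc k | _ = ofℕ-*-1/ℕ k

  degree*avg : ∀ x h → ofℕ (degree x) * avg x h ≈ ∑∼ x h
  degree*avg x h = begin-equality
    ofℕ (degree x) * (1/ℕ (degree x) * ∑∼ x h)   ≈⟨ *-assoc _ _ _ ⟨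
    ofℕ (degree x) * 1/ℕ (degree x) * ∑∼ x h     ≈⟨ *-congʳ (degree*1/degree x) ⟩
    1# * ∑∼ x h                                  ≈⟨ *-identityˡ _ ⟩
    ∑∼ x h                                       ∎

  avg-cong : (∀ y → x ∼ y → h y ≈ k y) → avg x h ≈ avg x k
  avg-cong h≈k = *-congˡ (∑∼-cong h≈k)

  avg-mono-≤ : (∀ y → x ∼ y → h y ≤ k y) → avg x h ≤ avg x k
  avg-mono-≤ {x} h≤k = *-monoˡ-≤ (1/ℕ-nonneg (degree x)) (∑∼-mono-≤ h≤k)

  avg-+ : ∀ x h k → avg x (λ y → h y + k y) ≈ avg x h + avg x k
  avg-+ x h k = trans (*-congˡ (∑∼-+ x h k)) (distribˡ _ _ _)

  avg-* : ∀ x a h → avg x (λ y → a * h y) ≈ a * avg x h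
  avg-* x a h = trans (*-congˡ (∑∼-* x a h))
    (solve 3 (λ r a b → r :* (a :* b) := a :* (r :* b)) refl _ a _)

  avg-const : ∀ x a → avg x (λ _ → a) ≈ a
  avg-const x a = begin-equality
    avg x (λ _ → a)                        ≈⟨ avg-cong (λ _ _ → sym (*-identityʳ a)) ⟩
    avg x (λ _ → a * 1#)                   ≈⟨ avg-* x a _ ⟩
    a * (1/ℕ (degree x) * ∑∼ x (λ _ → 1#)) ≈⟨ *-congˡ (*-congˡ (∑∼-1 x)) ⟩
    a * (1/ℕ (degree x) * ofℕ (degree x))  ≈⟨ *-congˡ (trans (*-comm _ _) (degree*1/degree x)) ⟩
    a * 1#                                 ≈⟨ *-identityʳ a ⟩
    a                                      ∎

  avg-≤-const : ∀ {a} → (∀ y → x ∼ y → h y ≤ a) → avg x h ≤ a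
  avg-≤-const {x} {a = a} h≤a = ≤-trans (avg-mono-≤ h≤a) (≤-reflexive (avg-const x a))

  avg-≥-const : ∀ {a} → (∀ y → x ∼ y → a ≤ h y) → a ≤ avg x h
  avg-≥-const {x} {a = a} a≤h = ≤-trans (≤-reflexive (sym (avg-const x a))) (avg-mono-≤ a≤h)

  avg-square : ∀ x h → avg x h * avg x h ≤ avg x (λ y → h y * h y)
  avg-square x h = ≤-by (avg x (λ y → (h y - m) * (h y - m))) (avg-≥-const λ y _ → square-nonneg _) (begin-equality
    m * m + avg x (λ y → (h y - m) * (h y - m))
      ≈⟨ +-congˡ (avg-cong λ y _ → solve 2 (λ h m → (h :- m) :* (h :- m)
        := h :* h :+ ((:- con (+ 2)) :* m :* h :+ m :* m)) refl (h y) m) ⟩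
    m * m + avg x (λ y → h y * h y + ((- ofℕ 2) * m * h y + m * m))
      ≈⟨ +-congˡ (trans (avg-+ x _ _) (+-congˡ
          (trans (avg-+ x _ _) (+-cong (avg-* x _ h) (avg-const x _))))) ⟩
    m * m + (avg x (λ y → h y * h y) + ((- ofℕ 2) * m * m + m * m))
      ≈⟨ solve 2 (λ m a → m :* m :+ (a :+ ((:- con (+ 2)) :* m :* m :+ m :* m)) := a) refl m _ ⟩
    avg x (λ y → h y * h y) ∎)
    where m = avg x h

  -- The gradient of f along an edge after transporting f(y) to x by the sign. The Laplacian is its
  -- mean over the neighbours, and Γ half its mean square.
  δ : Fun {G = G} → Fin n → Fin n → Carrier
  δ f x y = signed (σ x y) (f y) - f x

  δ≈ : ∀ f x y → δ f x y ≈ unit (σ x y) * f y - f x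
  δ≈ f x y = +-congʳ (signed≈ (σ x y) (f y))

  -- As σ² = 1, the product f(y)g(y) equals (σf(y))(σg(y)); hence the unsigned Laplacian of fg
  -- satisfies a Leibniz rule in the twisted increments.
  Γ≈ : ∀ f g x → Γ S f g x ≈ ½ * avg x (λ y → δ f x y * δ g x y)
  Γ≈ f g x = *-congˡ (begin-equality
    (avg x (λ y → f y * g y - f x * g x) - g x * avg x (δ f x)) - f x * avg x (δ g x)
      ≈⟨ +-congʳ (+-congʳ (avg-cong λ y _ → leibniz y)) ⟩
    (avg x (λ y → δ f x y * δ g x y + (g x * δ f x y + f x * δ g x y)) - g x * avg x (δ f x)) - f x * avg x (δ g x)
      ≈⟨ +-congʳ (+-congʳ (trans (avg-+ x _ _) (+-congˡ
          (trans (avg-+ x _ _) (+-cong (avg-* x _ _) (avg-* x _ _)))))) ⟩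
    (avg x (λ y → δ f x y * δ g x y) + (g x * avg x (δ f x) + f x * avg x (δ g x)) - g x * avg x
        (δ f x)) - f x * avg x (δ g x)
      ≈⟨ solve 3 (λ a b c → ((a :+ (b :+ c)) :- b) :- c := a) refl _ _ _ ⟩
    avg x (λ y → δ f x y * δ g x y) ∎)
    where
    leibniz : ∀ y → f y * g y - f x * g x ≈ δ f x y * δ g x y + (g x * δ f x y + f x * δ g x y)
    leibniz y = begin-equality
      f y * g y - f x * g x
        ≈⟨ +-congʳ (sym (trans (*-congʳ (unit² (σ x y))) (*-identityˡ _))) ⟩
      e * e * (f y * g y) - f x * g x
        ≈⟨ solve 5 (λ e fy gy fx gx → e :* e :* (fy :* gy) :- fx :* gx :=
             (e :* fy :- fx) :* (e :* gy :- gx) :+ (gx :* (e :* fy :- fx) :+ fx :* (e :* gy :- gx)))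
             refl e (f y) (g y) (f x) (g x) ⟩
      (e * f y - f x) * (e * g y - g x) + (g x * (e * f y - f x) + f x * (e * g y - g x))
        ≈⟨ sym (+-cong (*-cong (δ≈ f x y) (δ≈ g x y)) (+-cong (*-congˡ (δ≈ f x y)) (*-congˡ (δ≈ g x y)))) ⟩
      δ f x y * δ g x y + (g x * δ f x y + f x * δ g x y) ∎
      where e = unit (σ x y)

  2Γ≈ : ∀ f g x → ofℕ 2 * Γ S f g x ≈ avg x (λ y → δ f x y * δ g x y)
  2Γ≈ f g x = begin-equality
    ofℕ 2 * Γ S f g x         ≈⟨ *-congˡ (Γ≈ f g x) ⟩
    ofℕ 2 * (½ * _)           ≈⟨ *-assoc _ _ _ ⟨
    ofℕ 2 * ½ * _             ≈⟨ *-congʳ 2*½ ⟩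
    1# * _                    ≈⟨ *-identityˡ _ ⟩
    _ ∎

  Γ-nonneg : ∀ f x → 0# ≤ Γ S f f x
  Γ-nonneg f x = *-cancelˡ-ofℕ-≤ 1 (begin
    ofℕ 2 * 0#        ≈⟨ zeroʳ _ ⟩
    0#                ≤⟨ avg-≥-const (λ y _ → square-nonneg (δ f x y)) ⟩
    avg x (λ y → δ f x y * δ f x y)  ≈⟨ 2Γ≈ f f x ⟨
    ofℕ 2 * Γ S f f x ∎)

  δ²≤ : ∀ f x y {a} → f x * f x ≤ a → f y * f y ≤ a → δ f x y * δ f x y ≤ ofℕ 4 * a
  δ²≤ f x y {a} fx²≤a fy²≤a = begin
    δ f x y * δ f x y
      ≈⟨ *-cong (δ≈ f x y) (δ≈ f x y) ⟩
    (e * f y - f x) * (e * f y - f x)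
      ≤⟨ ≤-by ((e * f y + f x) * (e * f y + f x)) (square-nonneg _)
           (solve 3 (λ e fx fy → (e :* fy :- fx) :* (e :* fy :- fx) :+ (e :* fy :+ fx) :* (e :* fy :+ fx)
             := con (+ 2) :* ((e :* e) :* (fy :* fy)) :+ con (+ 2) :* (fx :* fx)) refl e (f x) (f y)) ⟩
    ofℕ 2 * ((e * e) * (f y * f y)) + ofℕ 2 * (f x * f x)
      ≈⟨ +-congʳ (*-congˡ (trans (*-congʳ (unit² (σ x y))) (*-identityˡ _))) ⟩
    ofℕ 2 * (f y * f y) + ofℕ 2 * (f x * f x)
      ≤⟨ +-mono-≤ (*-monoˡ-≤ (0≤ofℕ 2) fy²≤a) (*-monoˡ-≤ (0≤ofℕ 2) fx²≤a) ⟩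
    ofℕ 2 * a + ofℕ 2 * a
      ≈⟨ solve 1 (λ a → con (+ 2) :* a :+ con (+ 2) :* a := con (+ 4) :* a) refl a ⟩
    ofℕ 4 * a ∎
    where e = unit (σ x y)

  Δσ : Fun {G = G} → Fun {G = G}
  Δσ = Δ[ S ]

  Δ²≤2Γ : ∀ f x → Δσ f x * Δσ f x ≤ ofℕ 2 * Γ S f f x
  Δ²≤2Γ f x = ≤-trans (avg-square x (δ f x)) (≤-reflexive (sym (2Γ≈ f f x)))

  euler : Carrier → Fun {G = G} → Fun {G = G}
  euler s f x = f x + s * Δσ f x

  -- The Euler step of the unsigned heat equation, which governs f² and Γ(f). For 0 ≤ s ≤ 1 it is a
  -- convex combination of F(x) and the mean over the neighbours, whence the maximum principle
  -- `smooth-≤`.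
  smooth : Carrier → Fun {G = G} → Fun {G = G}
  smooth s F x = F x + s * Δ {G = G} F x

  smooth-≤ : ∀ {s F b} → 0# ≤ s → s ≤ 1# → (∀ x → F x ≤ b) → ∀ x → smooth s F x ≤ b
  smooth-≤ {s} {F} {b} 0≤s s≤1 F≤b x = begin
    F x + s * avg x (λ y → F y - F x)
      ≤⟨ +-mono-≤ ≤-refl (*-monoˡ-≤ 0≤s (avg-≤-const λ y _ → +-monoˡ-≤ (- F x) (F≤b y))) ⟩
    F x + s * (b - F x)
      ≤⟨ ≤-by ((1# - s) * (b - F x)) (*-nonneg (≤⇒0≤- s≤1) (≤⇒0≤- (F≤b x)))
           (solve 3 (λ s b f → f :+ s :* (b :- f) :+ (con (+ 1) :- s) :* (b :- f) := b) refl s b (F x)) ⟩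
    b ∎

  -- The discrete form of Δ(f²) = 2fΔσf + 2Γ(f); the term in s² is the discretisation error.
  euler-square : ∀ s f x → euler s f x * euler s f x + ofℕ 2 * s * Γ S f f x
                         ≈ smooth s (λ y → f y * f y) x + s * s * (Δσ f x * Δσ f x)
  euler-square s f x = begin-equality
    euler s f x * euler s f x + ofℕ 2 * s * Γ S f f x
      ≈⟨ solve 4 (λ s f v g → (f :+ s :* v) :* (f :+ s :* v) :+ con (+ 2) :* s :* g :=
           f :* f :+ s :* (con (+ 2) :* g :+ con (+ 2) :* f :* v) :+ s :* s :* (v :* v)) refl s (f x) v _ ⟩
    f x * f x + s * (ofℕ 2 * Γ S f f x + ofℕ 2 * f x * v) + s * s * (v * v)
      ≈⟨ +-congʳ (+-congˡ (*-congˡ (sym (begin-equality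
        avg x (λ y → f y * f y - f x * f x)
          ≈⟨ avg-cong (λ y _ → chain y) ⟩
        avg x (λ y → δ f x y * δ f x y + (ofℕ 2 * f x) * δ f x y)
          ≈⟨ trans (avg-+ x _ _) (+-cong (sym (2Γ≈ f f x)) (avg-* x _ _)) ⟩
        ofℕ 2 * Γ S f f x + ofℕ 2 * f x * v ∎)))) ⟩
    smooth s (λ y → f y * f y) x + s * s * (v * v) ∎
    where
    v = Δσ f x
    chain : ∀ y → f y * f y - f x * f x ≈ δ f x y * δ f x y + (ofℕ 2 * f x) * δ f x y
    chain y = begin-equality
      f y * f y - f x * f x
        ≈⟨ +-congʳ (sym (trans (*-congʳ (unit² (σ x y))) (*-identityˡ _))) ⟩
      e * e * (f y * f y) - f x * f x
        ≈⟨ solve 3 (λ e fy fx → e :* e :* (fy :* fy) :- fx :* fx :=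
             (e :* fy :- fx) :* (e :* fy :- fx) :+ (con (+ 2) :* fx) :* (e :* fy :- fx)) refl e (f y) (f x) ⟩
      (e * f y - f x) * (e * f y - f x) + (ofℕ 2 * f x) * (e * f y - f x)
        ≈⟨ sym (+-cong (*-cong (δ≈ f x y) (δ≈ f x y)) (*-congˡ (δ≈ f x y))) ⟩
      δ f x y * δ f x y + (ofℕ 2 * f x) * δ f x y ∎
      where e = unit (σ x y)

  δ-euler : ∀ s f x y → δ (euler s f) x y ≈ δ f x y + s * δ (Δσ f) x y
  δ-euler s f x y = begin-equality
    δ (euler s f) x y
      ≈⟨ δ≈ _ x y ⟩
    e * (f y + s * v y) - (f x + s * v x)
      ≈⟨ solve 6 (λ e s fx fy vx vy → e :* (fy :+ s :* vy) :- (fx :+ s :* vx) :=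
           (e :* fy :- fx) :+ s :* (e :* vy :- vx)) refl e s (f x) (f y) (v x) (v y) ⟩
    (e * f y - f x) + s * (e * v y - v x)
      ≈⟨ +-cong (δ≈ f x y) (*-congˡ (δ≈ v x y)) ⟨
    δ f x y + s * δ v x y ∎
    where
    e = unit (σ x y)
    v = Δσ f

  Γ-euler : ∀ s f x → Γ S (euler s f) (euler s f) x
                    ≈ Γ S f f x + ofℕ 2 * s * Γ S f (Δσ f) x + s * s * Γ S (Δσ f) (Δσ f) x
  Γ-euler s f x = begin-equality
    Γ S (euler s f) (euler s f) x
      ≈⟨ Γ≈ _ _ x ⟩
    ½ * avg x (λ y → δ (euler s f) x y * δ (euler s f) x y)
      ≈⟨ *-congˡ (avg-cong λ y _ → trans (*-cong (δ-euler s f x y) (δ-euler s f x y))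
           (solve 3 (λ s a b → (a :+ s :* b) :* (a :+ s :* b)
             := a :* a :+ (con (+ 2) :* s :* (a :* b) :+ s :* s :* (b :* b)))
             refl s (δ f x y) (δ v x y))) ⟩
    ½ * avg x (λ y → δ f x y * δ f x y + (ofℕ 2 * s * (δ f x y * δ v x y) + s * s * (δ v x y * δ v x y)))
      ≈⟨ *-congˡ (trans (avg-+ x _ _) (+-congˡ (trans (avg-+ x _ _) (+-cong (avg-* x _ _) (avg-* x _ _))))) ⟩
    ½ * (avg x (λ y → δ f x y * δ f x y) + (ofℕ 2 * s * avg x (λ y → δ f x y * δ v x y) + s * s * avg x
        (λ y → δ v x y * δ v x y)))
      ≈⟨ solve 5 (λ h s a b c → h :* (a :+ (con (+ 2) :* s :* b :+ s :* s :* c)) :=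
           h :* a :+ con (+ 2) :* s :* (h :* b) :+ s :* s :* (h :* c)) refl ½ s _ _ _ ⟩
    ½ * avg x (λ y → δ f x y * δ f x y) + ofℕ 2 * s * (½ * avg x (λ y → δ f x y * δ v x y)) + s * s *
        (½ * avg x (λ y → δ v x y * δ v x y))
      ≈⟨ sym (+-cong (+-cong (Γ≈ f f x) (*-congˡ (Γ≈ f v x))) (*-congˡ (Γ≈ v v x))) ⟩
    Γ S f f x + ofℕ 2 * s * Γ S f v x + s * s * Γ S v v x ∎
    where v = Δσ f

  -- In `euler-square` the error s²(Δσf)² is at most 2s²Γ(f) by Jensen, and for s ≤ 1 the
  -- dissipation 2sΓ(f) pays for it.
  euler-contraction : ∀ {s f} → 0# ≤ s → s ≤ 1# → (∀ x → f x * f x ≤ 1#) →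
                      ∀ x → euler s f x * euler s f x ≤ 1#
  euler-contraction {s} {f} 0≤s s≤1 f²≤1 x = ≤-trans
    (≤-by (ofℕ 2 * s * (1# - s) * Γ S f f x + s * s * (ofℕ 2 * Γ S f f x - v * v))
      (+-nonneg (*-nonneg (*-nonneg (*-nonneg (0≤ofℕ 2) 0≤s) (≤⇒0≤- s≤1)) (Γ-nonneg f x))
        (*-nonneg (square-nonneg s) (≤⇒0≤- (Δ²≤2Γ f x))))
      (begin-equality
        euler s f x * euler s f x + (ofℕ 2 * s * (1# - s) * g + s * s * (ofℕ 2 * g - v * v))
          ≈⟨ solve 4 (λ s q g v → q :+ (con (+ 2) :* s :* (con (+ 1) :- s) :* g :+ s :* s :* (con (+ 2) :* g :- v :* v))
               := (q :+ con (+ 2) :* s :* g) :- s :* s :* (v :* v)) refl s _ g v ⟩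
        (euler s f x * euler s f x + ofℕ 2 * s * g) - s * s * (v * v)
          ≈⟨ +-congʳ (euler-square s f x) ⟩
        (smooth s (λ y → f y * f y) x + s * s * (v * v)) - s * s * (v * v)
          ≈⟨ +-cancel _ _ ⟩
        smooth s (λ y → f y * f y) x ∎))
    (smooth-≤ 0≤s s≤1 f²≤1 x)
    where
    v = Δσ f x
    g = Γ S f f x

-- The reverse Poincaré inequality for the Euler scheme.

module Flow
  {c ℓ₁ ℓ₂} (ℝ : RealNumbers c ℓ₁ ℓ₂) {n : ℕ} {G : Graph n} (S : Signature G)
  (positive : ∀ x → 0 ℕ.< Graph.degree G x)
  (0≤Γ₂ : ∀ f x → RealNumbers._≤_ ℝ (RealNumbers.0# ℝ) (SignedCalculus.Γ₂ ℝ S f f x)) where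

  open RealNumbers ℝ hiding (zero)
  open OrderedField ℝ
  open ≤-Reasoning
  open Sums ℝ
  open SignedCalculus ℝ
  open Graph G
  open Signature S
  open Calculus ℝ S positive

  2ΓΔ≤ΔΓ : ∀ f x → ofℕ 2 * Γ S f (Δσ f) x ≤ Δ {G = G} (Γ S f f) x
  2ΓΔ≤ΔΓ f x = ≤-by (ofℕ 2 * Γ₂ S f f x) (*-nonneg (0≤ofℕ 2) (0≤Γ₂ f x)) (begin-equality
    ofℕ 2 * g + ofℕ 2 * (½ * ((l - g) - g))  ≈⟨ solve 3 (λ g h l → con (+ 2) :* g :+ con (+ 2) :* (h :* ((l :- g) :- g))
      := con (+ 2) :* g :+ (con (+ 2) :* h) :* ((l :- g) :- g)) refl g ½ l ⟩
    ofℕ 2 * g + ofℕ 2 * ½ * ((l - g) - g)    ≈⟨ +-congˡ (*-congʳ 2*½) ⟩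
    ofℕ 2 * g + 1# * ((l - g) - g)           ≈⟨ solve 2 (λ g l → con (+ 2) :* g :+ con (+ 1) :* ((l :- g) :- g)
      := l) refl g l ⟩
    l ∎)
    where
    g = Γ S f (Δσ f) x
    l = Δ {G = G} (Γ S f f) x

  Δ²≤4 : ∀ {f} → (∀ x → f x * f x ≤ 1#) → ∀ x → Δσ f x * Δσ f x ≤ ofℕ 4
  Δ²≤4 {f} f²≤1 x = ≤-trans (avg-square x (δ f x))
    (avg-≤-const λ y _ → ≤-trans (δ²≤ f x y (f²≤1 x) (f²≤1 y)) (≤-reflexive (*-identityʳ _)))

  δΔ²≤16 : ∀ {f} → (∀ x → f x * f x ≤ 1#) → ∀ x y → δ (Δσ f) x y * δ (Δσ f) x y ≤ ofℕ 16
  δΔ²≤16 {f} f²≤1 x y = ≤-trans (δ²≤ (Δσ f) x y (Δ²≤4 f²≤1 x) (Δ²≤4 f²≤1 y))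
    (≤-reflexive (sym (ofℕ-* 4 4)))

  ΓΔΔ≤8 : ∀ {f} → (∀ x → f x * f x ≤ 1#) → ∀ x → Γ S (Δσ f) (Δσ f) x ≤ ofℕ 8
  ΓΔΔ≤8 {f} f²≤1 x = *-cancelˡ-ofℕ-≤ 1 (begin
    ofℕ 2 * Γ S (Δσ f) (Δσ f) x                     ≈⟨ 2Γ≈ _ _ x ⟩
    avg x (λ y → δ (Δσ f) x y * δ (Δσ f) x y)       ≤⟨ avg-≤-const (λ y _ → δΔ²≤16 f²≤1 x y) ⟩
    ofℕ 16                                          ≈⟨ ofℕ-* 2 8 ⟩
    ofℕ 2 * ofℕ 8                                   ∎)

  2ΓΔ≤8 : ∀ {f} → (∀ x → f x * f x ≤ 1#) → ∀ x → ofℕ 2 * Γ S f (Δσ f) x ≤ ofℕ 8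
  2ΓΔ≤8 {f} f²≤1 x = *-cancelˡ-ofℕ-≤ 3 (begin
    ofℕ 4 * (ofℕ 2 * Γ S f v x)
      ≈⟨ *-congˡ (2Γ≈ _ _ x) ⟩
    ofℕ 4 * avg x (λ y → δ f x y * δ v x y)
      ≈⟨ avg-* x _ _ ⟨
    avg x (λ y → ofℕ 4 * (δ f x y * δ v x y))
      ≤⟨ avg-≤-const (λ y _ → bound y) ⟩
    ofℕ 32
      ≈⟨ ofℕ-* 4 8 ⟩
    ofℕ 4 * ofℕ 8 ∎)
    where
    v = Δσ f
    bound : ∀ y → ofℕ 4 * (δ f x y * δ v x y) ≤ ofℕ 32
    bound y = begin
      -- The weight 2 balances the bounds |a| ≤ 2 and |b| ≤ 4, so that 4ab ≤ 16 + 16 loses nothing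
      -- against |ab| ≤ 8.
      ofℕ 4 * (a * b)                ≤⟨ ≤-by _ (square-nonneg (ofℕ 2 * a - b))
          (solve 2 (λ a b → con (+ 4) :* (a :* b) :+ (con (+ 2) :* a :- b) :* (con (+ 2) :* a :- b)
            := con (+ 4) :* (a :* a) :+ b :* b) refl a b) ⟩
      ofℕ 4 * (a * a) + b * b        ≤⟨ +-mono-≤
          (*-monoˡ-≤ (0≤ofℕ 4) (δ²≤ f x y (f²≤1 x) (f²≤1 y))) (δΔ²≤16 f²≤1 x y) ⟩
      ofℕ 4 * (ofℕ 4 * 1#) + ofℕ 16  ≈⟨ solve 0 (con (+ 4) :* (con (+ 4) :* con (+ 1)) :+ con (+ 16)
        := con (+ 32)) refl ⟩
      ofℕ 32                         ∎
      where
      a = δ f x y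
      b = δ v x y

  -- The last term collects the second-order errors, bounded crudely from |f| ≤ 1.
  euler-step : ∀ {s t f b} → 0# ≤ s → s ≤ 1# → 0# ≤ t → (∀ x → f x * f x ≤ 1#) →
    (∀ x → f x * f x + t * Γ S f f x ≤ b) →
    ∀ x → euler s f x * euler s f x + (t + ofℕ 2 * s) * Γ S (euler s f) (euler s f) x
        ≤ b + s * s * (ofℕ 36 + ofℕ 8 * t)
  euler-step {s} {t} {f} {b} 0≤s s≤1 0≤t f²≤1 f²+tΓ≤b x = ≤-by
    -- The first summand is the maximum principle, the second is Γ₂ ≥ 0 and the others are crude
    -- bounds on error terms. The last one raises the cubic error 16s³ to 16s², so that the
    -- coefficient of s² is 4 + 16 + 16 = 36.
    ((b - smooth s F x) + (t * s * (l - ofℕ 2 * g₁) + (t * s * s * (ofℕ 8 - g₂) + (s * s * (ofℕ 4 - v²)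
      + (ofℕ 2 * s * s * (ofℕ 8 - ofℕ 2 * g₁) + (ofℕ 2 * s * s * s * (ofℕ 8 - g₂) + ofℕ 16 * s * s * (1# - s)))))))
    (+-nonneg (≤⇒0≤- (smooth-≤ 0≤s s≤1 f²+tΓ≤b x))
      (+-nonneg (*-nonneg (*-nonneg 0≤t 0≤s) (≤⇒0≤- (2ΓΔ≤ΔΓ f x)))
      (+-nonneg (*-nonneg (*-nonneg (*-nonneg 0≤t 0≤s) 0≤s) (≤⇒0≤- (ΓΔΔ≤8 f²≤1 x)))
      (+-nonneg (*-nonneg (square-nonneg s) (≤⇒0≤- (Δ²≤4 f²≤1 x)))
      (+-nonneg (*-nonneg (*-nonneg (*-nonneg (0≤ofℕ 2) 0≤s) 0≤s) (≤⇒0≤- (2ΓΔ≤8 f²≤1 x)))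
      (+-nonneg (*-nonneg (*-nonneg (*-nonneg (*-nonneg (0≤ofℕ 2) 0≤s) 0≤s) 0≤s) (≤⇒0≤- (ΓΔΔ≤8 f²≤1 x)))
        (*-nonneg (*-nonneg (*-nonneg (0≤ofℕ 16) 0≤s) 0≤s) (≤⇒0≤- s≤1))))))))
    (begin-equality
      E² + (t + ofℕ 2 * s) * g′ + _
        ≈⟨ +-cong (+-cong (sym (+-cancel E² (ofℕ 2 * s * g))) (*-congˡ (Γ-euler s f x))) (+-congʳ (+-congˡ
            (-‿cong smooth-F))) ⟩
      ((E² + ofℕ 2 * s * g) - ofℕ 2 * s * g) + (t + ofℕ 2 * s) * (g + ofℕ 2 * s * g₁ + s * s * g₂) + ((b -
          (p + t * (g + s * l))) + rest)
        ≈⟨ +-congʳ (+-congʳ (+-congʳ (euler-square s f x))) ⟩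
      ((p + s * s * v²) - ofℕ 2 * s * g) + (t + ofℕ 2 * s) * (g + ofℕ 2 * s * g₁ + s * s * g₂) + ((b -
          (p + t * (g + s * l))) + rest)
        ≈⟨ solve 9 (λ s t b g g₁ g₂ l p v² →
            ((p :+ s :* s :* v²) :- con (+ 2) :* s :* g) :+ (t :+ con (+ 2) :* s) :* (g :+ con
                (+ 2) :* s :* g₁ :+ s :* s :* g₂) :+ ((b :- (p :+ t :* (g :+ s :* l)))
            :+ (t :* s :* (l :- con (+ 2) :* g₁) :+ (t :* s :* s :* (con (+ 8) :- g₂) :+ (s :* s :* (con (+ 4) :- v²)
            :+ (con (+ 2) :* s :* s :* (con (+ 8) :- con (+ 2) :* g₁) :+ (con (+ 2) :* s :* s :* s :* (con
                (+ 8) :- g₂) :+ con (+ 16) :* s :* s :* (con (+ 1) :- s)))))))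
            := b :+ s :* s :* (con (+ 36) :+ con (+ 8) :* t)) refl s t b g g₁ g₂ l p v² ⟩
      b + s * s * (ofℕ 36 + ofℕ 8 * t) ∎)
    where
    F : Fun {G = G}
    F y = f y * f y + t * Γ S f f y
    E² = euler s f x * euler s f x
    g′ = Γ S (euler s f) (euler s f) x
    g  = Γ S f f x
    g₁ = Γ S f (Δσ f) x
    g₂ = Γ S (Δσ f) (Δσ f) x
    l  = Δ {G = G} (Γ S f f) x
    p  = smooth s (λ y → f y * f y) x
    v² = Δσ f x * Δσ f x
    rest = t * s * (l - ofℕ 2 * g₁) + (t * s * s * (ofℕ 8 - g₂) + (s * s * (ofℕ 4 - v²)
      + (ofℕ 2 * s * s * (ofℕ 8 - ofℕ 2 * g₁) + (ofℕ 2 * s * s * s * (ofℕ 8 - g₂) + ofℕ 16 * s * s * (1# - s)))))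
    smooth-F : smooth s F x ≈ p + t * (g + s * l)
    smooth-F = begin-equality
      (f x * f x + t * g) + s * avg x (λ y → F y - F x)
        ≈⟨ +-congˡ (*-congˡ (avg-cong λ y _ → solve 5 (λ a b c d t → (a :+ t :* b) :- (c :+ t :* d)
          := (a :- c) :+ t :* (b :- d)) refl (f y * f y) (Γ S f f y) (f x * f x) g t)) ⟩
      (f x * f x + t * g) + s * avg x (λ y → (f y * f y - f x * f x) + t * (Γ S f f y - g))
        ≈⟨ +-congˡ (*-congˡ (trans (avg-+ x _ _) (+-congˡ (avg-* x t _)))) ⟩
      (f x * f x + t * g) + s * (avg x (λ y → f y * f y - f x * f x) + t * l)
        ≈⟨ solve 6 (λ q t g s a l → (q :+ t :* g) :+ s :* (a :+ t :* l)
          := (q :+ s :* a) :+ t :* (g :+ s :* l)) refl (f x * f x) t g s _ l ⟩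
      p + t * (g + s * l) ∎

  flow : Carrier → ℕ → Fun {G = G} → Fun {G = G}
  flow s zero    f = f
  flow s (suc k) f = euler s (flow s k f)

  module _ {s : Carrier} {f : Fun {G = G}} (0≤s : 0# ≤ s) (s≤1 : s ≤ 1#) (f²≤1 : ∀ x → f x * f x ≤ 1#) where

    flow-contraction : ∀ k x → flow s k f x * flow s k f x ≤ 1#
    flow-contraction zero    = f²≤1
    flow-contraction (suc k) = euler-contraction 0≤s s≤1 (flow-contraction k)

    -- Each step adds 2s to the weight of Γ. Keeping t fixed as a bound for the elapsed time sk
    -- makes the error the same in every step, hence linear in k.
    reverse-Poincaré : ∀ {t} k → s * ofℕ k ≤ t → ∀ x →
      flow s k f x * flow s k f x + ofℕ 2 * (s * ofℕ k) * Γ S (flow s k f) (flow s k f) x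
        ≤ 1# + ofℕ k * (s * s * (ofℕ 36 + ofℕ 16 * t))
    reverse-Poincaré {t} zero sk≤t x = begin
      f x * f x + ofℕ 2 * (s * 0#) * Γ S f f x  ≈⟨ solve 3 (λ a s g → a :+ con (+ 2) :* (s :* con (+ 0)) :* g
        := a) refl (f x * f x) s _ ⟩
      f x * f x                                 ≤⟨ f²≤1 x ⟩
      1#                                        ≈⟨ solve 2 (λ s t → con (+ 1)
        := con (+ 1) :+ con (+ 0) :* (s :* s :* (con (+ 36) :+ con (+ 16) :* t))) refl s t ⟩
      1# + 0# * (s * s * (ofℕ 36 + ofℕ 16 * t)) ∎
    reverse-Poincaré {t} (suc k) s[1+k]≤t x = begin
      u x * u x + ofℕ 2 * (s * ofℕ (suc k)) * Γ S u u x
        ≈⟨ +-congˡ (*-congʳ (solve 2 (λ s k → con (+ 2) :* (s :* (con (+ 1) :+ k))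
          := con (+ 2) :* (s :* k) :+ con (+ 2) :* s) refl s (ofℕ k))) ⟩
      u x * u x + (ofℕ 2 * (s * ofℕ k) + ofℕ 2 * s) * Γ S u u x
        ≤⟨ euler-step 0≤s s≤1 (*-nonneg (0≤ofℕ 2) (*-nonneg 0≤s (0≤ofℕ k))) (flow-contraction k)
            (reverse-Poincaré k sk≤t) x ⟩
      1# + ofℕ k * (s * s * (ofℕ 36 + ofℕ 16 * t)) + s * s * (ofℕ 36 + ofℕ 8 * (ofℕ 2 * (s * ofℕ k)))
        ≤⟨ +-mono-≤ ≤-refl (*-monoˡ-≤ (square-nonneg s) (+-mono-≤ ≤-refl (*-monoˡ-≤ (0≤ofℕ 8)
            (*-monoˡ-≤ (0≤ofℕ 2) sk≤t)))) ⟩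
      1# + ofℕ k * (s * s * (ofℕ 36 + ofℕ 16 * t)) + s * s * (ofℕ 36 + ofℕ 8 * (ofℕ 2 * t))
        ≈⟨ solve 3 (λ k s t → con (+ 1) :+ k :* (s :* s :* (con (+ 36) :+ con (+ 16) :* t)) :+ s :* s :*
            (con (+ 36) :+ con (+ 8) :* (con (+ 2) :* t))
             := con (+ 1) :+ (con (+ 1) :+ k) :* (s :* s :* (con (+ 36) :+ con (+ 16) :* t)))
               refl (ofℕ k) s t ⟩
      1# + ofℕ (suc k) * (s * s * (ofℕ 36 + ofℕ 16 * t)) ∎
      where
      u = flow s (suc k) f
      sk≤t : s * ofℕ k ≤ t
      sk≤t = ≤-trans (*-monoˡ-≤ 0≤s (ofℕ-mono-≤ {k} {suc k} (ℕₚ.n≤1+n k))) s[1+k]≤t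

-- Self-adjointness, and the decay of the pairing with a sign function.

module Energy
  {c ℓ₁ ℓ₂} (ℝ : RealNumbers c ℓ₁ ℓ₂) {n : ℕ} {G : Graph n} (S : Signature G)
  (positive : ∀ x → 0 ℕ.< Graph.degree G x) where

  open RealNumbers ℝ hiding (zero)
  open OrderedField ℝ
  open ≤-Reasoning
  open Sums ℝ
  open SignedCalculus ℝ
  open Graph G
  open Signature S
  open Calculus ℝ S positive

  ⟨_,_⟩ : Fun {G = G} → Fun {G = G} → Carrier
  ⟨ f , g ⟩ = sum λ x → ofℕ (degree x) * (f x * g x)

  ⟨⟩-+* : ∀ s f v g → ⟨ (λ x → f x + s * v x) , g ⟩ ≈ ⟨ f , g ⟩ + s * ⟨ v , g ⟩
  ⟨⟩-+* s f v g = begin-equality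
    ⟨ (λ x → f x + s * v x) , g ⟩
      ≈⟨ sum-cong-≋ {n = n} (λ x → solve 5 (λ d f s v g → d :* ((f :+ s :* v) :* g)
        := d :* (f :* g) :+ s :* (d :* (v :* g)))
           refl (ofℕ (degree x)) (f x) s (v x) (g x)) ⟩
    sum (λ x → ofℕ (degree x) * (f x * g x) + s * (ofℕ (degree x) * (v x * g x)))
      ≈⟨ ∑-distrib-+ (λ x → ofℕ (degree x) * (f x * g x)) (λ x → s * (ofℕ (degree x) * (v x * g x))) ⟩
    ⟨ f , g ⟩ + sum (λ x → s * (ofℕ (degree x) * (v x * g x)))
      ≈⟨ +-congˡ (*-distribˡ-sum s λ x → ofℕ (degree x) * (v x * g x)) ⟨
    ⟨ f , g ⟩ + s * ⟨ v , g ⟩ ∎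

  ⟨⟩-comm : ∀ f g → ⟨ f , g ⟩ ≈ ⟨ g , f ⟩
  ⟨⟩-comm f g = sum-cong-≋ {n = n} λ x → *-congˡ (*-comm (f x) (g x))

  ⟨⟩-mono-≤ : ∀ {f a} → (∀ x → f x * f x ≤ a) → ⟨ f , f ⟩ ≤ ofℕ volume * a
  ⟨⟩-mono-≤ {f} {a} f²≤a = begin
    ⟨ f , f ⟩                          ≤⟨ sum-mono-≤ (λ x → *-monoˡ-≤ (0≤ofℕ (degree x)) (f²≤a x)) ⟩
    sum (λ x → ofℕ (degree x) * a)     ≈⟨ sum-cong-≋ {n = n} (λ x → *-comm (ofℕ (degree x)) a) ⟩
    sum (λ x → a * ofℕ (degree x))     ≈⟨ *-distribˡ-sum a (λ x → ofℕ (degree x)) ⟨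
    a * sum (λ x → ofℕ (degree x))     ≈⟨ *-congˡ (sym (ofℕ-sum degree)) ⟩
    a * ofℕ volume                     ≈⟨ *-comm a (ofℕ volume) ⟩
    ofℕ volume * a                     ∎

  ⟨unit,unit⟩ : ∀ (τ : Vector Sign n) → ⟨ (unit ∘ τ) , (unit ∘ τ) ⟩ ≈ ofℕ volume
  ⟨unit,unit⟩ τ = trans (sum-cong-≋ {n = n} λ x → trans (*-congˡ (unit² (τ x))) (*-identityʳ _)) (sym (ofℕ-sum degree))

  ∑∑∼ : (Fin n → Fin n → Carrier) → Carrier
  ∑∑∼ h = sum λ x → ∑∼ x (h x)

  private
    when-swap : ∀ x y {a b} → (x ∼ y → a ≈ b) → when (x ∼? y) a ≈ when (y ∼? x) b
    when-swap x y a≈b with x ∼? y | y ∼? x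
    ... | yes x∼y | yes _   = a≈b x∼y
    ... | yes x∼y | no y≁x  = ⊥-elim (y≁x (∼-sym x∼y))
    ... | no x≁y  | yes y∼x = ⊥-elim (x≁y (∼-sym y∼x))
    ... | no _    | no _    = refl

  ∑∑∼-swap : ∀ {h k} → (∀ x y → x ∼ y → h x y ≈ k y x) → ∑∑∼ h ≈ ∑∑∼ k
  ∑∑∼-swap {h} {k} h≈k = trans
    (sum-cong-≋ {n = n} λ x → sum-cong-≋ {n = n} λ y → when-swap x y (h≈k x y))
    (∑-comm λ x y → when (y ∼? x) (k y x))

  ⟨Δ,⟩ : ∀ f g → ⟨ Δσ f , g ⟩ ≈ ∑∑∼ (λ x y → g x * δ f x y)
  ⟨Δ,⟩ f g = sum-cong-≋ {n = n} λ x → begin-equality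
    ofℕ (degree x) * (Δσ f x * g x)     ≈⟨ solve 3 (λ d v g → d :* (v :* g) := g :* (d :* v)) refl _ _ (g x) ⟩
    g x * (ofℕ (degree x) * Δσ f x)     ≈⟨ *-congˡ (degree*avg x (δ f x)) ⟩
    g x * ∑∼ x (δ f x)                  ≈⟨ ∑∼-* x (g x) (δ f x) ⟨
    ∑∼ x (λ y → g x * δ f x y)          ∎

  -- Adding ⟨f, g⟩ cancels the diagonal of the Laplacian and leaves the signed adjacency form, whose
  -- symmetry is that of σ.
  ⟨Δ,⟩-expand : ∀ f g → ⟨ Δσ f , g ⟩ + ⟨ f , g ⟩ ≈ ∑∑∼ (λ x y → unit (σ x y) * (f y * g x))
  ⟨Δ,⟩-expand f g = begin-equality
    ⟨ Δσ f , g ⟩ + ⟨ f , g ⟩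
      ≈⟨ ∑-distrib-+ (λ x → ofℕ (degree x) * (Δσ f x * g x)) (λ x → ofℕ (degree x) * (f x * g x)) ⟨
    sum (λ x → ofℕ (degree x) * (Δσ f x * g x) + ofℕ (degree x) * (f x * g x))
      ≈⟨ sum-cong-≋ {n = n} expand ⟩
    ∑∑∼ (λ x y → unit (σ x y) * (f y * g x)) ∎
    where
    expand : ∀ x → ofℕ (degree x) * (Δσ f x * g x) + ofℕ (degree x) * (f x * g x) ≈ ∑∼ x (λ y → unit
        (σ x y) * (f y * g x))
    expand x = begin-equality
      ofℕ (degree x) * (Δσ f x * g x) + ofℕ (degree x) * (f x * g x)
        ≈⟨ solve 4 (λ d v f g → d :* (v :* g) :+ d :* (f :* g)
          := g :* (d :* v :+ f :* d)) refl (ofℕ (degree x)) (Δσ f x) (f x) (g x) ⟩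
      g x * (ofℕ (degree x) * Δσ f x + f x * ofℕ (degree x))
        ≈⟨ *-congˡ (+-cong (degree*avg x (δ f x)) (trans (*-congˡ (sym (∑∼-1 x))) (sym (∑∼-* x (f x) _)))) ⟩
      g x * (∑∼ x (δ f x) + ∑∼ x (λ _ → f x * 1#))
        ≈⟨ *-congˡ (∑∼-+ x _ _) ⟨
      g x * ∑∼ x (λ y → δ f x y + f x * 1#)
        ≈⟨ ∑∼-* x (g x) _ ⟨
      ∑∼ x (λ y → g x * (δ f x y + f x * 1#))
        ≈⟨ ∑∼-cong (λ y _ → trans (*-congˡ (+-congʳ (δ≈ f x y)))
             (solve 4 (λ e fx fy g → g :* (e :* fy :- fx :+ fx :* con (+ 1))
               := e :* (fy :* g)) refl (unit (σ x y)) (f x) (f y) (g x))) ⟩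
      ∑∼ x (λ y → unit (σ x y) * (f y * g x)) ∎

  Δ-selfAdjoint : ∀ f g → ⟨ Δσ f , g ⟩ ≈ ⟨ f , Δσ g ⟩
  Δ-selfAdjoint f g = begin-equality
    ⟨ Δσ f , g ⟩
      ≈⟨ +-cancel _ _ ⟨
    ⟨ Δσ f , g ⟩ + ⟨ f , g ⟩ - ⟨ f , g ⟩
      ≈⟨ +-cong (trans (⟨Δ,⟩-expand f g) (trans (∑∑∼-swap λ x y x∼y →
           *-cong (reflexive (≡.cong unit (σ-sym x∼y))) (*-comm (f y) (g x))) (sym (⟨Δ,⟩-expand g f))))
               (-‿cong (⟨⟩-comm f g)) ⟩
    ⟨ Δσ g , f ⟩ + ⟨ g , f ⟩ - ⟨ g , f ⟩
      ≈⟨ +-cancel _ _ ⟩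
    ⟨ Δσ g , f ⟩
      ≈⟨ ⟨⟩-comm (Δσ g) f ⟩
    ⟨ f , Δσ g ⟩ ∎

  euler-selfAdjoint : ∀ s f g → ⟨ euler s f , g ⟩ ≈ ⟨ f , euler s g ⟩
  euler-selfAdjoint s f g = begin-equality
    ⟨ euler s f , g ⟩              ≈⟨ ⟨⟩-+* s f (Δσ f) g ⟩
    ⟨ f , g ⟩ + s * ⟨ Δσ f , g ⟩   ≈⟨ +-cong (⟨⟩-comm f g) (*-congˡ
        (trans (Δ-selfAdjoint f g) (⟨⟩-comm f (Δσ g)))) ⟩
    ⟨ g , f ⟩ + s * ⟨ Δσ g , f ⟩   ≈⟨ ⟨⟩-+* s g (Δσ g) f ⟨
    ⟨ euler s g , f ⟩              ≈⟨ ⟨⟩-comm (euler s g) f ⟩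
    ⟨ f , euler s g ⟩              ∎

  private
    ±-bound : ∀ p q {d b} → ∣ d ∣≤ b → - ((unit p - unit q) * d) ≤ ofℕ ℤ.∣ (p ◃ 1) ℤ.- (q ◃ 1) ∣ * b
    ±-bound Sign.+ Sign.+ {d} {b} _ = ≤-reflexive
        (solve 2 (λ d b → :- ((con (+ 1) :- con (+ 1)) :* d) := con (+ 0) :* b) refl d b)
    ±-bound Sign.- Sign.- {d} {b} _ = ≤-reflexive
        (solve 2 (λ d b → :- ((:- con (+ 1) :- :- con (+ 1)) :* d) := con (+ 0) :* b) refl d b)
    ±-bound Sign.+ Sign.- {d} {b} (bounds _ -d≤b) = begin
      - ((1# - - 1#) * d)   ≈⟨ solve 1 (λ d → :- ((con (+ 1) :- :- con (+ 1)) :* d)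
        := con (+ 2) :* :- d) refl d ⟩
      ofℕ 2 * - d           ≤⟨ *-monoˡ-≤ (0≤ofℕ 2) -d≤b ⟩
      ofℕ 2 * b             ∎
    ±-bound Sign.- Sign.+ {d} {b} (bounds d≤b _) = begin
      - ((- 1# - 1#) * d)   ≈⟨ solve 1 (λ d → :- ((:- con (+ 1) :- con (+ 1)) :* d)
        := con (+ 2) :* d) refl d ⟩
      ofℕ 2 * d             ≤⟨ *-monoˡ-≤ (0≤ofℕ 2) d≤b ⟩
      ofℕ 2 * b             ∎

    δ-flip : ∀ f x y → x ∼ y → δ f y x ≈ - (unit (σ x y) * δ f x y)
    δ-flip f x y x∼y = begin-equality
      δ f y x                                 ≈⟨ δ≈ f y x ⟩
      unit (σ y x) * f x - f y                ≈⟨ +-cong (*-congʳ (reflexive (≡.cong unit (≡.sym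
          (σ-sym x∼y))))) (-‿cong (sym
          (trans (*-congʳ (unit² (σ x y))) (*-identityˡ (f y))))) ⟩
      e * f x - e * e * f y                   ≈⟨ solve 3 (λ e fx fy → e :* fx :- e :* e :* fy
        := :- (e :* (e :* fy :- fx))) refl e (f x) (f y) ⟩
      - (e * (e * f y - f x))                 ≈⟨ -‿cong (*-congˡ (sym (δ≈ f x y))) ⟩
      - (e * δ f x y)                         ∎
      where e = unit (σ x y)

  -- The two orientations of an edge are collected at its representative x < y, as in `frustration`,
  -- so that the two sums can be compared edge by edge.
  ∑∑∼-halve : ∀ h → ∑∑∼ h ≈ sum (λ x → sum λ y →
    when (x Fin.<? y) (when (x ∼? y) (h x y)) + when (x Fin.<? y) (when (y ∼? x) (h y x)))
  ∑∑∼-halve h = begin-equality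
    sum (λ x → sum λ y → A x y)
      ≈⟨ sum-cong-≋ {n = n} (λ x → sum-cong-≋ {n = n} (split x)) ⟩
    sum (λ x → sum λ y → when (x Fin.<? y) (A x y) + when (y Fin.<? x) (A x y))
      ≈⟨ sum-sum-+ (λ x y → when (x Fin.<? y) (A x y)) (λ x y → when (y Fin.<? x) (A x y)) ⟩
    sum (λ x → sum λ y → when (x Fin.<? y) (A x y)) + sum (λ x → sum λ y → when (y Fin.<? x) (A x y))
      ≈⟨ +-congˡ (∑-comm λ x y → when (y Fin.<? x) (A x y)) ⟩
    sum (λ x → sum λ y → when (x Fin.<? y) (A x y)) + sum (λ y → sum λ x → when (y Fin.<? x) (A x y))
      ≈⟨ sum-sum-+ (λ x y → when (x Fin.<? y) (A x y)) (λ y x → when (y Fin.<? x) (A x y)) ⟨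
    sum (λ x → sum λ y → when (x Fin.<? y) (A x y) + when (x Fin.<? y) (A y x)) ∎
    where
    A : Fin n → Fin n → Carrier
    A x y = when (x ∼? y) (h x y)
    sum-sum-+ : ∀ (s t : Fin n → Fin n → Carrier) →
      sum (λ x → sum λ y → s x y + t x y) ≈ sum (λ x → sum (s x)) + sum (λ x → sum (t x))
    sum-sum-+ s t = trans (sum-cong-≋ {n = n} λ x → ∑-distrib-+ (s x) (t x)) (∑-distrib-+ (λ x → sum (s x))
        (λ x → sum (t x)))
    split : ∀ x y → A x y ≈ when (x Fin.<? y) (A x y) + when (y Fin.<? x) (A x y)
    split x y = cases (x Fin.<? y) (y Fin.<? x)
      where
      cases : (p : Dec (x Fin.< y)) (q : Dec (y Fin.< x)) → A x y ≈ when p (A x y) + when q (A x y)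
      cases (yes x<y) (yes y<x) = ⊥-elim (ℕₚ.<-asym x<y y<x)
      cases (yes _)   (no  _)   = sym (+-identityʳ _)
      cases (no  _)   (yes _)   = sym (+-identityˡ _)
      cases (no x≮y)  (no y≮x)  = trans (when-zero (x ∼? y) λ x∼y → ⊥-elim (∼-irr x≡y x∼y)) (sym (+-identityˡ 0#))
        where
        x≡y : x ≡ y
        x≡y = Finₚ.toℕ-injective (ℕₚ.≤-antisym (ℕₚ.≮⇒≥ y≮x) (ℕₚ.≮⇒≥ x≮y))

  -- The increment seen from y is -σ times the one seen from x, so the two orientations of an edge
  -- add up to (τ(x) - στ(y)) δf. The modulus of the first factor is the contribution of the edge to
  -- `frustration`.
  ⟨Δ,unit⟩-bound : ∀ (τ : Vector Sign n) f {b} → (∀ x y → x ∼ y → ∣ δ f x y ∣≤ b) →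
    - ⟨ Δσ f , (unit ∘ τ) ⟩ ≤ ofℕ (frustration S τ) * b
  ⟨Δ,unit⟩-bound τ f {b} δ≤b = begin
    - ⟨ Δσ f , (unit ∘ τ) ⟩
      ≈⟨ -‿cong (trans (⟨Δ,⟩ f (unit ∘ τ)) (∑∑∼-halve h)) ⟩
    - sum (λ x → sum λ y → B x y)
      ≤⟨ neg-bound (λ x → neg-bound (pointwise x)) ⟩
    sum (λ x → sum λ y → ofℕ (N x y)) * b
      ≈⟨ *-congʳ (sym (trans (ofℕ-sum (λ x → sumℕ (N x))) (sum-cong-≋ {n = n} λ x → ofℕ-sum (N x)))) ⟩
    ofℕ (frustration S τ) * b ∎
    where
    h : Fin n → Fin n → Carrier
    h x y = unit (τ x) * δ f x y
    B : Fin n → Fin n → Carrier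
    B x y = when (x Fin.<? y) (when (x ∼? y) (h x y)) + when (x Fin.<? y) (when (y ∼? x) (h y x))
    N : Fin n → Fin n → ℕ
    N x y = if does (x ∼? y) ∧ does (x Fin.<? y) then ℤ.∣ (τ x ◃ 1) ℤ.- ((σ x y Sign.* τ y) ◃ 1) ∣ else 0
    sum-*ʳ : ∀ {m} (t : Vector Carrier m) → sum (λ i → t i * b) ≈ sum t * b
    sum-*ʳ {m} t = trans (sum-cong-≋ {n = m} λ i → *-comm (t i) b)
        (trans (sym (*-distribˡ-sum b t)) (*-comm b (sum t)))
    neg-bound : ∀ {m} {s t : Vector Carrier m} → (∀ i → - s i ≤ t i * b) → - sum s ≤ sum t * b
    neg-bound {m} {s} {t} s≤t = begin
      - sum s                      ≈⟨ solve 1 (λ a → :- a := (:- con (+ 1)) :* a) refl _ ⟩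
      (- 1#) * sum s               ≈⟨ *-distribˡ-sum (- 1#) s ⟩
      sum (λ i → (- 1#) * s i)     ≤⟨ sum-mono-≤ {m} (λ i → ≤-trans (≤-reflexive
          (solve 1 (λ a → (:- con (+ 1)) :* a := :- a) refl (s i))) (s≤t i)) ⟩
      sum (λ i → t i * b)          ≈⟨ sum-*ʳ t ⟩
      sum t * b                    ∎
    edge : ∀ x y → x ∼ y → - (h x y + h y x) ≤ ofℕ ℤ.∣ (τ x ◃ 1) ℤ.- ((σ x y Sign.* τ y) ◃ 1) ∣ * b
    edge x y x∼y = begin
      - (h x y + h y x)
        ≈⟨ -‿cong (+-congˡ (*-congˡ (δ-flip f x y x∼y))) ⟩
      - (unit (τ x) * δ f x y + unit (τ y) * - (unit (σ x y) * δ f x y))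
        ≈⟨ solve 4 (λ p q e d → :- (p :* d :+ q :* :- (e :* d))
          := :- ((p :- e :* q) :* d)) refl (unit (τ x)) (unit (τ y)) (unit (σ x y)) (δ f x y) ⟩
      - ((unit (τ x) - unit (σ x y) * unit (τ y)) * δ f x y)
        ≈⟨ -‿cong (*-congʳ (+-congˡ (-‿cong (sym (unit-* (σ x y) (τ y)))))) ⟩
      - ((unit (τ x) - unit (σ x y Sign.* τ y)) * δ f x y)
        ≤⟨ ±-bound (τ x) (σ x y Sign.* τ y) (δ≤b x y x∼y) ⟩
      ofℕ ℤ.∣ (τ x ◃ 1) ℤ.- ((σ x y Sign.* τ y) ◃ 1) ∣ * b ∎
    none : - (0# + 0#) ≤ 0# * b
    none = ≤-reflexive (solve 1 (λ b → :- (con (+ 0) :+ con (+ 0)) := con (+ 0) :* b) refl b)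
    pointwise : ∀ x y → - B x y ≤ ofℕ (N x y) * b
    pointwise x y = cases (x Fin.<? y) (x ∼? y) (y ∼? x)
      where
      cases : (p : Dec (x Fin.< y)) (q : Dec (x ∼ y)) (r : Dec (y ∼ x)) →
        - (when p (when q (h x y)) + when p (when r (h y x))) ≤
          ofℕ (if does q ∧ does p then ℤ.∣ (τ x ◃ 1) ℤ.- ((σ x y Sign.* τ y) ◃ 1) ∣ else 0) * b
      cases (yes _) (yes x∼y) (yes _)   = edge x y x∼y
      cases (yes _) (yes x∼y) (no y≁x)  = ⊥-elim (y≁x (∼-sym x∼y))
      cases (yes _) (no x≁y)  (yes y∼x) = ⊥-elim (x≁y (∼-sym y∼x))
      cases (yes _) (no _)    (no _)    = none
      cases (no _)  (yes _)   _         = none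
      cases (no _)  (no _)    _         = none

  ⟨unit,⟩-euler : ∀ (τ : Vector Sign n) {s} f {b} → 0# ≤ s → (∀ x y → x ∼ y → ∣ δ f x y ∣≤ b) →
    ⟨ (unit ∘ τ) , f ⟩ ≤ ⟨ (unit ∘ τ) , euler s f ⟩ + s * (ofℕ (frustration S τ) * b)
  ⟨unit,⟩-euler τ {s} f {b} 0≤s δ≤b = ≤-by _ (*-nonneg 0≤s (≤⇒0≤- (⟨Δ,unit⟩-bound τ f δ≤b))) (begin-equality
    ⟨ (unit ∘ τ) , f ⟩ + s * (ofℕ (frustration S τ) * b - - e)
      ≈⟨ solve 4 (λ a s e p → a :+ s :* (p :- :- e) := (a :+ s :* e) :+ s :* p) refl _ s e _ ⟩
    (⟨ (unit ∘ τ) , f ⟩ + s * e) + s * (ofℕ (frustration S τ) * b)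
      ≈⟨ +-congʳ (trans (+-congʳ (⟨⟩-comm (unit ∘ τ) f))
          (trans (sym (⟨⟩-+* s f (Δσ f) (unit ∘ τ))) (⟨⟩-comm (euler s f) (unit ∘ τ)))) ⟩
    ⟨ (unit ∘ τ) , euler s f ⟩ + s * (ofℕ (frustration S τ) * b) ∎)
    where e = ⟨ Δσ f , (unit ∘ τ) ⟩

-- Double negation commutes with a finite conjunction. This lets one short walk be chosen from every
-- vertex simultaneously, although each exists only up to double negation.
¬¬-∀ : ∀ {p} {n} {P : Fin n → Set p} → (∀ i → ¬ ¬ P i) → ¬ ¬ (∀ i → P i)
¬¬-∀ {n = zero}  _   ¬all = ¬all λ ()
¬¬-∀ {n = suc n} ¬¬p ¬all = ¬¬p zero λ p₀ → ¬¬-∀ (¬¬p ∘ suc) λ ps →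
  ¬all λ { zero → p₀ ; (suc i) → ps i }

-- Short walks, their signs, and balance.

module Walks {n : ℕ} {G : Graph n} (S : Signature G) where
  open Graph G
  open Signature S

  private variable
    x y : Fin n

  walkSign : Walk x y → Sign
  walkSign ε = Sign.+
  walkSign (_◅_ {x} {y} _ w) = σ x y Sign.* walkSign w

  -- Otherwise all lengths would exceed every k: once every walk has length at least k, a walk of
  -- length exactly k realises the distance, so k ≤ D and that walk is short. The double negation
  -- spares the search for a shortest walk.
  shortWalk : Connected → ∀ {D} → IsDiameter D → ∀ x y → ¬ ¬ (Σ (Walk x y) λ w → length w ℕ.≤ D)
  shortWalk connected (_ , max) x y ¬short = ℕₚ.<-irrefl ≡.refl (unbounded (suc (length w₀)) w₀)
    where
    w₀ = connected x y
    unbounded : ∀ k (w : Walk x y) → k ℕ.≤ length w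
    unbounded zero    w = ℕ.z≤n
    unbounded (suc k) w = ℕₚ.≤∧≢⇒< (unbounded k w) λ k≡∣w∣ →
      ¬short (w , ≡.subst (ℕ._≤ _) k≡∣w∣ (max x y k ((w , ≡.sym k≡∣w∣) , unbounded k)))

  private
    *-telescope : ∀ a b c → (a Sign.* b) Sign.* (b Sign.* c) ≡ a Sign.* c
    *-telescope Sign.+ Sign.+ c = ≡.refl
    *-telescope Sign.+ Sign.- Sign.+ = ≡.refl
    *-telescope Sign.+ Sign.- Sign.- = ≡.refl
    *-telescope Sign.- Sign.+ c = ≡.refl
    *-telescope Sign.- Sign.- c = ≡.refl

  -- θ is a switching function: σ(x,y) = θ(x)θ(y) on edges, and the product around a cycle
  -- telescopes.
  potential⇒balanced : (θ : Fin n → Sign) → (∀ x y → x ∼ y → θ x ≡ σ x y Sign.* θ y) → Balanced S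
  potential⇒balanced θ θ-σ C = ≡.trans
    (≡.cong₂ Sign._*_ (telescope vertex steps) (σ≡ _ _ closes))
    (≡.trans (*-telescope (θ (vertex zero)) _ _) (Signₚ.s*s≡+ (θ (vertex zero))))
    where
    open Cycle C
    σ≡ : ∀ x y → x ∼ y → σ x y ≡ θ x Sign.* θ y
    σ≡ x y x∼y rewrite θ-σ x y x∼y | Signₚ.*-assoc (σ x y) (θ y) (θ y) | Signₚ.s*s≡+ (θ y) = ≡.sym (Signₚ.*-identityʳ _)
    telescope : ∀ {k} (v : Fin (suc k) → Fin n) → (∀ i → v (Fin.inject₁ i) ∼ v (suc i)) →
      foldr Sign._*_ Sign.+ (λ i → σ (v (Fin.inject₁ i)) (v (suc i))) ≡ θ (v zero) Sign.* θ (v (Fin.fromℕ k))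
    telescope {zero}  v _  = ≡.sym (Signₚ.s*s≡+ (θ (v zero)))
    telescope {suc k} v v∼ = ≡.trans
      (≡.cong₂ Sign._*_ (σ≡ _ _ (v∼ zero)) (telescope (v ∘ suc) (v∼ ∘ suc)))
      (*-telescope (θ (v zero)) (θ (v (suc zero))) _)

  frustratedEdge : Unbalanced S → (θ : Fin n → Sign) →
    ¬ ¬ (∃[ x ] ∃[ y ] x ∼ y × θ x ≢ σ x y Sign.* θ y)
  frustratedEdge unbalanced θ ¬edge = unbalanced (potential⇒balanced θ λ x y x∼y → θ-σ x y x∼y)
    where
    θ-σ : ∀ x y → x ∼ y → θ x ≡ σ x y Sign.* θ y
    θ-σ x y x∼y with θ x Sign.≟ σ x y Sign.* θ y
    ... | yes eq = eq
    ... | no neq = ⊥-elim (¬edge (x , y , x∼y , neq))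

⌈⌉+⌈⌉ : ∀ D → ⌈ D /2⌉ ℕ.+ ⌈ suc D /2⌉ ≡ suc D
⌈⌉+⌈⌉ D = ≡.trans (ℕₚ.+-comm ⌈ D /2⌉ _) (≡.cong suc (ℕₚ.⌊n/2⌋+⌈n/2⌉≡n D))

-- From a gradient bound to a pointwise bound, along walks.

module WalkEstimate
  {c ℓ₁ ℓ₂} (ℝ : RealNumbers c ℓ₁ ℓ₂) {n : ℕ} {G : Graph n} (S : Signature G)
  (positive : ∀ x → 0 ℕ.< Graph.degree G x) where

  open RealNumbers ℝ hiding (zero)
  open OrderedField ℝ
  open ≤-Reasoning
  open Sums ℝ
  open SignedCalculus ℝ
  open Graph G
  open Signature S
  open Calculus ℝ S positive
  open Walks S

  private
    ≢⇒neg : ∀ {s t} → s ≢ t → unit t ≈ - unit s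
    ≢⇒neg {Sign.+} {Sign.+} s≢t = ⊥-elim (s≢t ≡.refl)
    ≢⇒neg {Sign.+} {Sign.-} s≢t = refl
    ≢⇒neg {Sign.-} {Sign.+} s≢t = solve 0 (con (+ 1) := :- (:- con (+ 1))) refl
    ≢⇒neg {Sign.-} {Sign.-} s≢t = ⊥-elim (s≢t ≡.refl)

  module _ {f : Fun {G = G}} {β : Carrier} (0≤β : 0# ≤ β)
    (gradient : ∀ x → ofℕ 2 * ∑∼ x (λ y → δ f x y * δ f x y) ≤ β * β) where

    private
      δ²-nonneg : ∀ x y → 0# ≤ when (x ∼? y) (δ f x y * δ f x y)
      δ²-nonneg x y = when-nonneg (x ∼? y) λ _ → square-nonneg (δ f x y)

      when-δ² : ∀ {x y} → x ∼ y → δ f x y * δ f x y ≤ when (x ∼? y) (δ f x y * δ f x y)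
      when-δ² {x} {y} x∼y = ≤-reflexive (reflexive (≡.sym (when-yes (x ∼? y) x∼y)))

    -- Only the last edge of a walk of odd length is charged on its own. The factor 2 in `gradient`
    -- is that of (a - b)² ≤ 2(a² + b²) in `twoSteps`.
    oneStep : ∀ x y → x ∼ y → ∣ δ f x y ∣≤ β
    oneStep x y x∼y = ∣∣≤-square 0≤β (begin
      δ f x y * δ f x y                          ≤⟨ ≤-trans (when-δ² x∼y) (term≤sum (δ²-nonneg x) y) ⟩
      ∑∼ x (λ y → δ f x y * δ f x y)             ≤⟨ ≤-by _ (sum-nonneg (δ²-nonneg x))
          (solve 1 (λ a → a :+ a := con (+ 2) :* a) refl _) ⟩
      ofℕ 2 * ∑∼ x (λ y → δ f x y * δ f x y)     ≤⟨ gradient x ⟩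
      β * β                                      ∎)

    -- A path x ∼ y ∼ z with x ≢ z uses two distinct terms of Γ at y; if x ≡ z the
    -- two increments cancel.  Hence a walk costs β per two steps only.
    twoSteps : ∀ x y z → x ∼ y → y ∼ z → ∣ unit (σ x y) * (unit (σ y z) * f z) - f x ∣≤ β
    twoSteps x y z x∼y y∼z with x Fin.≟ z
    ... | yes ≡.refl = ∣∣≤-square 0≤β (begin
      d * d    ≈⟨ *-cong d≈0 d≈0 ⟩
      0# * 0#  ≈⟨ zeroˡ 0# ⟩
      0#       ≤⟨ square-nonneg β ⟩
      β * β    ∎)
      where
      d = unit (σ x y) * (unit (σ y x) * f x) - f x
      d≈0 : d ≈ 0#
      d≈0 = begin-equality
        unit (σ x y) * (unit (σ y x) * f x) - f x  ≈⟨ +-congʳ (sym (*-assoc _ _ _)) ⟩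
        unit (σ x y) * unit (σ y x) * f x - f x    ≈⟨ +-congʳ (*-congʳ
            (trans (*-congˡ (reflexive (≡.cong unit (σ-sym y∼z)))) (unit² (σ x y)))) ⟩
        1# * f x - f x                             ≈⟨ solve 1 (λ a → con (+ 1) :* a :- a
          := con (+ 0)) refl (f x) ⟩
        0#                                         ∎
    ... | no x≢z = ∣∣≤-resp (begin-equality
      e * (δ f y z - δ f y x)
        ≈⟨ *-congˡ (+-cong (δ≈ f y z) (-‿cong
            (trans (δ≈ f y x) (+-congʳ (*-congʳ (reflexive (≡.cong unit (≡.sym (σ-sym x∼y))))))))) ⟩
      e * ((e′ * f z - f y) - (e * f x - f y))
        ≈⟨ solve 5 (λ e e′ fx fy fz → e :* ((e′ :* fz :- fy) :- (e :* fx :- fy))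
          := e :* (e′ :* fz) :- e :* e :* fx) refl e e′ (f x) (f y) (f z) ⟩
      e * (e′ * f z) - e * e * f x
        ≈⟨ +-congˡ (-‿cong (trans (*-congʳ (unit² (σ x y))) (*-identityˡ (f x)))) ⟩
      e * (e′ * f z) - f x ∎)
      (∣∣≤-unit (σ x y) (∣∣≤-square 0≤β (begin
        (δ f y z - δ f y x) * (δ f y z - δ f y x)
          ≤⟨ ≤-by _ (square-nonneg (δ f y z + δ f y x))
              (solve 2 (λ a b → (a :- b) :* (a :- b) :+ (a :+ b) :* (a :+ b)
                := con (+ 2) :* (b :* b :+ a :* a)) refl (δ f y z) (δ f y x)) ⟩
        ofℕ 2 * (δ f y x * δ f y x + δ f y z * δ f y z)
          ≤⟨ *-monoˡ-≤ (0≤ofℕ 2) (≤-trans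
              (+-mono-≤ (when-δ² (∼-sym x∼y)) (when-δ² y∼z)) (two-terms≤sum (δ²-nonneg y) x≢z)) ⟩
        ofℕ 2 * ∑∼ y (λ z → δ f y z * δ f y z)
          ≤⟨ gradient y ⟩
        β * β ∎)))
      where
      e = unit (σ x y)
      e′ = unit (σ y z)

    walk-bound : ∀ {x y} (w : Walk x y) → ∣ unit (walkSign w) * f y - f x ∣≤ ofℕ ⌈ length w /2⌉ * β
    walk-bound {x} ε = bounds
      (≤-reflexive (solve 2 (λ a β → con (+ 1) :* a :- a := con (+ 0) :* β) refl (f x) β))
      (≤-reflexive (solve 2 (λ a β → :- (con (+ 1) :* a :- a) := con (+ 0) :* β) refl (f x) β))
    walk-bound {x} {y} (x∼y ◅ ε) = ∣∣≤-resp
      (trans (δ≈ f x y) (+-congʳ (*-congʳ (sym (trans (unit-* (σ x y) Sign.+) (*-identityʳ _))))))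
      (∣∣≤-weaken (oneStep x y x∼y) β≤)
      where
      β≤ : β ≤ ofℕ 1 * β
      β≤ = ≤-reflexive (sym (trans (*-congʳ ofℕ-1) (*-identityˡ β)))
    walk-bound {x} {y} (_◅_ {_} {a} x∼a (_◅_ {_} {b} a∼b w)) = ∣∣≤-resp (begin-equality
      (e * (e′ * f b) - f x) + e * (e′ * (unit (walkSign w) * f y - f b))
        ≈⟨ solve 6 (λ e e′ t fb fx fy → (e :* (e′ :* fb) :- fx) :+ e :* (e′ :* (t :* fy :- fb))
          := (e :* (e′ :* t)) :* fy :- fx) refl e e′ (unit (walkSign w)) (f b) (f x) (f y) ⟩
      e * (e′ * unit (walkSign w)) * f y - f x
        ≈⟨ +-congʳ (*-congʳ (sym (trans (unit-* (σ x a) _) (*-congˡ (unit-* (σ a b) (walkSign w)))))) ⟩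
      unit (walkSign (x∼a ◅ a∼b ◅ w)) * f y - f x ∎)
      (∣∣≤-weaken (∣∣≤-+ (twoSteps x a b x∼a a∼b) (∣∣≤-unit (σ x a) (∣∣≤-unit (σ a b) (walk-bound w))))
          (≤-reflexive distr))
      where
      e = unit (σ x a)
      e′ = unit (σ a b)
      distr : β + ofℕ ⌈ length w /2⌉ * β ≈ ofℕ (suc ⌈ length w /2⌉) * β
      distr = solve 2 (λ β k → β :+ k :* β := (con (+ 1) :+ k) :* β) refl β _

    -- The signs of chosen short walks to x₀ are a candidate potential, which must fail at some edge
    -- x ∼ y. The chosen walk from x and the detour through y then transport f(x₀) to x with
    -- opposite signs, and both results are close to f(x); their difference is 2f(x₀) up to sign.
    -- Rounding up to pairs of edges costs nothing in total, as ⌈D/2⌉ + ⌈(D+1)/2⌉ = D + 1.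
    antipodal-bound : Connected → Unbalanced S → ∀ {D} → IsDiameter D → ∀ x₀ →
      ofℕ 4 * (f x₀ * f x₀) ≤ (ofℕ (suc D) * β) * (ofℕ (suc D) * β)
    antipodal-bound connected unbalanced {D} diameter x₀ =
      λ lt → ¬¬-∀ (λ x → shortWalk connected diameter x x₀) λ W →
        frustratedEdge unbalanced (walkSign ∘ proj₁ ∘ W) λ (x , y , x∼y , s≢t) → estimate W x∼y s≢t lt
      where
      estimate : (W : ∀ x → Σ (Walk x x₀) λ w → length w ℕ.≤ D) → ∀ {x y} → x ∼ y →
        walkSign (proj₁ (W x)) ≢ σ x y Sign.* walkSign (proj₁ (W y)) →
        ofℕ 4 * (f x₀ * f x₀) ≤ (ofℕ (suc D) * β) * (ofℕ (suc D) * β)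
      estimate W {x} {y} x∼y s≢t = begin
        ofℕ 4 * (f x₀ * f x₀)
          ≈⟨ solve 1 (λ a → con (+ 4) :* (a :* a) := (con (+ 2) :* a) :* (con (+ 2) :* a)) refl (f x₀) ⟩
        (ofℕ 2 * f x₀) * (ofℕ 2 * f x₀)
          ≤⟨ square-∣∣≤ (∣∣≤-weaken 2f≤ length≤) ⟩
        (ofℕ (suc D) * β) * (ofℕ (suc D) * β) ∎
        where
        w = proj₁ (W x)
        w′ = x∼y ◅ proj₁ (W y)
        s = unit (walkSign w)
        2f≤ : ∣ ofℕ 2 * f x₀ ∣≤ ofℕ ⌈ length w /2⌉ * β + ofℕ ⌈ length w′ /2⌉ * β
        2f≤ = ∣∣≤-resp (begin-equality
          s * ((s * f x₀ - f x) + - (unit (walkSign w′) * f x₀ - f x))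
            ≈⟨ *-congˡ (+-congˡ (-‿cong (+-congʳ (*-congʳ (≢⇒neg s≢t))))) ⟩
          s * ((s * f x₀ - f x) + - (- s * f x₀ - f x))
            ≈⟨ solve 3 (λ s a b → s :* ((s :* a :- b) :+ :- ((:- s) :* a :- b))
              := (s :* s) :* (con (+ 2) :* a)) refl s (f x₀) (f x) ⟩
          s * s * (ofℕ 2 * f x₀)
            ≈⟨ trans (*-congʳ (unit² (walkSign w))) (*-identityˡ _) ⟩
          ofℕ 2 * f x₀ ∎)
          (∣∣≤-unit (walkSign w) (∣∣≤-+ (walk-bound w) (∣∣≤-neg (walk-bound w′))))
        length≤ : ofℕ ⌈ length w /2⌉ * β + ofℕ ⌈ length w′ /2⌉ * β ≤ ofℕ (suc D) * β
        length≤ = begin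
          ofℕ ⌈ length w /2⌉ * β + ofℕ ⌈ length w′ /2⌉ * β
            ≈⟨ distribʳ β _ _ ⟨
          (ofℕ ⌈ length w /2⌉ + ofℕ ⌈ length w′ /2⌉) * β
            ≈⟨ *-congʳ (ofℕ-+ ⌈ length w /2⌉ ⌈ length w′ /2⌉) ⟨
          ofℕ (⌈ length w /2⌉ ℕ.+ ⌈ length w′ /2⌉) * β
            ≤⟨ *-monoʳ-≤ 0≤β (ofℕ-mono-≤ {⌈ length w /2⌉ ℕ.+ ⌈ length w′ /2⌉} {suc D} (≡.subst
                (⌈ length w /2⌉ ℕ.+ ⌈ length w′ /2⌉ ℕ.≤_) (⌈⌉+⌈⌉ D)
                 (ℕₚ.+-mono-≤ (ℕₚ.⌈n/2⌉-mono (proj₂ (W x))) (ℕₚ.⌈n/2⌉-mono (ℕ.s≤s (proj₂ (W y))))))) ⟩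
          ofℕ (suc D) * β ∎

-- Degrees in a graph that contains a cycle.

module Degrees {n : ℕ} (G : Graph n) where
  open Graph G
  open MonoidSum ℕₚ.+-0-monoid using (sum)

  private
    term≤sum : ∀ {m} (t : Vector ℕ m) i → t i ℕ.≤ sum t
    term≤sum t zero    = ℕₚ.m≤m+n _ _
    term≤sum t (suc i) = ℕₚ.≤-trans (term≤sum (t ∘ suc) i) (ℕₚ.m≤n+m _ _)

    two-terms≤sum : ∀ {m} (t : Vector ℕ m) {i j} → i ≢ j → t i ℕ.+ t j ℕ.≤ sum t
    two-terms≤sum t {zero}  {zero}  i≢j = ⊥-elim (i≢j ≡.refl)
    two-terms≤sum t {zero}  {suc j} i≢j = ℕₚ.+-monoʳ-≤ _ (term≤sum (t ∘ suc) j)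
    two-terms≤sum t {suc i} {zero}  i≢j = ℕₚ.≤-trans (ℕₚ.≤-reflexive (ℕₚ.+-comm (t (suc i)) (t zero)))
        (ℕₚ.+-monoʳ-≤ (t zero) (term≤sum (t ∘ suc) i))
    two-terms≤sum t {suc i} {suc j} i≢j = ℕₚ.≤-trans (two-terms≤sum (t ∘ suc) (i≢j ∘ ≡.cong suc)) (ℕₚ.m≤n+m _ _)

    count : ∀ {x y} → x ∼ y → (if does (x ∼? y) then 1 else 0) ≡ 1
    count {x} {y} x∼y with x ∼? y
    ... | yes _  = ≡.refl
    ... | no x≁y = ⊥-elim (x≁y x∼y)

  neighbour⇒0<degree : ∀ {x y} → x ∼ y → 0 ℕ.< degree x
  neighbour⇒0<degree {x} {y} x∼y =
    ≡.subst (ℕ._≤ degree x) (count x∼y) (term≤sum (λ y → if does (x ∼? y) then 1 else 0) y)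

  neighbours⇒2≤degree : ∀ {x y z} → x ∼ y → x ∼ z → y ≢ z → 2 ℕ.≤ degree x
  neighbours⇒2≤degree {x} {y} {z} x∼y x∼z y≢z =
    ≡.subst (ℕ._≤ degree x) (≡.cong₂ ℕ._+_ (count x∼y) (count x∼z))
      (two-terms≤sum (λ y → if does (x ∼? y) then 1 else 0) y≢z)

  degree≤maxDegree : ∀ x → degree x ℕ.≤ maxDegree
  degree≤maxDegree = ≤max degree
    where
    ≤max : ∀ {m} (t : Vector ℕ m) i → t i ℕ.≤ foldr ℕ._⊔_ 0 t
    ≤max t zero    = ℕₚ.m≤m⊔n _ _
    ≤max t (suc i) = ℕₚ.≤-trans (≤max (t ∘ suc) i) (ℕₚ.m≤n⊔m _ _)

  module _ (C : Cycle) where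
    open Cycle C

    cycle⇒0<degree : Connected → ∀ x → 0 ℕ.< degree x
    cycle⇒0<degree connected x with x Fin.≟ vertex zero
    ... | yes ≡.refl = neighbour⇒0<degree (steps zero)
    ... | no x≢v with connected x (vertex zero)
    ...   | ε       = ⊥-elim (x≢v ≡.refl)
    ...   | x∼y ◅ _ = neighbour⇒0<degree x∼y

    cycle⇒2≤degree : 2 ℕ.≤ degree (vertex zero)
    cycle⇒2≤degree = neighbours⇒2≤degree (steps zero) (∼-sym closes) λ eq → 1≢last (distinct eq)
      where
      1≢last : suc zero ≢ Fin.fromℕ (2 ℕ.+ m)
      1≢last ()

    -- If a vertex of the cycle has a leaf as neighbour, the leaf will do: its only neighbour lies
    -- on the cycle. Otherwise the cycle vertex itself will do.
    branching-neighbours : ∃[ x ] (∀ y → x ∼ y → 2 ℕ.≤ degree y)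
    branching-neighbours with Finₚ.any? (λ y → (vertex zero ∼? y) ×-dec (degree y ℕ.<? 2))
    ... | yes (y , v∼y , leaf) = y , λ z y∼z → ≡.subst (λ v → 2 ℕ.≤ degree v) (v≡ z y∼z) cycle⇒2≤degree
      where
      v≡ : ∀ z → y ∼ z → vertex zero ≡ z
      v≡ z y∼z with vertex zero Fin.≟ z
      ... | yes v≡z = v≡z
      ... | no v≢z  = ⊥-elim (ℕₚ.<⇒≱ leaf (neighbours⇒2≤degree (∼-sym v∼y) y∼z v≢z))
    ... | no ¬leaf = vertex zero , λ y v∼y → ℕₚ.≮⇒≥ λ leaf → ¬leaf (y , v∼y , leaf)

-- A lower bound for the dimension N.

module DimensionBound
  {c ℓ₁ ℓ₂} (ℝ : RealNumbers c ℓ₁ ℓ₂) {n : ℕ} {G : Graph n} (S : Signature G)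
  (positive : ∀ x → 0 ℕ.< Graph.degree G x) where

  open RealNumbers ℝ hiding (zero)
  open OrderedField ℝ
  open ≤-Reasoning
  open Sums ℝ
  open SignedCalculus ℝ
  open Graph G
  open Signature S
  open Calculus ℝ S positive

  private
    avg-single : ∀ {x y h} → y ∼ x → (∀ z → z ≢ x → h z ≈ 0#) → avg y h ≈ 1/ℕ (degree y) * h x
    avg-single {x} {y} {h} y∼x h≈0 = *-congˡ (trans
      (sum-single {t = λ z → when (y ∼? z) (h z)} x λ z z≢x → when-zero (y ∼? z) λ _ → h≈0 z z≢x)
      (reflexive (when-yes (y ∼? x) y∼x)))

  module _ (x₀ : Fin n) (branching : ∀ y → x₀ ∼ y → 2 ℕ.≤ degree y) where

    indicator : Fun {G = G}
    indicator y = when (y Fin.≟ x₀) 1#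

    private
      f = indicator
      ρ : Fin n → Carrier
      ρ y = 1/ℕ (degree y)

      2ρ≤1 : ∀ {y} → x₀ ∼ y → ofℕ 2 * ρ y ≤ 1#
      2ρ≤1 {y} x₀∼y = ≤-trans (*-monoˡ-≤ (0≤ofℕ 2) (1/ℕ-antitone {1} {degree y} (branching y x₀∼y)))
          (≤-reflexive 2*½)

      f-at : f x₀ ≈ 1#
      f-at = reflexive (when-yes (x₀ Fin.≟ x₀) ≡.refl)

      f-off : ∀ {y} → y ≢ x₀ → f y ≈ 0#
      f-off {y} y≢x₀ = when-zero (y Fin.≟ x₀) (⊥-elim ∘ y≢x₀)

      ∼⇒≢ : ∀ {y} → x₀ ∼ y → y ≢ x₀
      ∼⇒≢ x₀∼y y≡x₀ = ∼-irr (≡.sym y≡x₀) x₀∼y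

      δ-x₀ : ∀ {y} → x₀ ∼ y → δ f x₀ y ≈ - 1#
      δ-x₀ {y} x₀∼y = begin-equality
        δ f x₀ y                   ≈⟨ δ≈ f x₀ y ⟩
        unit (σ x₀ y) * f y - f x₀ ≈⟨ +-cong (*-congˡ (f-off (∼⇒≢ x₀∼y))) (-‿cong f-at) ⟩
        unit (σ x₀ y) * 0# - 1#    ≈⟨ solve 1 (λ e → e :* con (+ 0) :- con (+ 1)
          := :- con (+ 1)) refl (unit (σ x₀ y)) ⟩
        - 1#                       ∎

      δ-y : ∀ {y} → x₀ ∼ y → δ f y x₀ ≈ unit (σ x₀ y)
      δ-y {y} x₀∼y = begin-equality
        δ f y x₀                   ≈⟨ δ≈ f y x₀ ⟩
        unit (σ y x₀) * f x₀ - f y ≈⟨ +-cong (*-cong (reflexive (≡.cong unit (≡.sym (σ-sym x₀∼y)))) f-at)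
            (-‿cong (f-off (∼⇒≢ x₀∼y))) ⟩
        unit (σ x₀ y) * 1# - 0#    ≈⟨ solve 1 (λ e → e :* con (+ 1) :- con (+ 0) := e) refl (unit (σ x₀ y)) ⟩
        unit (σ x₀ y)              ∎

      δ-y-off : ∀ {y} → x₀ ∼ y → ∀ z → z ≢ x₀ → δ f y z ≈ 0#
      δ-y-off {y} x₀∼y z z≢x₀ = begin-equality
        δ f y z                    ≈⟨ δ≈ f y z ⟩
        unit (σ y z) * f z - f y   ≈⟨ +-cong (*-congˡ (f-off z≢x₀)) (-‿cong (f-off (∼⇒≢ x₀∼y))) ⟩
        unit (σ y z) * 0# - 0#     ≈⟨ solve 1 (λ e → e :* con (+ 0) :- con (+ 0)
          := con (+ 0)) refl (unit (σ y z)) ⟩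
        0#                         ∎

    Δ-x₀ : Δσ f x₀ ≈ - 1#
    Δ-x₀ = trans (avg-cong λ y → δ-x₀) (avg-const x₀ (- 1#))

    private
      Δ-y : ∀ {y} → x₀ ∼ y → Δσ f y ≈ ρ y * unit (σ x₀ y)
      Δ-y x₀∼y = trans (avg-single (∼-sym x₀∼y) (δ-y-off x₀∼y)) (*-congˡ (δ-y x₀∼y))

      2Γ-x₀ : ofℕ 2 * Γ S f f x₀ ≈ 1#
      2Γ-x₀ = trans (2Γ≈ f f x₀) (trans
        (avg-cong λ y x₀∼y → trans (*-cong (δ-x₀ x₀∼y) (δ-x₀ x₀∼y)) (unit² Sign.-)) (avg-const x₀ 1#))

      2Γ-y : ∀ {y} → x₀ ∼ y → ofℕ 2 * Γ S f f y ≈ ρ y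
      2Γ-y {y} x₀∼y = begin-equality
        ofℕ 2 * Γ S f f y                     ≈⟨ 2Γ≈ f f y ⟩
        avg y (λ z → δ f y z * δ f y z)       ≈⟨ avg-single (∼-sym x₀∼y) (λ z z≢x₀ → trans (*-congʳ
            (δ-y-off x₀∼y z z≢x₀)) (zeroˡ _)) ⟩
        ρ y * (δ f y x₀ * δ f y x₀)           ≈⟨ *-congˡ
            (trans (*-cong (δ-y x₀∼y) (δ-y x₀∼y)) (unit² (σ x₀ y))) ⟩
        ρ y * 1#                              ≈⟨ *-identityʳ (ρ y) ⟩
        ρ y                                   ∎

      δΔ-x₀ : ∀ {y} → x₀ ∼ y → δ (Δσ f) x₀ y ≈ ρ y + 1#
      δΔ-x₀ {y} x₀∼y = begin-equality
        δ (Δσ f) x₀ y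
          ≈⟨ δ≈ (Δσ f) x₀ y ⟩
        unit (σ x₀ y) * Δσ f y - Δσ f x₀
          ≈⟨ +-cong (*-congˡ (Δ-y x₀∼y)) (-‿cong Δ-x₀) ⟩
        unit (σ x₀ y) * (ρ y * unit (σ x₀ y)) - - 1#
          ≈⟨ solve 2 (λ e r → e :* (r :* e) :- :- con (+ 1)
            := r :* (e :* e) :+ con (+ 1)) refl (unit (σ x₀ y)) (ρ y) ⟩
        ρ y * (unit (σ x₀ y) * unit (σ x₀ y)) + 1#
          ≈⟨ +-congʳ (trans (*-congˡ (unit² (σ x₀ y))) (*-identityʳ (ρ y))) ⟩
        ρ y + 1# ∎

      4ΔΓ≤ : ofℕ 4 * Δ {G = G} (Γ S f f) x₀ ≤ - 1#
      4ΔΓ≤ = ≤-trans (≤-reflexive (sym (avg-* x₀ _ _))) (avg-≤-const λ y x₀∼y → begin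
        ofℕ 4 * (Γ S f f y - Γ S f f x₀)
          ≈⟨ solve 2 (λ a b → con (+ 4) :* (a :- b)
            := con (+ 2) :* (con (+ 2) :* a) :- con (+ 2) :* (con (+ 2) :* b)) refl _ _ ⟩
        ofℕ 2 * (ofℕ 2 * Γ S f f y) - ofℕ 2 * (ofℕ 2 * Γ S f f x₀)
          ≈⟨ +-cong (*-congˡ (2Γ-y x₀∼y)) (-‿cong (*-congˡ 2Γ-x₀)) ⟩
        ofℕ 2 * ρ y - ofℕ 2 * 1#
          ≤⟨ +-monoˡ-≤ _ (2ρ≤1 x₀∼y) ⟩
        1# - ofℕ 2 * 1#
          ≈⟨ solve 0 (con (+ 1) :- con (+ 2) :* con (+ 1) := :- con (+ 1)) refl ⟩
        - 1# ∎)

      -8ΓΔ≤ : - ofℕ 4 * (ofℕ 2 * Γ S f (Δσ f) x₀) ≤ ofℕ 6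
      -8ΓΔ≤ = ≤-trans (≤-reflexive
          (trans (*-congˡ (2Γ≈ f (Δσ f) x₀)) (sym (avg-* x₀ _ _)))) (avg-≤-const λ y x₀∼y → begin
        - ofℕ 4 * (δ f x₀ y * δ (Δσ f) x₀ y)
          ≈⟨ *-congˡ (*-cong (δ-x₀ x₀∼y) (δΔ-x₀ x₀∼y)) ⟩
        - ofℕ 4 * (- 1# * (ρ y + 1#))
          ≈⟨ solve 1 (λ r → :- con (+ 4) :* (:- con (+ 1) :* (r :+ con (+ 1)))
            := con (+ 2) :* (con (+ 2) :* r) :+ con (+ 4)) refl (ρ y) ⟩
        ofℕ 2 * (ofℕ 2 * ρ y) + ofℕ 4
          ≤⟨ +-monoˡ-≤ _ (*-monoˡ-≤ (0≤ofℕ 2) (2ρ≤1 x₀∼y)) ⟩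
        ofℕ 2 * 1# + ofℕ 4
          ≈⟨ solve 0 (con (+ 2) :* con (+ 1) :+ con (+ 4) := con (+ 6)) refl ⟩
        ofℕ 6 ∎)

    -- With ρ = 1/d_y at a neighbour y, 4ΔΓ(f) is the mean of 2ρ - 2 and -8Γ(f,Δσf) the mean of 4ρ +
    -- 4. Since ρ ≤ 1/2, these are at most -1 and 6.
    8Γ₂-indicator≤5 : ofℕ 8 * Γ₂ S indicator indicator x₀ ≤ ofℕ 5
    8Γ₂-indicator≤5 = begin
      ofℕ 8 * (½ * ((l - g) - g))
        ≈⟨ solve 3 (λ h l g → con (+ 8) :* (h :* ((l :- g) :- g))
          := (con (+ 2) :* h) :* (con (+ 4) :* l :+ :- con (+ 4) :* (con (+ 2) :* g))) refl ½ l g ⟩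
      ofℕ 2 * ½ * (ofℕ 4 * l + - ofℕ 4 * (ofℕ 2 * g))
        ≈⟨ trans (*-congʳ 2*½) (*-identityˡ _) ⟩
      ofℕ 4 * l + - ofℕ 4 * (ofℕ 2 * g)
        ≤⟨ +-mono-≤ 4ΔΓ≤ -8ΓΔ≤ ⟩
      - 1# + ofℕ 6
        ≈⟨ solve 0 (:- con (+ 1) :+ con (+ 6) := con (+ 5)) refl ⟩
      ofℕ 5 ∎
      where
      l = Δ {G = G} (Γ S f f) x₀
      g = Γ S f (Δσ f) x₀

    8/N≤5 : ∀ {N} → CD S 0# N → ofℕ 8 * 1/ᴺ N ≤ ofℕ 5
    8/N≤5 {N} cd = begin
      ofℕ 8 * 1/ᴺ N
        ≈⟨ *-congˡ (solve 2 (λ a g → a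
          := a :* (:- con (+ 1) :* :- con (+ 1)) :+ con (+ 0) :* g) refl (1/ᴺ N) (Γ S f f x₀)) ⟩
      ofℕ 8 * (1/ᴺ N * (- 1# * - 1#) + 0# * Γ S f f x₀)
        ≈⟨ *-congˡ (+-congʳ (*-congˡ (sym (*-cong Δ-x₀ Δ-x₀)))) ⟩
      ofℕ 8 * (1/ᴺ N * (Δσ f x₀ * Δσ f x₀) + 0# * Γ S f f x₀)
        ≤⟨ *-monoˡ-≤ (0≤ofℕ 8) (cd f x₀) ⟩
      ofℕ 8 * Γ₂ S f f x₀
        ≤⟨ 8Γ₂-indicator≤5 ⟩
      ofℕ 5 ∎

-- Rational estimates for the constants of the theorem.

module Constants {c ℓ₁ ℓ₂} (ℝ : RealNumbers c ℓ₁ ℓ₂) where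
  open RealNumbers ℝ hiding (zero)
  open OrderedField ℝ
  open ≤-Reasoning
  open SignedCalculus ℝ

  1/ᴺ-nonneg : ∀ N → 0# ≤ 1/ᴺ N
  1/ᴺ-nonneg (finite N 1<N) = inv-nonneg N _
  1/ᴺ-nonneg ∞              = ≤-refl

  3≤5q : ∀ N {q} → IsSqrt[N-1/N] N q → ofℕ 8 * 1/ᴺ N ≤ ofℕ 5 → (0# ≤ q) × (ofℕ 3 ≤ ofℕ 5 * q)
  3≤5q ∞ {q} (lift q≈1) _ = ≤-trans 0≤1 (≤-reflexive (sym q≈1)) , (begin
    ofℕ 3          ≤⟨ ofℕ-mono-≤ {3} {5} (ℕₚ.m≤m+n 3 2) ⟩
    ofℕ 5          ≈⟨ *-identityʳ _ ⟨
    ofℕ 5 * 1#     ≈⟨ *-congˡ q≈1 ⟨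
    ofℕ 5 * q      ∎)
  3≤5q (finite N 1<N) {q} (0≤q , q²≈) 8/N≤5 = 0≤q , square-cancel-≤ (*-nonneg (0≤ofℕ 5) 0≤q) (*-cancelˡ-ofℕ-≤ 7 (begin
    ofℕ 8 * (ofℕ 3 * ofℕ 3)
      -- From 1/N ≤ 5/8 comes 25q² ≥ 75/8, just above 9 = 72/8.
      ≤⟨ ≤-by (ofℕ 3) (0≤ofℕ 3) (solve 0 (con (+ 8) :* (con (+ 3) :* con (+ 3)) :+ con (+ 3)
        := con (+ 200) :- con (+ 25) :* con (+ 5)) refl) ⟩
    ofℕ 200 - ofℕ 25 * ofℕ 5
      ≤⟨ +-mono-≤ ≤-refl (neg-mono-≤ (*-monoˡ-≤ (0≤ofℕ 25) 8/N≤5)) ⟩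
    ofℕ 200 - ofℕ 25 * (ofℕ 8 * i)
      ≈⟨ solve 1 (λ i → con (+ 200) :- con (+ 25) :* (con (+ 8) :* i)
        := con (+ 200) :* (con (+ 1) :- i)) refl i ⟩
    ofℕ 200 * (1# - i)
      ≈⟨ *-congˡ (+-congʳ (sym (*-inv N _))) ⟩
    ofℕ 200 * (N * i - i)
      ≈⟨ solve 2 (λ N i → con (+ 200) :* (N :* i :- i) := con (+ 200) :* ((N :- con (+ 1)) :* i)) refl N i ⟩
    ofℕ 200 * ((N - 1#) * i)
      ≈⟨ *-congˡ q²≈ ⟨
    ofℕ 200 * (q * q)
      ≈⟨ solve 1 (λ q → con (+ 200) :* (q :* q)
        := con (+ 8) :* ((con (+ 5) :* q) :* (con (+ 5) :* q))) refl q ⟩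
    ofℕ 8 * ((ofℕ 5 * q) * (ofℕ 5 * q)) ∎))
    where i = 1/ᴺ (finite N 1<N)

  module _ {y : Carrier} (0≤y : 0# ≤ y) (3y<2 : ofℕ 3 * y < ofℕ 2) where
    private
      y≤1 : y ≤ 1#
      y≤1 = *-cancelˡ-ofℕ-≤ 2 (≤-trans (<⇒≤ 3y<2) (≤-by 1# 0≤1
          (solve 0 (con (+ 2) :+ con (+ 1) := con (+ 3) :* con (+ 1)) refl)))

      term-nonneg : ∀ k → 0# ≤ expTerm y k
      term-nonneg zero    = 0≤1
      term-nonneg (suc k) = *-nonneg (term-nonneg k) (*-nonneg 0≤y (1/ℕ-nonneg (suc k)))

      term-decay : ∀ k → ofℕ 3 * expTerm y (3 ℕ.+ k) ≤ expTerm y (2 ℕ.+ k)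
      term-decay k = begin
        ofℕ 3 * (t * (y * i))      ≤⟨ *-monoˡ-≤ (0≤ofℕ 3) (*-monoˡ-≤ (term-nonneg (2 ℕ.+ k))
            (*-mono-≤ 0≤1 (1/ℕ-nonneg (3 ℕ.+ k)) y≤1 (1/ℕ-antitone {2} {3 ℕ.+ k} (ℕₚ.m≤m+n 3 k)))) ⟩
        ofℕ 3 * (t * (1# * 1/ℕ 3)) ≈⟨ solve 2 (λ t j → con (+ 3) :* (t :* (con (+ 1) :* j))
          := t :* (con (+ 3) :* j)) refl t (1/ℕ 3) ⟩
        t * (ofℕ 3 * 1/ℕ 3)        ≈⟨ trans (*-congˡ (ofℕ-*-1/ℕ 2)) (*-identityʳ t) ⟩
        t                          ∎
        where
        t = expTerm y (2 ℕ.+ k)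
        i = 1/ℕ (3 ℕ.+ k)

      -- This is 4(1 + y + (3/4)y²): from y²/2 on, the exponential series is dominated by a
      -- geometric series of ratio 1/3. Its value at y = 2/3 is exactly 8, which is why 2/3 is the
      -- lower bound obtained for ln 2.
      bound : Carrier
      bound = ofℕ 4 + ofℕ 4 * y + ofℕ 3 * (y * y)

      bound<8 : bound < ofℕ 8
      bound<8 = ≤-<-trans (≤-by (y * (ofℕ 2 - ofℕ 3 * y)) (*-nonneg 0≤y (≤⇒0≤- (<⇒≤ 3y<2)))
          (solve 1 (λ y → con (+ 4) :+ con (+ 4) :* y :+ con (+ 3) :* (y :* y) :+ y :* (con (+ 2) :- con (+ 3) :* y)
            := con (+ 4) :+ con (+ 2) :* (con (+ 3) :* y)) refl y))
        (0<-⇒< (IsStrictPartialOrder.<-respʳ-≈ isOrder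
          (solve 1 (λ y → con (+ 2) :* (con (+ 2) :- con (+ 3) :* y)
            := con (+ 8) :- (con (+ 4) :+ con (+ 2) :* (con (+ 3) :* y))) refl y)
          (*-positive (0<ofℕ 1) (<⇒0<- 3y<2))))

      -- 6t/4 dominates the tail t (1 + 1/3 + 1/9 + …).
      sum-bound : ∀ k → ofℕ 4 * expSum y (2 ℕ.+ k) + ofℕ 6 * expTerm y (2 ℕ.+ k) ≤ bound
      sum-bound zero = ≤-reflexive (begin-equality
        ofℕ 4 * (0# + 1# + 1# * (y * 1/ℕ 1)) + ofℕ 6 * (1# * (y * 1/ℕ 1) * (y * ½))
          ≈⟨ solve 3 (λ y i h → con (+ 4) :* (con (+ 0) :+ con (+ 1) :+ con (+ 1) :* (y :* i)) :+ con
              (+ 6) :* (con (+ 1) :* (y :* i) :* (y :* h))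
               := con (+ 4) :+ con (+ 4) :* y :* i :+ con (+ 3) :* (y :* y) :* (i :* (con (+ 2) :* h)))
                 refl y (1/ℕ 1) ½ ⟩
        ofℕ 4 + ofℕ 4 * y * 1/ℕ 1 + ofℕ 3 * (y * y) * (1/ℕ 1 * (ofℕ 2 * ½))
          ≈⟨ +-cong (+-congˡ (trans (*-congˡ 1/1) (*-identityʳ _))) (trans (*-congˡ
              (trans (*-cong 1/1 2*½) (*-identityʳ 1#))) (*-identityʳ _)) ⟩
        bound ∎)
        where
        1/1 : 1/ℕ 1 ≈ 1#
        1/1 = trans (sym (*-identityˡ _)) (trans (*-congʳ (sym ofℕ-1)) (ofℕ-*-1/ℕ 0))
      sum-bound (suc k) = begin
        ofℕ 4 * (s + t) + ofℕ 6 * t′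
          ≤⟨ ≤-by (ofℕ 2 * (t - ofℕ 3 * t′)) (*-nonneg (0≤ofℕ 2) (≤⇒0≤- (term-decay k)))
               (solve 3 (λ s t t′ → con (+ 4) :* (s :+ t) :+ con (+ 6) :* t′ :+ con (+ 2) :* (t :- con (+ 3) :* t′)
                 := con (+ 4) :* s :+ con (+ 6) :* t) refl s t t′) ⟩
        ofℕ 4 * s + ofℕ 6 * t
          ≤⟨ sum-bound k ⟩
        bound ∎
        where
        s = expSum y (2 ℕ.+ k)
        t = expTerm y (2 ℕ.+ k)
        t′ = expTerm y (3 ℕ.+ k)

      4expSum≤bound : ∀ k → ofℕ 4 * expSum y (2 ℕ.+ k) ≤ bound
      4expSum≤bound k = ≤-trans (≤-by _ (*-nonneg (0≤ofℕ 6) (term-nonneg (2 ℕ.+ k))) refl) (sum-bound k)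

    exp≉2 : ¬ IsExp y (ofℕ 2)
    exp≉2 converges = ≤-cases gap 0#
      (λ gap≤0 lt → ≤-trans (≤-trans (≤-reflexive (sym 4gap)) (*-monoˡ-≤ (0≤ofℕ 4) gap≤0))
          (≤-reflexive (zeroʳ _)) lt)
      (λ 0<gap _ → far (converges gap 0<gap))
      (<⇒0<- bound<8)
      where
      gap = (ofℕ 8 - bound) * 1/ℕ 4
      4gap : ofℕ 4 * gap ≈ ofℕ 8 - bound
      4gap = trans (solve 3 (λ f d i → f :* (d :* i) := d :* (f :* i)) refl (ofℕ 4) (ofℕ 8 - bound) (1/ℕ 4))
        (trans (*-congˡ (ofℕ-*-1/ℕ 3)) (*-identityʳ _))
      far : ¬ (∃[ k ] ∀ i → k ℕ.≤ i → (expSum y i - ofℕ 2 < gap) × (ofℕ 2 - expSum y i < gap))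
      far (k , close) = (begin
        gap                       ≤⟨ *-cancelˡ-ofℕ-≤ 3 (begin
          ofℕ 4 * gap               ≈⟨ 4gap ⟩
          ofℕ 8 - bound             ≤⟨ +-mono-≤ ≤-refl (neg-mono-≤ (4expSum≤bound k)) ⟩
          ofℕ 8 - ofℕ 4 * S         ≈⟨ solve 1 (λ s → con (+ 8) :- con (+ 4) :* s
            := con (+ 4) :* (con (+ 2) :- s)) refl S ⟩
          ofℕ 4 * (ofℕ 2 - S)       ∎) ⟩
        ofℕ 2 - S ∎) (proj₂ (close (2 ℕ.+ k) (ℕₚ.m≤n+m k 2)))
        where S = expSum y (2 ℕ.+ k)

  2≤3ln2 : ∀ {y} → 0# ≤ y → IsLn (ofℕ 2) y → ofℕ 2 ≤ ofℕ 3 * y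
  2≤3ln2 0≤y isLn 3y<2 = exp≉2 0≤y 3y<2 isLn

  16≤15r² : ∀ {q ln2 r} → 0# ≤ q → ofℕ 3 ≤ ofℕ 5 * q → IsLn (ofℕ 2) ln2 → IsSqrt ((1# + q) * ln2) r →
    ofℕ 16 ≤ ofℕ 15 * (r * r)
  16≤15r² {q} {ln2} {r} 0≤q 3≤5q isLn (0≤r , r²≈) = begin
    ofℕ 16                                    ≈⟨ ofℕ-* 8 2 ⟩
    ofℕ 8 * ofℕ 2                             ≤⟨ *-mono-≤
        (≤-trans (0≤ofℕ 8) 8≤) (0≤ofℕ 2) 8≤ (2≤3ln2 0≤ln2 isLn) ⟩
    (ofℕ 5 * (1# + q)) * (ofℕ 3 * ln2)        ≈⟨ solve 2 (λ q l → (con (+ 5) :* (con (+ 1) :+ q)) :* (con (+ 3) :* l)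
      := con (+ 15) :* ((con (+ 1) :+ q) :* l)) refl q ln2 ⟩
    ofℕ 15 * ((1# + q) * ln2)                 ≈⟨ *-congˡ r²≈ ⟨
    ofℕ 15 * (r * r)                          ∎
    where
    0<1+q : 0# < 1# + q
    0<1+q = <-≤-trans 0<1 (≤-by q 0≤q refl)
    -- The sign of ln 2 is read off from (1 + q) ln 2 = r² ≥ 0.
    0≤ln2 : 0# ≤ ln2
    0≤ln2 = *-cancelˡ-≤ 0<1+q (begin
      (1# + q) * 0#    ≈⟨ zeroʳ _ ⟩
      0#               ≤⟨ square-nonneg r ⟩
      r * r            ≈⟨ r²≈ ⟩
      (1# + q) * ln2   ∎)
    8≤ : ofℕ 8 ≤ ofℕ 5 * (1# + q)
    8≤ = begin
      ofℕ 8                ≈⟨ ofℕ-+ 5 3 ⟩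
      ofℕ 5 + ofℕ 3        ≤⟨ +-mono-≤ ≤-refl 3≤5q ⟩
      ofℕ 5 + ofℕ 5 * q    ≈⟨ solve 1 (λ q → con (+ 5) :+ con (+ 5) :* q
        := con (+ 5) :* (con (+ 1) :+ q)) refl q ⟩
      ofℕ 5 * (1# + q)     ∎

  -- Since 2s² ≥ m², (rs)² ≥ (8/15)m² ≥ (7/10)²m². The ratio 7/10 is what the conclusion requires: 8
  -- · 7/10 = 28/5.
  7m≤10rs : ∀ m {r s} → 0# ≤ r → ofℕ 16 ≤ ofℕ 15 * (r * r) → IsSqrt (ofℕ (m ℕ.* ⌈ m /2⌉)) s →
    ofℕ 7 * ofℕ m ≤ ofℕ 10 * (r * s)
  7m≤10rs m {r} {s} 0≤r 16≤ (0≤s , s²≈) =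
    square-cancel-≤ (*-nonneg (0≤ofℕ 10) (*-nonneg 0≤r 0≤s)) (*-cancelˡ-ofℕ-≤ 29 (begin
      ofℕ 30 * ((ofℕ 7 * M) * (ofℕ 7 * M))
        ≤⟨ ≤-by (ofℕ 130 * (M * M)) (*-nonneg (0≤ofℕ 130) (square-nonneg M))
             (solve 1 (λ M → con (+ 30) :* ((con (+ 7) :* M) :* (con (+ 7) :* M)) :+ con (+ 130) :* (M :* M)
               := con (+ 100) :* (con (+ 16) :* (M :* M))) refl M) ⟩
      ofℕ 100 * (ofℕ 16 * (M * M))
        ≤⟨ *-monoˡ-≤ (0≤ofℕ 100) (*-mono-≤ (≤-trans (0≤ofℕ 16) 16≤) (square-nonneg M) 16≤ m²≤2s²) ⟩
      ofℕ 100 * ((ofℕ 15 * (r * r)) * (ofℕ 2 * (s * s)))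
        ≈⟨ solve 2 (λ r s → con (+ 100) :* ((con (+ 15) :* (r :* r)) :* (con (+ 2) :* (s :* s)))
          := con (+ 30) :* ((con (+ 10) :* (r :* s)) :* (con (+ 10) :* (r :* s)))) refl r s ⟩
      ofℕ 30 * ((ofℕ 10 * (r * s)) * (ofℕ 10 * (r * s))) ∎))
    where
    M = ofℕ m
    h = ⌈ m /2⌉
    m≤2h : m ℕ.≤ 2 ℕ.* h
    m≤2h = ≡.subst₂ ℕ._≤_ (ℕₚ.⌊n/2⌋+⌈n/2⌉≡n m) (≡.cong (h ℕ.+_) (≡.sym (ℕₚ.+-identityʳ h)))
      (ℕₚ.+-monoˡ-≤ h (ℕₚ.⌊n/2⌋≤⌈n/2⌉ m))
    m²≤2s² : M * M ≤ ofℕ 2 * (s * s)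
    m²≤2s² = begin
      M * M                    ≤⟨ *-monoˡ-≤ (0≤ofℕ m) (ofℕ-mono-≤ {m} {2 ℕ.* h} m≤2h) ⟩
      M * ofℕ (2 ℕ.* h)        ≈⟨ *-congˡ (ofℕ-* 2 h) ⟩
      M * (ofℕ 2 * ofℕ h)      ≈⟨ solve 2 (λ m h → m :* (con (+ 2) :* h)
        := con (+ 2) :* (m :* h)) refl M (ofℕ h) ⟩
      ofℕ 2 * (M * ofℕ h)      ≈⟨ *-congˡ (ofℕ-* m h) ⟨
      ofℕ 2 * ofℕ (m ℕ.* h)    ≈⟨ *-congˡ s²≈ ⟨
      ofℕ 2 * (s * s)          ∎

minOverSigns-attained : ∀ n (F : Vector Sign n → ℕ) → ∃[ τ ] F τ ≡ minOverSigns n F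
minOverSigns-attained zero    F = _ , ≡.refl
minOverSigns-attained (suc n) F
  with minOverSigns-attained n (λ τ → F (Sign.+ ∷ τ)) | minOverSigns-attained n (λ τ → F (Sign.- ∷ τ))
     | ℕₚ.⊓-sel (minOverSigns n (λ τ → F (Sign.+ ∷ τ))) (minOverSigns n (λ τ → F (Sign.- ∷ τ)))
... | τ , Fτ≡ | _       | inj₁ min≡ = (Sign.+ ∷ τ) , ≡.trans Fτ≡ (≡.sym min≡)
... | _       | τ , Fτ≡ | inj₂ min≡ = (Sign.- ∷ τ) , ≡.trans Fτ≡ (≡.sym min≡)

-- The volume bound with constant 28/5.

module VolumeBound
  {c ℓ₁ ℓ₂} (ℝ : RealNumbers c ℓ₁ ℓ₂) {n : ℕ} {G : Graph n} (S : Signature G)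
  (positive : ∀ x → 0 ℕ.< Graph.degree G x)
  (0≤Γ₂ : ∀ f x → RealNumbers._≤_ ℝ (RealNumbers.0# ℝ) (SignedCalculus.Γ₂ ℝ S f f x))
  (connected : Graph.Connected G) (unbalanced : Unbalanced S)
  {D : ℕ} (diameter : Graph.IsDiameter G D)
  {d : ℕ} (1≤d : 1 ℕ.≤ d) (degree≤d : ∀ x → Graph.degree G x ℕ.≤ d) where

  open RealNumbers ℝ hiding (zero)
  open OrderedField ℝ
  open ≤-Reasoning
  open Sums ℝ
  open SignedCalculus ℝ
  open Graph G
  open Signature S
  open Calculus ℝ S positive
  open Flow ℝ S positive 0≤Γ₂
  open Energy ℝ S positive
  open WalkEstimate ℝ S positive

  -- With s = 1/(d h²), `K′` steps take time 2dL², which is when |u| has halved, and 2K′ steps take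
  -- time 4dL². Moreover 2K′ = J², so the blocks between consecutive squares fill the index range
  -- exactly.
  L h J K′ : ℕ
  L  = suc D
  h  = 200 ℕ.* (d ℕ.* (L ℕ.* L))
  J  = 2 ℕ.* (d ℕ.* h ℕ.* L)
  K′ = 2 ℕ.* ((d ℕ.* h ℕ.* L) ℕ.* (d ℕ.* h ℕ.* L))

  s d′ h′ L′ t : Carrier
  s  = 1/ℕ (d ℕ.* (h ℕ.* h))
  d′ = ofℕ d
  h′ = ofℕ h
  L′ = ofℕ L
  t  = ofℕ 4 * (d′ * (L′ * L′))

  private
    1≤* : ∀ {m n} → 1 ℕ.≤ m → 1 ℕ.≤ n → 1 ℕ.≤ m ℕ.* n
    1≤* = ℕₚ.*-mono-≤

    1≤dLL : 1 ℕ.≤ d ℕ.* (L ℕ.* L)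
    1≤dLL = 1≤* 1≤d (1≤* {L} {L} (ℕ.s≤s ℕ.z≤n) (ℕ.s≤s ℕ.z≤n))

    200≤h : 200 ℕ.≤ h
    200≤h = ℕₚ.*-monoʳ-≤ 200 1≤dLL

    1≤h : 1 ℕ.≤ h
    1≤h = ℕₚ.≤-trans (ℕₚ.m≤m+n 1 199) 200≤h

    20≤J : 20 ℕ.≤ J
    20≤J = ℕₚ.≤-trans (ℕₚ.m≤m+n 20 180) (ℕₚ.≤-trans 200≤h
      (ℕₚ.≤-trans (ℕₚ.m≤m+n h _) (ℕₚ.*-monoʳ-≤ 2 h≤dhL)))
      where
      h≤dhL : h ℕ.≤ d ℕ.* h ℕ.* L
      h≤dhL = ℕₚ.≤-trans (ℕₚ.≤-trans (ℕₚ.≤-reflexive (≡.sym (ℕₚ.*-identityˡ h))) (ℕₚ.*-monoˡ-≤ h 1≤d))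
        (ℕₚ.m≤m*n (d ℕ.* h) L)

    1≤d′ : 1# ≤ d′
    1≤d′ = ≤-trans (≤-reflexive (sym ofℕ-1)) (ofℕ-mono-≤ {1} {d} 1≤d)

    1≤L′ : 1# ≤ L′
    1≤L′ = ≤-by (ofℕ D) (0≤ofℕ D) refl

    ofℕ-*-1/ℕ₊ : ∀ m → 1 ℕ.≤ m → ofℕ m * 1/ℕ m ≈ 1#
    ofℕ-*-1/ℕ₊ (suc m) _ = ofℕ-*-1/ℕ m

    0≤s : 0# ≤ s
    0≤s = 1/ℕ-nonneg (d ℕ.* (h ℕ.* h))

    sdhh : s * (d′ * (h′ * h′)) ≈ 1#
    sdhh = begin-equality
      s * (d′ * (h′ * h′))            ≈⟨ *-congˡ (*-congˡ (ofℕ-* h h)) ⟨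
      s * (d′ * ofℕ (h ℕ.* h))        ≈⟨ *-congˡ (ofℕ-* d (h ℕ.* h)) ⟨
      s * ofℕ (d ℕ.* (h ℕ.* h))       ≈⟨ *-comm _ _ ⟩
      ofℕ (d ℕ.* (h ℕ.* h)) * s       ≈⟨ ofℕ-*-1/ℕ₊ (d ℕ.* (h ℕ.* h)) (1≤* 1≤d (1≤* 1≤h 1≤h)) ⟩
      1#                              ∎

    h′≈ : h′ ≈ ofℕ 200 * (d′ * (L′ * L′))
    h′≈ = trans (ofℕ-* 200 (d ℕ.* (L ℕ.* L))) (*-congˡ (trans (ofℕ-* d (L ℕ.* L)) (*-congˡ (ofℕ-* L L))))

    0≤z : 0# ≤ d′ * (L′ * L′)
    0≤z = *-nonneg (0≤ofℕ d) (*-nonneg (0≤ofℕ L) (0≤ofℕ L))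

    1≤z : 1# ≤ d′ * (L′ * L′)
    1≤z = begin
      1#                 ≈⟨ solve 0 (con (+ 1) := con (+ 1) :* (con (+ 1) :* con (+ 1))) refl ⟩
      1# * (1# * 1#)     ≤⟨ *-mono-≤ (0≤ofℕ d) (*-nonneg 0≤1 0≤1) 1≤d′ (*-mono-≤ (0≤ofℕ L) 0≤1 1≤L′ 1≤L′) ⟩
      d′ * (L′ * L′)     ∎

    -- The choice h = 200 d L² is made for this estimate.
    s-small : ofℕ 40000 * ((d′ * (L′ * L′)) * (d′ * (L′ * L′))) * s ≤ 1#
    s-small = begin
      ofℕ 40000 * (z * z) * s
        ≈⟨ *-congʳ (trans (*-congʳ (ofℕ-* 200 200))
            (solve 2 (λ a z → (a :* a) :* (z :* z) := (a :* z) :* (a :* z)) refl (ofℕ 200) z)) ⟩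
      (ofℕ 200 * z) * (ofℕ 200 * z) * s
        ≈⟨ *-congʳ (*-cong h′≈ h′≈) ⟨
      h′ * h′ * s
        ≤⟨ *-monoʳ-≤ 0≤s (≤-trans (≤-reflexive (sym (*-identityˡ _))) (*-monoʳ-≤ (square-nonneg h′) 1≤d′)) ⟩
      d′ * (h′ * h′) * s
        ≈⟨ trans (*-comm _ s) sdhh ⟩
      1# ∎
      where z = d′ * (L′ * L′)

    40000s≤1 : ofℕ 40000 * s ≤ 1#
    40000s≤1 = begin
      ofℕ 40000 * s
        ≤⟨ *-monoʳ-≤ 0≤s (≤-trans (≤-reflexive (trans (sym (*-identityʳ _)) (*-congˡ (sym (*-identityʳ 1#)))))
             (*-monoˡ-≤ (0≤ofℕ 40000) (*-mono-≤ 0≤z 0≤1 1≤z 1≤z))) ⟩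
      ofℕ 40000 * ((d′ * (L′ * L′)) * (d′ * (L′ * L′))) * s
        ≤⟨ s-small ⟩
      1# ∎

    s≤1 : s ≤ 1#
    s≤1 = ≤-trans (≤-by (ofℕ 39999 * s) (*-nonneg (0≤ofℕ 39999) 0≤s)
      (trans (+-congʳ (sym (*-identityˡ s))) (sym (distribʳ s 1# (ofℕ 39999))))) 40000s≤1

    sK′≈ : s * ofℕ K′ ≈ ofℕ 2 * (d′ * (L′ * L′))
    sK′≈ = begin-equality
      s * ofℕ K′
        ≈⟨ *-congˡ (trans (ofℕ-* 2 (dhL ℕ.* dhL)) (*-congˡ (trans (ofℕ-* dhL dhL) (*-cong dhL≈ dhL≈)))) ⟩
      s * (ofℕ 2 * ((d′ * h′ * L′) * (d′ * h′ * L′)))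
        ≈⟨ solve 4 (λ s d h L → s :* (con (+ 2) :* ((d :* h :* L) :* (d :* h :* L)))
          := (s :* (d :* (h :* h))) :* (con (+ 2) :* (d :* (L :* L)))) refl s d′ h′ L′ ⟩
      s * (d′ * (h′ * h′)) * (ofℕ 2 * (d′ * (L′ * L′)))
        ≈⟨ trans (*-congʳ sdhh) (*-identityˡ _) ⟩
      ofℕ 2 * (d′ * (L′ * L′)) ∎
      where
      dhL = d ℕ.* h ℕ.* L
      dhL≈ : ofℕ dhL ≈ d′ * h′ * L′
      dhL≈ = trans (ofℕ-* (d ℕ.* h) L) (*-congʳ (ofℕ-* d h))

    sK≈ : s * ofℕ (K′ ℕ.+ K′) ≈ t
    sK≈ = begin-equality
      s * ofℕ (K′ ℕ.+ K′)
        ≈⟨ *-congˡ (ofℕ-+ K′ K′) ⟩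
      s * (ofℕ K′ + ofℕ K′)
        ≈⟨ distribˡ s _ _ ⟩
      s * ofℕ K′ + s * ofℕ K′
        ≈⟨ +-cong sK′≈ sK′≈ ⟩
      ofℕ 2 * (d′ * (L′ * L′)) + ofℕ 2 * (d′ * (L′ * L′))
        ≈⟨ solve 1 (λ z → con (+ 2) :* z :+ con (+ 2) :* z := con (+ 4) :* z) refl _ ⟩
      t ∎

  -- The value 1.01: the constant 1 of the reverse Poincaré inequality plus all discretisation
  -- errors up to time `t`.
  B : Carrier
  B = ofℕ 101 * 1/ℕ 100

  private
    100B≈ : ofℕ 100 * B ≈ ofℕ 101
    100B≈ = trans (solve 3 (λ a b i → a :* (b :* i) := b :* (a :* i)) refl (ofℕ 100) (ofℕ 101) (1/ℕ 100))
      (trans (*-congˡ (ofℕ-*-1/ℕ 99)) (*-identityʳ _))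

    1≤B : 1# ≤ B
    1≤B = *-cancelˡ-ofℕ-≤ 99 (begin
      ofℕ 100 * 1#   ≈⟨ *-identityʳ _ ⟩
      ofℕ 100        ≤⟨ ofℕ-mono-≤ {100} {101} (ℕₚ.n≤1+n 100) ⟩
      ofℕ 101        ≈⟨ 100B≈ ⟨
      ofℕ 100 * B    ∎)

    0≤B : 0# ≤ B
    0≤B = ≤-trans 0≤1 1≤B

    -- Weakening B to a perfect square avoids the root of B when a bound on squared increments is
    -- turned into one on increments.
    B≤B² : B ≤ B * B
    B≤B² = ≤-trans (≤-reflexive (sym (*-identityʳ B))) (*-monoˡ-≤ 0≤B 1≤B)

    error-small : ∀ {k} → s * ofℕ k ≤ t → 1# + ofℕ k * (s * s * (ofℕ 36 + ofℕ 16 * t)) ≤ B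
    error-small {k} sk≤t = *-cancelˡ-ofℕ-≤ 99 (begin
      ofℕ 100 * (1# + ofℕ k * (s * s * (ofℕ 36 + ofℕ 16 * t)))
        ≈⟨ solve 3 (λ k s t → con (+ 100) :* (con (+ 1) :+ k :* (s :* s :* (con (+ 36) :+ con (+ 16) :* t)))
          := con (+ 100) :+ con (+ 100) :* ((s :* k) :* (s :* (con (+ 36) :+ con (+ 16) :* t))))
            refl (ofℕ k) s t ⟩
      ofℕ 100 + ofℕ 100 * ((s * ofℕ k) * (s * (ofℕ 36 + ofℕ 16 * t)))
        -- With z = dL² ≥ 1, raising 36 to 36z makes the error homogeneous: 100 · 4z · (36 + 64)z ·
        -- s = 40000z²s.
        ≤⟨ +-mono-≤ ≤-refl (*-monoˡ-≤ (0≤ofℕ 100)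
            (*-mono-≤ 0≤t (*-nonneg 0≤s (+-nonneg (0≤ofℕ 36) (*-nonneg (0≤ofℕ 16) 0≤t))) sk≤t
             (*-monoˡ-≤ 0≤s (+-monoˡ-≤ _ (≤-by (ofℕ 36 * (z - 1#)) (*-nonneg (0≤ofℕ 36) (≤⇒0≤- 1≤z))
                 (solve 1 (λ z → con (+ 36) :+ con (+ 36) :* (z :- con (+ 1))
                   := con (+ 36) :* z) refl z)))))) ⟩
      ofℕ 100 + ofℕ 100 * (t * (s * (ofℕ 36 * z + ofℕ 16 * t)))
        ≈⟨ solve 2 (λ s z → con (+ 100) :+ con (+ 100) :* ((con (+ 4) :* z) :* (s :* (con (+ 36) :* z :+ con
            (+ 16) :* (con (+ 4) :* z))))
          := con (+ 100) :+ con (+ 40000) :* (z :* z) :* s) refl s z ⟩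
      ofℕ 100 + ofℕ 40000 * (z * z) * s
        ≤⟨ +-mono-≤ ≤-refl s-small ⟩
      ofℕ 100 + 1#
        ≈⟨ +-comm (ofℕ 100) 1# ⟩
      ofℕ 101
        ≈⟨ 100B≈ ⟨
      ofℕ 100 * B ∎)
      where
      z = d′ * (L′ * L′)
      0≤t : 0# ≤ t
      0≤t = *-nonneg (0≤ofℕ 4) 0≤z

  module _ (τ : Vector Sign n) where

    f : Fun {G = G}
    f = unit ∘ τ

    u : ℕ → Fun {G = G}
    u k = flow s k f

    private
      f²≤1 : ∀ x → f x * f x ≤ 1#
      f²≤1 x = ≤-reflexive (unit² (τ x))

    gradient-bound : ∀ k → k ℕ.≤ K′ ℕ.+ K′ → ∀ x → ofℕ 2 * (s * ofℕ k) * Γ S (u k) (u k) x ≤ B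
    gradient-bound k k≤K x = begin
      ofℕ 2 * (s * ofℕ k) * Γ S (u k) (u k) x
        ≤⟨ ≤-by _ (square-nonneg (u k x)) (+-comm _ _) ⟩
      u k x * u k x + ofℕ 2 * (s * ofℕ k) * Γ S (u k) (u k) x
        ≤⟨ reverse-Poincaré 0≤s s≤1 f²≤1 k sk≤t x ⟩
      1# + ofℕ k * (s * s * (ofℕ 36 + ofℕ 16 * t))
        ≤⟨ error-small {k} sk≤t ⟩
      B ∎
      where
      sk≤t : s * ofℕ k ≤ t
      sk≤t = ≤-trans (*-monoˡ-≤ 0≤s (ofℕ-mono-≤ {k} {K′ ℕ.+ K′} k≤K)) (≤-reflexive sK≈)

    ∑∼δ²≤2dΓ : ∀ g x → ∑∼ x (λ y → δ g x y * δ g x y) ≤ ofℕ 2 * d′ * Γ S g g x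
    ∑∼δ²≤2dΓ g x = begin
      ∑∼ x (λ y → δ g x y * δ g x y)
        ≈⟨ degree*avg x _ ⟨
      ofℕ (degree x) * avg x (λ y → δ g x y * δ g x y)
        ≈⟨ *-congˡ (2Γ≈ g g x) ⟨
      ofℕ (degree x) * (ofℕ 2 * Γ S g g x)
        ≤⟨ *-monoʳ-≤ (*-nonneg (0≤ofℕ 2) (Γ-nonneg g x)) (ofℕ-mono-≤ {degree x} {d} (degree≤d x)) ⟩
      d′ * (ofℕ 2 * Γ S g g x)
        ≈⟨ solve 2 (λ d g → d :* (con (+ 2) :* g) := con (+ 2) :* d :* g) refl d′ _ ⟩
      ofℕ 2 * d′ * Γ S g g x ∎

    -- At step `K′` the weight 2sK′ is 4dL², so 4dL²Γ(u) ≤ B. Twice the sum of squared increments at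
    -- a vertex is at most 4dΓ(u) ≤ (B/L)², and `antipodal-bound` with β = B/L gives 2|u| ≤ B.
    late-square : ∀ x → u K′ x * u K′ x ≤ B * B * 1/ℕ 4
    late-square x = *-cancelˡ-ofℕ-≤ 3 (begin
      ofℕ 4 * (u K′ x * u K′ x)
        ≤⟨ antipodal-bound {u K′} {β} (*-nonneg 0≤B (1/ℕ-nonneg L)) gradient connected unbalanced diameter x ⟩
      (L′ * β) * (L′ * β)
        ≈⟨ *-cong Lβ Lβ ⟩
      B * B
        ≈⟨ trans (*-congˡ (ofℕ-*-1/ℕ 3)) (*-identityʳ _) ⟨
      B * B * (ofℕ 4 * 1/ℕ 4)
        ≈⟨ solve 3 (λ b f i → b :* (f :* i) := f :* (b :* i)) refl (B * B) (ofℕ 4) (1/ℕ 4) ⟩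
      ofℕ 4 * (B * B * 1/ℕ 4) ∎)
      where
      β = B * 1/ℕ L
      Lβ : L′ * β ≈ B
      Lβ = trans (solve 3 (λ l b i → l :* (b :* i)
        := b :* (l :* i)) refl L′ B (1/ℕ L)) (trans (*-congˡ (ofℕ-*-1/ℕ D)) (*-identityʳ B))
      gradient : ∀ x → ofℕ 2 * ∑∼ x (λ y → δ (u K′) x y * δ (u K′) x y) ≤ β * β
      gradient x = *-cancelˡ-ofℕ-≤ D (*-cancelˡ-ofℕ-≤ D (begin
        L′ * (L′ * (ofℕ 2 * ∑∼ x (λ y → δ (u K′) x y * δ (u K′) x y)))
          ≤⟨ *-monoˡ-≤ (0≤ofℕ L) (*-monoˡ-≤ (0≤ofℕ L) (*-monoˡ-≤ (0≤ofℕ 2) (∑∼δ²≤2dΓ (u K′) x))) ⟩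
        L′ * (L′ * (ofℕ 2 * (ofℕ 2 * d′ * g)))
          ≈⟨ solve 3 (λ l d g → l :* (l :* (con (+ 2) :* (con (+ 2) :* d :* g)))
            := con (+ 2) :* (con (+ 2) :* (d :* (l :* l))) :* g) refl L′ d′ g ⟩
        ofℕ 2 * (ofℕ 2 * (d′ * (L′ * L′))) * g
          ≈⟨ *-congʳ (*-congˡ sK′≈) ⟨
        ofℕ 2 * (s * ofℕ K′) * g
          ≤⟨ gradient-bound K′ (ℕₚ.m≤m+n K′ K′) x ⟩
        B
          ≤⟨ B≤B² ⟩
        B * B
          ≈⟨ *-cong Lβ Lβ ⟨
        (L′ * β) * (L′ * β)
          ≈⟨ solve 2 (λ l b → (l :* b) :* (l :* b) := l :* (l :* (b :* b))) refl L′ β ⟩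
        L′ * (L′ * (β * β)) ∎))
        where g = Γ S (u K′) (u K′) x

    a : ℕ → Carrier
    a k = ⟨ f , u k ⟩

    a₀ : a 0 ≈ ofℕ volume
    a₀ = ⟨unit,unit⟩ τ

    -- Self-adjointness moves steps across the pairing. For j = k = `K′` it turns ⟨τ, u⟩ at the
    -- doubled time into a square norm, which is smaller by a factor of about 4. Stopping at step
    -- `K′` with a factor 2 would give 4√2 in place of 16/3.
    flow-pairing : ∀ j k → ⟨ u j , u k ⟩ ≈ a (j ℕ.+ k)
    flow-pairing zero    k = refl
    flow-pairing (suc j) k = trans (euler-selfAdjoint s (u j) (u k))
      (trans (flow-pairing j (suc k)) (reflexive (≡.cong a (ℕₚ.+-suc j k))))

    a-final : a (K′ ℕ.+ K′) ≤ ofℕ volume * (B * B * 1/ℕ 4)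
    a-final = ≤-trans (≤-reflexive (sym (flow-pairing K′ K′))) (⟨⟩-mono-≤ late-square)

    ι : Carrier
    ι = ofℕ (frustration S τ)

    private
      0≤ι : 0# ≤ ι
      0≤ι = 0≤ofℕ (frustration S τ)

    -- Near k = 0 the gradient bound degenerates, so the increments are bounded by 2 through the
    -- contraction. Only the first 400 steps are treated this way, at the negligible cost 800sι.
    early-step : ∀ k → a k ≤ a (suc k) + s * (ι * ofℕ 2)
    early-step k = ⟨unit,⟩-euler τ (u k) 0≤s λ x y _ → ∣∣≤-square (0≤ofℕ 2) (begin
      δ (u k) x y * δ (u k) x y   ≤⟨ δ²≤ (u k) x y (flow-contraction 0≤s s≤1 f²≤1 k x)
          (flow-contraction 0≤s s≤1 f²≤1 k y) ⟩
      ofℕ 4 * 1#                  ≈⟨ solve 0 (con (+ 4) :* con (+ 1) := con (+ 2) :* con (+ 2)) refl ⟩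
      ofℕ 2 * ofℕ 2               ∎)

    -- Squared increments are at most 2dΓ(u) ≤ dB/(sk), and d/s = (dh)² is a perfect square.
    -- Bounding k below by a square therefore bounds the increments themselves.
    late-step : ∀ j k → suc j ℕ.* suc j ℕ.≤ k → k ℕ.≤ K′ ℕ.+ K′ →
      a k ≤ a (suc k) + s * (ι * (B * (d′ * h′) * 1/ℕ (suc j)))
    late-step j k jj≤k k≤K = ⟨unit,⟩-euler τ (u k) 0≤s λ x y x∼y →
      ∣∣≤-square (*-nonneg (*-nonneg 0≤B (*-nonneg (0≤ofℕ d) (0≤ofℕ h))) (1/ℕ-nonneg (suc j)))
        (*-cancelˡ-ofℕ-≤ j (*-cancelˡ-ofℕ-≤ j (bound x y x∼y)))
      where
      j′ = ofℕ (suc j)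
      b = B * (d′ * h′) * 1/ℕ (suc j)
      jb : j′ * b ≈ B * (d′ * h′)
      jb = trans (solve 3 (λ j c i → j :* (c :* i)
        := c :* (j :* i)) refl j′ _ _) (trans (*-congˡ (ofℕ-*-1/ℕ j)) (*-identityʳ _))
      bound : ∀ x y → x ∼ y → j′ * (j′ * (δ (u k) x y * δ (u k) x y)) ≤ j′ * (j′ * (b * b))
      bound x y x∼y = begin
        j′ * (j′ * (δ (u k) x y * δ (u k) x y))
          ≈⟨ trans (sym (*-assoc _ _ _)) (*-congʳ (sym (ofℕ-* (suc j) (suc j)))) ⟩
        ofℕ (suc j ℕ.* suc j) * (δ (u k) x y * δ (u k) x y)
          ≤⟨ *-mono-≤ (0≤ofℕ k) (square-nonneg _) (ofℕ-mono-≤ {suc j ℕ.* suc j} {k} jj≤k) δ²≤2dΓ ⟩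
        ofℕ k * (ofℕ 2 * d′ * g)
          ≈⟨ trans (sym (*-identityˡ _)) (*-congʳ (sym sdhh)) ⟩
        s * (d′ * (h′ * h′)) * (ofℕ k * (ofℕ 2 * d′ * g))
          ≈⟨ solve 5 (λ s d h k g → s :* (d :* (h :* h)) :* (k :* (con (+ 2) :* d :* g))
            := (d :* h) :* (d :* h) :* (con (+ 2) :* (s :* k) :* g)) refl s d′ h′ (ofℕ k) g ⟩
        (d′ * h′) * (d′ * h′) * (ofℕ 2 * (s * ofℕ k) * g)
          ≤⟨ *-monoˡ-≤ (square-nonneg (d′ * h′)) (≤-trans (gradient-bound k k≤K x) B≤B²) ⟩
        (d′ * h′) * (d′ * h′) * (B * B)
          ≈⟨ solve 2 (λ c b → c :* c :* (b :* b) := (b :* c) :* (b :* c)) refl (d′ * h′) B ⟩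
        (B * (d′ * h′)) * (B * (d′ * h′))
          ≈⟨ *-cong jb jb ⟨
        (j′ * b) * (j′ * b)
          ≈⟨ solve 2 (λ j b → (j :* b) :* (j :* b) := j :* (j :* (b :* b))) refl j′ b ⟩
        j′ * (j′ * (b * b)) ∎
        where
        g = Γ S (u k) (u k) x
        δ²≤2dΓ : δ (u k) x y * δ (u k) x y ≤ ofℕ 2 * d′ * g
        δ²≤2dΓ = begin
          δ (u k) x y * δ (u k) x y                     ≈⟨ reflexive (≡.sym (when-yes (x ∼? y) x∼y)) ⟩
          when (x ∼? y) (δ (u k) x y * δ (u k) x y)     ≤⟨ term≤sum (λ z → when-nonneg
              (x ∼? z) λ _ → square-nonneg (δ (u k) x z)) y ⟩
          ∑∼ x (λ z → δ (u k) x z * δ (u k) x z)        ≤⟨ ∑∼δ²≤2dΓ (u k) x ⟩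
          ofℕ 2 * d′ * g                                ∎

    private
      telescope : ∀ {w} k m → (∀ i → i ℕ.< m → a (i ℕ.+ k) ≤ a (suc i ℕ.+ k) + w) → a k ≤ a (m ℕ.+ k) + ofℕ m * w
      telescope {w} k zero    _    = ≤-reflexive (solve 2 (λ a w → a := a :+ con (+ 0) :* w) refl (a k) w)
      telescope {w} k (suc m) step = begin
        a k
          ≤⟨ telescope k m (λ i i<m → step i (ℕₚ.m<n⇒m<1+n i<m)) ⟩
        a (m ℕ.+ k) + ofℕ m * w
          ≤⟨ +-monoˡ-≤ _ (step m ℕₚ.≤-refl) ⟩
        a (suc m ℕ.+ k) + w + ofℕ m * w
          ≈⟨ solve 3 (λ a w m → a :+ w :+ m :* w := a :+ (con (+ 1) :+ m) :* w) refl _ w (ofℕ m) ⟩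
        a (suc m ℕ.+ k) + ofℕ (suc m) * w ∎

      c₀ : Carrier
      c₀ = s * (ι * (B * (d′ * h′)))

      0≤c₀ : 0# ≤ c₀
      0≤c₀ = *-nonneg 0≤s (*-nonneg 0≤ι (*-nonneg 0≤B (*-nonneg (0≤ofℕ d) (0≤ofℕ h))))

      KJ : K′ ℕ.+ K′ ≡ J ℕ.* J
      KJ = lemma (d ℕ.* h ℕ.* L)
        where
        lemma : ∀ e → 2 ℕ.* (e ℕ.* e) ℕ.+ 2 ℕ.* (e ℕ.* e) ≡ (2 ℕ.* e) ℕ.* (2 ℕ.* e)
        lemma = ℕ-Solver.solve-∀

      next-square : ∀ j → (j ℕ.+ suc j) ℕ.+ j ℕ.* j ≡ suc j ℕ.* suc j
      next-square = ℕ-Solver.solve-∀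

    -- On the block j² ≤ k < (j+1)² the decay per step is at most c₀/j, so the block
    -- contributes (2j+1)/j ≤ 41/20 once j ≥ 20.
    block : ∀ j → 20 ℕ.≤ j → suc j ℕ.≤ J → ofℕ 20 * a (j ℕ.* j) ≤ ofℕ 20 * a (suc j ℕ.* suc j) + ofℕ 41 * c₀
    block j@(suc j₀) 20≤j j<J = begin
      ofℕ 20 * a (j ℕ.* j)
        ≤⟨ *-monoˡ-≤ (0≤ofℕ 20) (telescope (j ℕ.* j) (j ℕ.+ suc j) λ i i<m →
             late-step j₀ (i ℕ.+ j ℕ.* j) (ℕₚ.m≤n+m _ i) (≤K i i<m)) ⟩
      ofℕ 20 * (a ((j ℕ.+ suc j) ℕ.+ j ℕ.* j) + ofℕ (j ℕ.+ suc j) * w)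
        ≈⟨ *-congˡ (+-cong (reflexive (≡.cong a (next-square j))) (*-congʳ (ofℕ-+ j (suc j)))) ⟩
      ofℕ 20 * (a (suc j ℕ.* suc j) + (ofℕ j + (1# + ofℕ j)) * w)
        ≈⟨ solve 6 (λ a j s ι b i → con (+ 20) :* (a :+ (j :+ (con (+ 1) :+ j)) :* (s :* (ι :* (b :* i))))
             := con (+ 20) :* a :+ (con (+ 40) :* (j :* i) :+ con (+ 20) :* i) :* (s :* (ι :* b)))
               refl _ (ofℕ j) s ι (B * (d′ * h′)) (1/ℕ j) ⟩
      ofℕ 20 * a (suc j ℕ.* suc j) + (ofℕ 40 * (ofℕ j * 1/ℕ j) + ofℕ 20 * 1/ℕ j) * c₀
        ≤⟨ +-mono-≤ ≤-refl (*-monoʳ-≤ 0≤c₀ (+-mono-≤ (≤-reflexive (*-congˡ (ofℕ-*-1/ℕ j₀)))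
            (*-monoˡ-≤ (0≤ofℕ 20) (1/ℕ-antitone {19} {j} 20≤j)))) ⟩
      ofℕ 20 * a (suc j ℕ.* suc j) + (ofℕ 40 * 1# + ofℕ 20 * 1/ℕ 20) * c₀
        ≈⟨ +-congˡ (*-congʳ (trans (+-congˡ (ofℕ-*-1/ℕ 19))
            (solve 0 (con (+ 40) :* con (+ 1) :+ con (+ 1) := con (+ 41)) refl))) ⟩
      ofℕ 20 * a (suc j ℕ.* suc j) + ofℕ 41 * c₀ ∎
      where
      w = s * (ι * (B * (d′ * h′) * 1/ℕ j))
      ≤K : ∀ i → i ℕ.< j ℕ.+ suc j → i ℕ.+ j ℕ.* j ℕ.≤ K′ ℕ.+ K′
      ≤K i i<m = ℕₚ.≤-trans (ℕₚ.+-monoˡ-≤ (j ℕ.* j) (ℕₚ.<⇒≤ i<m))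
        (≡.subst₂ ℕ._≤_ (≡.sym (next-square j)) (≡.sym KJ) (ℕₚ.*-mono-≤ j<J j<J))

    blocks : ∀ i → i ℕ.+ 20 ℕ.≤ J → ofℕ 20 * a (20 ℕ.* 20) ≤ ofℕ 20 * a ((i ℕ.+ 20) ℕ.*
        (i ℕ.+ 20)) + ofℕ i * (ofℕ 41 * c₀)
    blocks zero    _    = ≤-reflexive (solve 2 (λ a w → a := a :+ con (+ 0) :* w) refl _ _)
    blocks (suc i) i≤J = begin
      ofℕ 20 * a (20 ℕ.* 20)
        ≤⟨ blocks i (ℕₚ.<⇒≤ i≤J) ⟩
      ofℕ 20 * a ((i ℕ.+ 20) ℕ.* (i ℕ.+ 20)) + ofℕ i * (ofℕ 41 * c₀)
        ≤⟨ +-monoˡ-≤ _ (block (i ℕ.+ 20) (ℕₚ.m≤n+m 20 i) i≤J) ⟩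
      ofℕ 20 * a ((suc i ℕ.+ 20) ℕ.* (suc i ℕ.+ 20)) + ofℕ 41 * c₀ + ofℕ i * (ofℕ 41 * c₀)
        ≈⟨ solve 3 (λ a w m → a :+ w :+ m :* w := a :+ (con (+ 1) :+ m) :* w) refl _ (ofℕ 41 * c₀) (ofℕ i) ⟩
      ofℕ 20 * a ((suc i ℕ.+ 20) ℕ.* (suc i ℕ.+ 20)) + ofℕ (suc i) * (ofℕ 41 * c₀) ∎

    private
      X : Carrier
      X = ι * (d′ * L′)

      ι≤X : ι ≤ X
      ι≤X = ≤-trans (≤-reflexive (trans (sym (*-identityʳ ι)) (*-congˡ (sym (*-identityʳ 1#)))))
        (*-monoˡ-≤ 0≤ι (*-mono-≤ (0≤ofℕ d) 0≤1 1≤d′ 1≤L′))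

      0≤X : 0# ≤ X
      0≤X = ≤-trans 0≤ι ι≤X

      -- The factor dh of `J` meets the one in `c₀`, and s d h² = 1 removes the step size.
      Jc₀≈ : ofℕ J * (ofℕ 41 * c₀) ≈ ofℕ 82 * B * X
      Jc₀≈ = begin-equality
        ofℕ J * (ofℕ 41 * c₀)
          ≈⟨ *-congʳ (trans (ofℕ-* 2 (d ℕ.* h ℕ.* L)) (*-congˡ
              (trans (ofℕ-* (d ℕ.* h) L) (*-congʳ (ofℕ-* d h))))) ⟩
        (ofℕ 2 * (d′ * h′ * L′)) * (ofℕ 41 * (s * (ι * (B * (d′ * h′)))))
          ≈⟨ solve 6 (λ d h L s ι B → (con (+ 2) :* (d :* h :* L)) :* (con (+ 41) :* (s :* (ι :* (B :* (d :* h)))))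
               := s :* (d :* (h :* h)) :* (con (+ 82) :* B :* (ι :* (d :* L)))) refl d′ h′ L′ s ι B ⟩
        s * (d′ * (h′ * h′)) * (ofℕ 82 * B * X)
          ≈⟨ trans (*-congʳ sdhh) (*-identityˡ _) ⟩
        ofℕ 82 * B * X ∎

      decay : ofℕ 20 * ofℕ volume ≤
        ofℕ 20 * (ofℕ volume * (B * B * 1/ℕ 4)) + ofℕ 82 * B * X + ofℕ 16000 * (s * ι)
      decay = begin
        ofℕ 20 * ofℕ volume
          ≈⟨ *-congˡ a₀ ⟨
        ofℕ 20 * a 0
          -- 400 = 20² is where the first block starts.
          ≤⟨ *-monoˡ-≤ (0≤ofℕ 20) (telescope 0 400 λ i _ → early-step (i ℕ.+ 0)) ⟩
        ofℕ 20 * (a 400 + ofℕ 400 * (s * (ι * ofℕ 2)))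
          ≈⟨ solve 3 (λ a s ι → con (+ 20) :* (a :+ con (+ 400) :* (s :* (ι :* con (+ 2))))
            := con (+ 20) :* a :+ con (+ 16000) :* (s :* ι)) refl (a 400) s ι ⟩
        ofℕ 20 * a 400 + ofℕ 16000 * (s * ι)
          ≤⟨ +-monoˡ-≤ _ (blocks (J ℕ.∸ 20) (ℕₚ.≤-reflexive (ℕₚ.m∸n+n≡m 20≤J))) ⟩
        ofℕ 20 * a ((J ℕ.∸ 20 ℕ.+ 20) ℕ.* (J ℕ.∸ 20 ℕ.+ 20)) + ofℕ (J ℕ.∸ 20) * (ofℕ 41 * c₀) + ofℕ 16000 * (s * ι)
          ≤⟨ +-monoˡ-≤ _ (+-mono-≤
               (*-monoˡ-≤ (0≤ofℕ 20) (≤-trans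
                   (≤-reflexive (reflexive (≡.cong a (≡.trans (≡.cong (λ j → j ℕ.* j) (ℕₚ.m∸n+n≡m 20≤J))
                       (≡.sym KJ))))) a-final))
               (≤-trans (*-monoʳ-≤ (*-nonneg (0≤ofℕ 41) 0≤c₀) (ofℕ-mono-≤ {J ℕ.∸ 20} {J} (ℕₚ.m∸n≤m J 20)))
                   (≤-reflexive Jc₀≈))) ⟩
        ofℕ 20 * (ofℕ volume * (B * B * 1/ℕ 4)) + ofℕ 82 * B * X + ofℕ 16000 * (s * ι) ∎

    5vol≤28ιdL : ofℕ 5 * ofℕ volume ≤ ofℕ 28 * X
    5vol≤28ιdL = *-cancelˡ-ofℕ-≤ 29798 (begin
      ofℕ 29799 * (ofℕ 5 * V)
        -- The factor 10000 turns B² into 101². The final energy then amounts to 5 · 101² = 51005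
        -- copies of V, and 200000 - 51005 = 5 · 29799.
        ≈⟨ solve 1 (λ V → con (+ 29799) :* (con (+ 5) :* V)
          := con (+ 10000) :* (con (+ 20) :* V) :- con (+ 51005) :* V) refl V ⟩
      ofℕ 10000 * (ofℕ 20 * V) - ofℕ 51005 * V
        ≤⟨ +-monoˡ-≤ _ (*-monoˡ-≤ (0≤ofℕ 10000) decay) ⟩
      ofℕ 10000 * (ofℕ 20 * (V * (B * B * 1/ℕ 4)) + ofℕ 82 * B * X + ofℕ 16000 * (s * ι)) - ofℕ 51005 * V
        ≈⟨ solve 6 (λ V B i X s ι →
             con (+ 10000) :* (con (+ 20) :* (V :* (B :* B :* i)) :+ con (+ 82) :* B :* X :+ con
                 (+ 16000) :* (s :* ι)) :- con (+ 51005) :* V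
             := con (+ 5) :* (V :* ((con (+ 100) :* B) :* (con (+ 100) :* B) :* (con (+ 4) :* i))) :+ con
                 (+ 8200) :* ((con (+ 100) :* B) :* X)
                :+ con (+ 4000) :* (con (+ 40000) :* s :* ι) :- con (+ 51005) :* V) refl V B (1/ℕ 4) X s ι ⟩
      ofℕ 5 * (V * ((ofℕ 100 * B) * (ofℕ 100 * B) * (ofℕ 4 * 1/ℕ 4))) + ofℕ 8200 * ((ofℕ 100 * B) * X)
        + ofℕ 4000 * (ofℕ 40000 * s * ι) - ofℕ 51005 * V
        ≤⟨ +-monoˡ-≤ _ (+-mono-≤
             (≤-reflexive (+-cong (*-congˡ (*-congˡ (*-cong (*-cong 100B≈ 100B≈) (ofℕ-*-1/ℕ 3)))) (*-congˡ
                 (*-congʳ 100B≈))))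
             (*-monoˡ-≤ (0≤ofℕ 4000) (≤-trans (*-monoʳ-≤ 0≤ι 40000s≤1) (≤-trans
                 (≤-reflexive (*-identityˡ ι)) ι≤X)))) ⟩
      ofℕ 5 * (V * (ofℕ 101 * ofℕ 101 * 1#)) + ofℕ 8200 * (ofℕ 101 * X) + ofℕ 4000 * X - ofℕ 51005 * V
        -- 8200 · 101 + 4000 = 832200, and 28 · 29799 exceeds it by 2172; this is the whole
        -- remaining margin.
        ≤⟨ ≤-by (ofℕ 2172 * X) (*-nonneg (0≤ofℕ 2172) 0≤X)
             (solve 2 (λ V X → con (+ 5) :* (V :* (con (+ 101) :* con (+ 101) :* con (+ 1))) :+ con
                 (+ 8200) :* (con (+ 101) :* X) :+ con (+ 4000) :* X
                :- con (+ 51005) :* V :+ con (+ 2172) :* X := con (+ 29799) :* (con (+ 28) :* X)) refl V X) ⟩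
      ofℕ 29799 * (ofℕ 28 * X) ∎)
      where V = ofℕ volume

theorem3p12 : ∀ {c ℓ₁ ℓ₂} (ℝ : RealNumbers c ℓ₁ ℓ₂) →
    let open RealNumbers ℝ
        open SignedCalculus ℝ in
    ∀ {n} (G : Graph n) (S : Signature G) →
    let open Graph G in
    Connected → Unbalanced S →
    (N : Dimension) → CD S 0# N →
    (D : ℕ) → IsDiameter D →
    (q ln2 r s : Carrier) →
    IsSqrt[N-1/N] N q →
    IsLn (ofℕ 2) ln2 →
    IsSqrt ((1# + q) * ln2) r →
    IsSqrt (ofℕ ((D ℕ.+ 1) ℕ.* ⌈ D ℕ.+ 1 /2⌉)) s →
    ofℕ volume ≤ ofℕ 8 * r * (ofℕ maxDegree * ofℕ (frustrationIndex S)) * s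
theorem3p12 ℝ G S connected unbalanced N cd D diameter q ln2 r s isq isLn isr iss =
  -- A graph without cycles is vacuously balanced, so a cycle may be assumed when a contradiction is
  -- sought. It supplies the positive degrees and the test vertex for the dimension bound.
  λ lt → unbalanced λ C → ⊥-elim (bound C lt)
  where
  open RealNumbers ℝ hiding (zero)
  open OrderedField ℝ
  open ≤-Reasoning
  open SignedCalculus ℝ
  open Constants ℝ
  open Graph G
  open Degrees G

  0≤Γ₂ : ∀ f x → 0# ≤ Γ₂ S f f x
  0≤Γ₂ f x = begin
    0#
      ≤⟨ *-nonneg (1/ᴺ-nonneg N) (square-nonneg (Δ[ S ] f x)) ⟩
    1/ᴺ N * (Δ[ S ] f x * Δ[ S ] f x)
      ≈⟨ solve 2 (λ a g → a := a :+ con (+ 0) :* g) refl _ (Γ S f f x) ⟩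
    1/ᴺ N * (Δ[ S ] f x * Δ[ S ] f x) + 0# * Γ S f f x
      ≤⟨ cd f x ⟩
    Γ₂ S f f x ∎

  bound : Cycle → ofℕ volume ≤ ofℕ 8 * r * (ofℕ maxDegree * ofℕ (frustrationIndex S)) * s
  bound C = *-cancelˡ-ofℕ-≤ 4 (begin
    ofℕ 5 * ofℕ volume
      ≤⟨ 5vol≤28ιdL τ ⟩
    ofℕ 28 * (ofℕ (frustration S τ) * (ofℕ maxDegree * ofℕ (suc D)))
      ≈⟨ *-congˡ (*-cong (reflexive (≡.cong ofℕ ι≡)) (*-congˡ (reflexive (≡.cong ofℕ (ℕₚ.+-comm 1 D))))) ⟩
    ofℕ 28 * (ι * (d * ofℕ (D ℕ.+ 1)))
      ≈⟨ solve 3 (λ ι d m → con (+ 28) :* (ι :* (d :* m))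
        := con (+ 4) :* (d :* ι) :* (con (+ 7) :* m)) refl ι d (ofℕ (D ℕ.+ 1)) ⟩
    ofℕ 4 * (d * ι) * (ofℕ 7 * ofℕ (D ℕ.+ 1))
      ≤⟨ *-monoˡ-≤ (*-nonneg (0≤ofℕ 4) (*-nonneg (0≤ofℕ maxDegree) (0≤ofℕ (frustrationIndex S))))
           (7m≤10rs (D ℕ.+ 1) (proj₁ isr) (16≤15r² (proj₁ q-bounds) (proj₂ q-bounds) isLn isr) iss) ⟩
    ofℕ 4 * (d * ι) * (ofℕ 10 * (r * s))
      ≈⟨ solve 4 (λ ι d r s → con (+ 4) :* (d :* ι) :* (con (+ 10) :* (r :* s))
        := con (+ 5) :* (con (+ 8) :* r :* (d :* ι) :* s)) refl ι d r s ⟩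
    ofℕ 5 * (ofℕ 8 * r * (d * ι) * s) ∎)
    where
    d = ofℕ maxDegree
    ι = ofℕ (frustrationIndex S)
    positive : ∀ x → 0 ℕ.< degree x
    positive = cycle⇒0<degree C connected
    1≤maxDegree : 1 ℕ.≤ maxDegree
    1≤maxDegree = ℕₚ.≤-trans (positive (Cycle.vertex C zero)) (degree≤maxDegree (Cycle.vertex C zero))
    τ = proj₁ (minOverSigns-attained _ (frustration S))
    ι≡ : frustration S τ ≡ frustrationIndex S
    ι≡ = proj₂ (minOverSigns-attained _ (frustration S))
    x₀ = proj₁ (branching-neighbours C)
    q-bounds : (0# ≤ q) × (ofℕ 3 ≤ ofℕ 5 * q)
    q-bounds = 3≤5q N isq (DimensionBound.8/N≤5 ℝ S positive x₀ (proj₂ (branching-neighbours C)) {N} cd)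
    open VolumeBound ℝ S positive 0≤Γ₂ connected unbalanced diameter 1≤maxDegree degree≤maxDegree
      using (5vol≤28ιdL)
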